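{- There is an algorithm that maintains an online topological ordering of a directed acyclic graph $G$ on $n$ vertices under any sequence of arbitrary edge insertions in total time $O(n^{5/2})$, where the total time is over the entire sequence of insertions and the bound is independent of the number of edges inserted.
   Context: Online topological ordering problem: the vertex set $V$, $|V|=n$, is fixed, and the directed graph $G$ on $V$ initially has no edges. Directed edges are given (inserted) one at a time and are not known in advance; there are no parallel edges, and $G$ is a directed acyclic graph. The algorithm must maintain a function $\mathrm{ord}$ on $V$ with values in a totally ordered set such that, after each insertion, $\mathrm{ord}(x)<\mathrm{ord}(y)$ holds for every edge $(x,y)$ inserted so far (a valid topological ordering). Any ordering of $V$ is valid at the start. Running time is the worst-case total number of elementary operations (standard unit-cost RAM) over the whole insertion sequence, and the constant in $O(\cdot)$ is absolute. -}

module Defs where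

open import Data.Bool.Base using (if_then_else_)
open import Data.Fin.Base using (Fin; toℕ)
open import Data.List.Base using (List; []; _∷_; head; drop)
open import Data.List.Membership.Propositional using (_∈_)
open import Data.Maybe.Base using (just; nothing)
open import Data.Nat.Base using (ℕ; suc; _+_; _*_; _∸_; _^_; _≤_; _<_; _>_)
open import Data.Nat.Properties using (_≟_)
open import Data.Product.Base using (_×_; _,_; ∃-syntax)
open import Relation.Binary.Construct.Closure.Transitive using (TransClosure)
open import Relation.Binary.PropositionalEquality.Core using (_≡_)
open import Relation.Nullary.Decidable.Core using (⌊_⌋)
open import Relation.Nullary.Negation.Core using (¬_)

-- Directed graphs on the vertex set Fin n, given by their edges in order of
-- insertion (the head of the list is inserted first).

Edge : ℕ → Set
Edge n = Fin n × Fin n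

Adjacent : ∀ {n} → List (Edge n) → Fin n → Fin n → Set
Adjacent es x y = (x , y) ∈ es

Acyclic : ∀ {n} → List (Edge n) → Set
Acyclic es = ∀ v → ¬ TransClosure (Adjacent es) v v

-- The random access machine: a fixed program, memory cells (= registers)
-- indexed by ℕ and holding natural numbers, indirect addressing, and unit cost
-- per executed instruction.

Memory : Set
Memory = ℕ → ℕ

_[_↦_] : Memory → ℕ → ℕ → Memory
(m [ a ↦ v ]) b = if ⌊ b ≟ a ⌋ then v else m b

data Instruction : Set where
  const       : (r k : ℕ)   → Instruction
  add sub mul : (r s t : ℕ) → Instruction
  load        : (r s : ℕ)   → Instruction
  store       : (r s : ℕ)   → Instruction
  jumpIfPos   : (r l : ℕ)   → Instruction

Program : Set
Program = List Instruction

-- A program counter together with the memory.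
Config : Set
Config = ℕ × Memory

-- Machine words hold the numbers below W.  An instruction whose result does
-- not fit into a word has no successor configuration, so that unit cost cannot
-- be exploited by computing with huge numbers.  Subtraction is truncated at 0.
data Exec (W : ℕ) : Instruction → Config → Config → Set where
  const : ∀ {r k pc m} → k < W →
          Exec W (const r k) (pc , m) (suc pc , m [ r ↦ k ])
  add   : ∀ {r s t pc m} → m s + m t < W →
          Exec W (add r s t) (pc , m) (suc pc , m [ r ↦ m s + m t ])
  sub   : ∀ {r s t pc m} → m s ∸ m t < W →
          Exec W (sub r s t) (pc , m) (suc pc , m [ r ↦ m s ∸ m t ])
  mul   : ∀ {r s t pc m} → m s * m t < W →
          Exec W (mul r s t) (pc , m) (suc pc , m [ r ↦ m s * m t ])
  load  : ∀ {r s pc m} → m (m s) < W →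
          Exec W (load r s) (pc , m) (suc pc , m [ r ↦ m (m s) ])
  store : ∀ {r s pc m} → m s < W →
          Exec W (store r s) (pc , m) (suc pc , m [ m r ↦ m s ])
  jump  : ∀ {r l pc m} → m r > 0 →
          Exec W (jumpIfPos r l) (pc , m) (l , m)
  skip  : ∀ {r l pc m} → m r ≡ 0 →
          Exec W (jumpIfPos r l) (pc , m) (suc pc , m)

-- Run W P c t m : from c, the program P halts with memory m in time t.  It
-- halts when the program counter leaves the program; halting costs one unit,
-- so that no call of a program is free.
data Run (W : ℕ) (P : Program) : Config → ℕ → Memory → Set where
  halt : ∀ {pc m} → head (drop pc P) ≡ nothing → Run W P (pc , m) 1 m
  step : ∀ {pc m i c t m′} → head (drop pc P) ≡ just i →
         Exec W i (pc , m) c → Run W P c t m′ → Run W P (pc , m) (suc t) m′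

-- An online algorithm consists of two programs sharing the memory.  The first
-- is called once, with n in cell 0; the second is called for each inserted
-- edge (x , y), with x in cell 0 and y in cell 1.  The value ord v is kept in
-- cell ordBase + v.  On n vertices the machine words hold the numbers below
-- κ * n ^ κ, i.e. they have O(log n) bits.
record Algorithm : Set where
  field
    initialise insert : Program
    ordBase           : ℕ
    κ                 : ℕ

  wordLimit : ℕ → ℕ
  wordLimit n = κ * n ^ κ

  ord : ∀ {n} → Memory → Fin n → ℕ
  ord m v = m (ordBase + toℕ v)

  IsTopologicalOrdering : ∀ {n} → List (Edge n) → Memory → Set
  IsTopologicalOrdering es m = ∀ {x y} → (x , y) ∈ es → ord m x < ord m y

  -- Insertions done m es t : with the edges in done already inserted and with
  -- memory m, the edges in es are processed one after the other in total time
  -- t, and a valid ordering is stored after each of them.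
  data Insertions {n : ℕ} (done : List (Edge n)) (m : Memory) :
                  List (Edge n) → ℕ → Set where
    []   : Insertions done m [] 0
    next : ∀ {x y es m′ t t′} →
           Run (wordLimit n) insert (0 , (m [ 0 ↦ toℕ x ]) [ 1 ↦ toℕ y ]) t m′ →
           IsTopologicalOrdering ((x , y) ∷ done) m′ →
           Insertions ((x , y) ∷ done) m′ es t′ →
           Insertions done m ((x , y) ∷ es) (t + t′)

  -- On n vertices and the insertion sequence es, the algorithm maintains a
  -- topological ordering, in total time t (including the initialisation).
  MaintainsIn : (n : ℕ) → List (Edge n) → ℕ → Set
  MaintainsIn n es t =
    ∃[ t₀ ] ∃[ m ] ∃[ t₁ ]
      Run (wordLimit n) initialise (0 , (λ _ → 0) [ 0 ↦ n ]) t₀ m ×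
      Insertions [] m es t₁ ×
      t ≡ t₀ + t₁

-- t ≤ c · n^{5/2}, with both sides squared.
_≤_·_^5/2 : ℕ → ℕ → ℕ → Set
t ≤ c · n ^5/2 = t ^ 2 ≤ c ^ 2 * n ^ 5

-- Every vertex v has a level k v, and an arc (v , w) is respected if k v < k w.
-- Levels only grow: if k w ≤ k v for an arc, then k w is raised to k v + 1, and w
-- is put on a stack because its own arcs may be violated now.  The levels are
-- divided into blocks of length s ≈ √n.  When v enters a new block, all its arcs
-- are checked, in time n; while v stays in the block, only those arcs need to be
-- rechecked whose heads were in the same block, and these are kept in a list.
-- As soon as s in-neighbours of w have been in the block of w, w skips to the
-- next block.  Every level is at most the position τ of its vertex in a fixed
-- topological numbering of the final graph; for the skips this holds because s
-- distinct positions between the start of the block and τ w are taken.  So every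
-- vertex enters at most √n + 1 blocks.  Per vertex and block, the complete check
-- costs n, and at most s list entries are created, each visited at most s ≈ √n
-- times, which costs n again: altogether n · √n · n.

module Submission where

open import Data.Bool.Base using (Bool; true; false; if_then_else_; _∧_)
open import Data.Empty using (⊥; ⊥-elim)
open import Data.Fin.Base using (Fin; toℕ; zero; suc; fromℕ<; combine)
open import Data.Fin.Induction using (spo-noetherian)
open import Data.Fin.Properties
  using (toℕ<n; toℕ-injective; fromℕ<-toℕ; fromℕ<-injective; combine-injective; injective⇒≤)
import Data.Fin.Properties as Fin
open import Data.List.Base using (List; []; _∷_; _++_; head; drop; length; lookup; filter; allFin)
open import Data.List.Membership.Propositional using (_∈_; _∉_; find; lose)
open import Data.List.Membership.Propositional.Properties using (∈-filter⁺; ∈-allFin; ∈-lookup)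
open import Data.List.Properties using (filter-notAll; length-tabulate; length-++)
open import Data.List.Relation.Unary.All as All using (All; []; _∷_)
open import Data.List.Relation.Unary.AllPairs using ([]; _∷_)
open import Data.List.Relation.Unary.Any using (here; there; any?)
open import Data.List.Relation.Unary.Unique.Propositional using (Unique)
open import Data.Maybe.Base using (Maybe; just; nothing)
open import Data.Nat.Base
open import Data.Nat.DivMod using (_%_; m<n⇒m%n≡m; [m+kn]%n≡m%n)
open import Data.Nat.Properties
open import Data.Nat.Solver using (module +-*-Solver)
open import Data.Product.Base using (_×_; _,_; proj₁; proj₂; ∃-syntax; Σ-syntax)
open import Data.Product.Properties using (≡-dec)
open import Data.Sum.Base using (_⊎_; inj₁; inj₂)
open import Data.Unit.Base using (⊤; tt)
open import Function.Base using (flip; id)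
open import Induction.WellFounded using (Acc; acc; WellFounded)
open import Relation.Binary.Construct.Closure.Transitive using (TransClosure; transitive)
  renaming ([_] to [_]⁺)
open import Relation.Binary.PropositionalEquality hiding ([_])
open import Relation.Nullary using (yes; no; ¬_; ¬?)
open import Relation.Nullary.Decidable.Core using (⌊_⌋)
open import Defs

-- A structured language and its compilation

-- The time bound is proved with a potential. The list entry made for an arc (v , w) belongs to `v`,
-- but what limits the number of entries is the counter of the head `w`. So `w` pays in advance for
-- all visits that the entry can receive on the list of `v`; when its counter is full, the payment
-- comes from the block that `w` leaves. The machine cannot divide, and its words have O(log n)
-- bits. Therefore the end of each block is stored: a vertex that changes its block enters the block
-- of the arc's tail or the one after it, so a comparison and an addition give the new end. Block
-- ends also serve as time stamps in `M`: a vertex that enters a block outdates the marks of its old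
-- list without touching them. Every sum, product and address must be shown to fit into a word, yet
-- neither the lists nor the stack, which may hold a vertex several times, have an evident bound.
-- The potential bounds both, so that the time analysis also yields the space bound and is carried
-- out together with the correctness proof.

data Reg : Set where
  rV rW rS rP rI rQ rA rB : Reg

data Arr : Set where
  aK aT aC aLen aPend aFull aStk aL aM : Arr

-- A call of `insert` puts the edge into cells 0 and 1, so it starts with the tail in `rV` and the
-- head in `rW`.
cell : Reg → ℕ
cell rV = 0
cell rW = 1
cell rS = 5
cell rP = 6
cell rI = 7
cell rQ = 8
cell rA = 9
cell rB = 10

-- `aK` is column 0, so its row 0 occupies the cells 11, 12, ..., one per vertex: the levels
-- themselves are the ordering that the algorithm outputs.
column : Arr → ℕ
column aK    = 0
column aT    = 1
column aC    = 2
column aLen  = 3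
column aPend = 4
column aFull = 5
column aStk  = 6
column aL    = 7
column aM    = 8

infixr 5 _⨾_

-- A missing row operand stands for row 0.
data Cmd : Set where
  skip        : Cmd
  set         : Reg → Fin 3 → Cmd
  add sub mul : (r s t : Reg) → Cmd
  size        : Reg → Cmd
  ld st       : Reg → Arr → Maybe Reg → Reg → Cmd
  _⨾_         : Cmd → Cmd → Cmd
  if          : Reg → Cmd → Cmd → Cmd
  while       : Reg → Cmd → Cmd

record State : Set where
  constructor mkState
  field
    reg : Reg → ℕ
    arr : Arr → ℕ → ℕ → ℕ
open State

row : State → Maybe Reg → ℕ
row σ nothing  = 0
row σ (just r) = reg σ r

-- Defined by copatterns and mentioning σ only once, so that the symbolic states
-- in preconditions of long programs stay small.
assign : Reg → (State → ℕ) → State → State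
reg (assign r g σ) r′ = if ⌊ cell r′ ≟ cell r ⌋ then g σ else reg σ r′
arr (assign r g σ)    = arr σ

-- The column is compared first: for concrete arrays this test computes, and a store leaves a
-- pointwise update of one table.
write : Reg → Arr → Maybe Reg → Reg → State → State
reg (write r a i v σ)          = reg σ
arr (write r a i v σ) a′ i′ v′ =
  if (column a ≡ᵇ column a′) ∧ (row σ i ≡ᵇ i′) ∧ (reg σ v ≡ᵇ v′) then reg σ r else arr σ a′ i′ v′

≡ᵇ-refl : ∀ i → (i ≡ᵇ i) ≡ true
≡ᵇ-refl zero    = refl
≡ᵇ-refl (suc i) = ≡ᵇ-refl i

≢⇒≡ᵇ-false : ∀ {i j} → i ≢ j → (i ≡ᵇ j) ≡ false
≢⇒≡ᵇ-false {zero}  {zero}  p = ⊥-elim (p refl)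
≢⇒≡ᵇ-false {zero}  {suc j} p = refl
≢⇒≡ᵇ-false {suc i} {zero}  p = refl
≢⇒≡ᵇ-false {suc i} {suc j} p = ≢⇒≡ᵇ-false (λ q → p (cong suc q))

column<9 : ∀ a → column a < 9
column<9 aK    = s≤s z≤n
column<9 aT    = s≤s (s≤s z≤n)
column<9 aC    = s≤s (s≤s (s≤s z≤n))
column<9 aLen  = s≤s (s≤s (s≤s (s≤s z≤n)))
column<9 aPend = s≤s (s≤s (s≤s (s≤s (s≤s z≤n))))
column<9 aFull = s≤s (s≤s (s≤s (s≤s (s≤s (s≤s z≤n)))))
column<9 aStk  = s≤s (s≤s (s≤s (s≤s (s≤s (s≤s (s≤s z≤n))))))
column<9 aL    = s≤s (s≤s (s≤s (s≤s (s≤s (s≤s (s≤s (s≤s z≤n)))))))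
column<9 aM    = ≤-refl

cell<11 : ∀ r → cell r < 11
cell<11 rV = s≤s z≤n
cell<11 rW = s≤s (s≤s z≤n)
cell<11 rS = s≤s (s≤s (s≤s (s≤s (s≤s (s≤s z≤n)))))
cell<11 rP = s≤s (s≤s (s≤s (s≤s (s≤s (s≤s (s≤s z≤n))))))
cell<11 rI = s≤s (s≤s (s≤s (s≤s (s≤s (s≤s (s≤s (s≤s z≤n)))))))
cell<11 rQ = s≤s (s≤s (s≤s (s≤s (s≤s (s≤s (s≤s (s≤s (s≤s z≤n))))))))
cell<11 rA = s≤s (s≤s (s≤s (s≤s (s≤s (s≤s (s≤s (s≤s (s≤s (s≤s z≤n)))))))))
cell<11 rB = ≤-refl

digits-injective : ∀ {n} .{{_ : NonZero n}} {a b u v} → u < n → v < n →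
                   a * n + u ≡ b * n + v → a ≡ b × u ≡ v
digits-injective {n} {a} {b} {u} {v} u<n v<n eq = *-cancelʳ-≡ a b n prods , digits
  where
  remainder : ∀ c w → w < n → (c * n + w) % n ≡ w
  remainder c w w<n = trans (cong (_% n) (+-comm (c * n) w))
                     (trans ([m+kn]%n≡m%n w c n) (m<n⇒m%n≡m w<n))
  digits : u ≡ v
  digits = trans (sym (remainder a u u<n)) (trans (cong (_% n) eq) (remainder b v v<n))
  prods : a * n ≡ b * n
  prods = +-cancelʳ-≡ u (a * n) (b * n) (trans eq (cong (b * n +_) (sym digits)))

column-injective : ∀ a b → column a ≡ column b → a ≡ b
column-injective a b eq = trans (sym (inverse a)) (trans (cong name eq) (inverse b))
  where
  name : ℕ → Arr
  name 0 = aK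
  name 1 = aT
  name 2 = aC
  name 3 = aLen
  name 4 = aPend
  name 5 = aFull
  name 6 = aStk
  name 7 = aL
  name _ = aM
  inverse : ∀ a → name (column a) ≡ a
  inverse aK    = refl
  inverse aT    = refl
  inverse aC    = refl
  inverse aLen  = refl
  inverse aPend = refl
  inverse aFull = refl
  inverse aStk  = refl
  inverse aL    = refl
  inverse aM    = refl

-- Cell 2 holds n, cells 3 and 4 are scratch.
address : ℕ → Arr → ℕ → ℕ → ℕ
address n a i v = 11 + ((i * 9 + column a) * n + v)

-- A number minus itself gives row 0, so that both cases take one instruction and all address
-- computations are equally long.
rowCode : Maybe Reg → Instruction
rowCode nothing  = sub 3 3 3
rowCode (just r) = mul 3 (cell r) 3

addressCode : Arr → Maybe Reg → Reg → List Instruction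
addressCode a i v =
  const 3 9 ∷ rowCode i ∷ const 4 (column a) ∷ add 3 3 4 ∷ mul 3 3 2 ∷
  add 3 3 (cell v) ∷ const 4 11 ∷ add 3 4 3 ∷ []

-- Jump targets depend on the lengths of the parts but not on their position, hence a recursion
-- separate from `compile`. The order of the summands makes the exit `length-compile c + o` of a
-- compound agree with that of its last part up to associativity.
length-compile : Cmd → ℕ
length-compile skip         = 0
length-compile (set r k)    = 1
length-compile (add r s t)  = 1
length-compile (sub r s t)  = 1
length-compile (mul r s t)  = 1
length-compile (size r)     = 2
length-compile (ld r a i v) = 9
length-compile (st r a i v) = 9
length-compile (c ⨾ d)      = length-compile d + length-compile c
length-compile (if r c d)   = length-compile c + (3 + length-compile d)
length-compile (while r c)  = 5 + length-compile c

-- Setting cell 3 to 1 turns the conditional jump into an unconditional one.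
compile : ℕ → Cmd → List Instruction
compile o skip         = []
compile o (set r k)    = const (cell r) (toℕ k) ∷ []
compile o (add r s t)  = add (cell r) (cell s) (cell t) ∷ []
compile o (sub r s t)  = sub (cell r) (cell s) (cell t) ∷ []
compile o (mul r s t)  = mul (cell r) (cell s) (cell t) ∷ []
compile o (size r)     = const 3 0 ∷ add (cell r) 2 3 ∷ []
compile o (ld r a i v) = addressCode a i v ++ load (cell r) 3 ∷ []
compile o (st r a i v) = addressCode a i v ++ store 3 (cell r) ∷ []
compile o (c ⨾ d)      = compile o c ++ compile (length-compile c + o) d
compile o (if r c d)   =
  jumpIfPos (cell r) (3 + length-compile d + o) ∷ compile (1 + o) d ++
  const 3 1 ∷ jumpIfPos 3 (length-compile c + (3 + length-compile d) + o) ∷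
  compile (3 + length-compile d + o) c
compile o (while r c)  =
  jumpIfPos (cell r) (3 + o) ∷ const 3 1 ∷ jumpIfPos 3 (5 + length-compile c + o) ∷
  compile (3 + o) c ++ const 3 1 ∷ jumpIfPos 3 o ∷ []

-- Placement of code in a program

At : Program → ℕ → List Instruction → Set
At P o []       = ⊤
At P o (i ∷ is) = head (drop o P) ≡ just i × At P (suc o) is

At-++ : ∀ {P o} is {js} → At P o (is ++ js) → At P o is × At P (length is + o) js
At-++ [] h = tt , h
At-++ {P} {o} (i ∷ is) {js} (e , h) with At-++ is h
... | h₁ , h₂ = (e , h₁) , subst (λ p → At P p js) (+-suc (length is) o) h₂

At-drop : ∀ P o is → drop o P ≡ is → At P o is
At-drop P o []       e = tt
At-drop P o (i ∷ is) e = cong head e , At-drop P (suc o) is (drop-suc P o e)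
  where
  drop-suc : ∀ (P : Program) o {i is} → drop o P ≡ i ∷ is → drop (suc o) P ≡ is
  drop-suc (j ∷ P) zero    refl = refl
  drop-suc (j ∷ P) (suc o) e    = drop-suc P o e

length-compile-correct : ∀ o c → length (compile o c) ≡ length-compile c
length-compile-correct o skip         = refl
length-compile-correct o (set r k)    = refl
length-compile-correct o (add r s t)  = refl
length-compile-correct o (sub r s t)  = refl
length-compile-correct o (mul r s t)  = refl
length-compile-correct o (size r)     = refl
length-compile-correct o (ld r a i v) = refl
length-compile-correct o (st r a i v) = refl
length-compile-correct o (c ⨾ d) = begin
  length (compile o c ++ compile (length-compile c + o) d)
    ≡⟨ length-++ (compile o c) ⟩
  length (compile o c) + length (compile (length-compile c + o) d)
    ≡⟨ cong₂ _+_ (length-compile-correct o c) (length-compile-correct _ d) ⟩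
  length-compile c + length-compile d
    ≡⟨ +-comm (length-compile c) _ ⟩
  length-compile d + length-compile c ∎
  where open ≡-Reasoning
length-compile-correct o (if r c d) = begin
  suc (length (compile (1 + o) d ++ _ ∷ _ ∷ compile (3 + length-compile d + o) c))
    ≡⟨ cong suc (length-++ (compile (1 + o) d)) ⟩
  suc (length (compile (1 + o) d) + suc (suc (length (compile (3 + length-compile d + o) c))))
    ≡⟨ cong suc (cong₂ (λ x y → x + suc (suc y)) (length-compile-correct (1 + o) d) (length-compile-correct _ c)) ⟩
  suc (length-compile d + (2 + length-compile c))
    ≡⟨ solve 2 (λ x y → con 1 :+ (x :+ (con 2 :+ y)) := y :+ (con 3 :+ x)) refl (length-compile d) (length-compile c) ⟩
  length-compile c + (3 + length-compile d) ∎
  where open ≡-Reasoning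
        open +-*-Solver
length-compile-correct o (while r c) = begin
  3 + length (compile (3 + o) c ++ _ ∷ _ ∷ [])
    ≡⟨ cong (3 +_) (length-++ (compile (3 + o) c)) ⟩
  3 + (length (compile (3 + o) c) + 2)
    ≡⟨ cong (λ x → 3 + (x + 2)) (length-compile-correct (3 + o) c) ⟩
  3 + (length-compile c + 2)
    ≡⟨ cong (3 +_) (+-comm (length-compile c) 2) ⟩
  5 + length-compile c ∎
  where open ≡-Reasoning

drop-length-++ : ∀ (xs ys : Program) → drop (length xs) (xs ++ ys) ≡ ys
drop-length-++ []       ys = refl
drop-length-++ (x ∷ xs) ys = drop-length-++ xs ys

lookup-same : ∀ m a x → (m [ a ↦ x ]) a ≡ x
lookup-same m a x with a ≟ a
... | yes _ = refl
... | no ¬p = ⊥-elim (¬p refl)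

lookup-other : ∀ m {a b} x → b ≢ a → (m [ a ↦ x ]) b ≡ m b
lookup-other m {a} {b} x b≢a with b ≟ a
... | yes p = ⊥-elim (b≢a p)
... | no _  = refl

-- Junk on loops, which count as free.
cost : Cmd → ℕ
cost skip         = 0
cost (set r k)    = 1
cost (add r s t)  = 1
cost (sub r s t)  = 1
cost (mul r s t)  = 1
cost (size r)     = 2
cost (ld r a i v) = 9
cost (st r a i v) = 9
cost (c ⨾ d)      = cost c + cost d
cost (if r c d)   = 3 + (cost c + cost d)
cost (while r c)  = 0

-- Values computed by arithmetic and row indices are bounded by H.
module Machine (n H W : ℕ) .{{_ : NonZero n}}
  (word : 11 + ((H * 9 + 8) * n + n) < W) where

  data Eval : Cmd → State → ℕ → State → Set where
    skip    : ∀ {σ} → Eval skip σ 0 σ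
    set     : ∀ {r k σ} → Eval (set r k) σ 1 (assign r (λ _ → toℕ k) σ)
    add     : ∀ {r s t σ} → reg σ s + reg σ t ≤ H →
              Eval (add r s t) σ 1 (assign r (λ σ → reg σ s + reg σ t) σ)
    sub     : ∀ {r s t σ} → Eval (sub r s t) σ 1 (assign r (λ σ → reg σ s ∸ reg σ t) σ)
    mul     : ∀ {r s t σ} → reg σ s * reg σ t ≤ H →
              Eval (mul r s t) σ 1 (assign r (λ σ → reg σ s * reg σ t) σ)
    size    : ∀ {r σ} → Eval (size r) σ 2 (assign r (λ _ → n) σ)
    ld      : ∀ {r a i v σ} → row σ i ≤ H → reg σ v < n →
              Eval (ld r a i v) σ 9 (assign r (λ σ → arr σ a (row σ i) (reg σ v)) σ)
    st      : ∀ {r a i v σ} → row σ i ≤ H → reg σ v < n →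
              Eval (st r a i v) σ 9 (write r a i v σ)
    _⨾_     : ∀ {c d σ σ′ σ″ t t′} → Eval c σ t σ′ → Eval d σ′ t′ σ″ →
              Eval (c ⨾ d) σ (t + t′) σ″
    true    : ∀ {r c d σ σ′ t} → 0 < reg σ r → Eval c σ t σ′ → Eval (if r c d) σ (1 + t) σ′
    false   : ∀ {r c d σ σ′ t} → reg σ r ≡ 0 → Eval d σ t σ′ → Eval (if r c d) σ (1 + (t + 2)) σ′
    done    : ∀ {r c σ} → reg σ r ≡ 0 → Eval (while r c) σ 3 σ
    iterate : ∀ {r c σ σ′ σ″ t t′} → 0 < reg σ r → Eval c σ t σ′ → Eval (while r c) σ′ t′ σ″ →
              Eval (while r c) σ (1 + (t + (2 + t′))) σ″

  infix 4 _≈_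
  -- `words` speaks about all of memory because loads, stores and differences handle values that
  -- `Eval` does not bound.
  record _≈_ (m : Memory) (σ : State) : Set where
    field
      regs  : ∀ r → m (cell r) ≡ reg σ r
      arrs  : ∀ a i v → v < n → m (address n a i v) ≡ arr σ a i v
      order : m 2 ≡ n
      words : ∀ b → m b < W
  open _≈_

  11<W : 11 < W
  11<W = ≤-<-trans (m≤m+n 11 _) word

  small : ∀ {k} → k ≤ 11 → k < W
  small p = ≤-<-trans p 11<W

  n<W : n < W
  n<W = ≤-<-trans (≤-trans (m≤n+m n _) (m≤n+m _ 11)) word

  H<W : ∀ {x} → x ≤ H → x < W
  H<W {x} p = begin-strict
    x                          ≤⟨ p ⟩
    H                          ≤⟨ m≤m*n H 9 ⟩
    H * 9                      ≤⟨ m≤m+n (H * 9) 8 ⟩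
    H * 9 + 8                  ≤⟨ m≤m*n (H * 9 + 8) n ⟩
    (H * 9 + 8) * n            ≤⟨ m≤m+n _ n ⟩
    (H * 9 + 8) * n + n        ≤⟨ m≤n+m _ 11 ⟩
    11 + ((H * 9 + 8) * n + n) <⟨ word ⟩
    W                          ∎
    where open ≤-Reasoning

  address<W : ∀ a {i v} → i ≤ H → v < n → address n a i v < W
  address<W a p q = ≤-<-trans (+-monoʳ-≤ 11 (+-mono-≤
    (*-monoˡ-≤ n (+-mono-≤ (*-monoˡ-≤ 9 p) (≤-pred (column<9 a)))) (<⇒≤ q))) word

  words-update : ∀ {m} a {x} → (∀ b → m b < W) → x < W → ∀ b → (m [ a ↦ x ]) b < W
  words-update a h x<W b with b ≟ a
  ... | yes _ = x<W
  ... | no _  = h b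

  ≈-scratch₃ : ∀ {m σ x} → m ≈ σ → x < W → m [ 3 ↦ x ] ≈ σ
  ≈-scratch₃ h x<W = record
    { regs  = λ { rV → regs h rV ; rW → regs h rW ; rS → regs h rS ; rP → regs h rP
                ; rI → regs h rI ; rQ → regs h rQ ; rA → regs h rA ; rB → regs h rB }
    ; arrs  = arrs h
    ; order = order h
    ; words = words-update 3 (words h) x<W }

  ≈-scratch₄ : ∀ {m σ x} → m ≈ σ → x < W → m [ 4 ↦ x ] ≈ σ
  ≈-scratch₄ h x<W = record
    { regs  = λ { rV → regs h rV ; rW → regs h rW ; rS → regs h rS ; rP → regs h rP
                ; rI → regs h rI ; rQ → regs h rQ ; rA → regs h rA ; rB → regs h rB }
    ; arrs  = arrs h
    ; order = order h
    ; words = words-update 4 (words h) x<W }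

  ≈-reg : ∀ {m σ x} r g → m ≈ σ → x < W → x ≡ g σ → m [ cell r ↦ x ] ≈ assign r g σ
  ≈-reg {m} {σ} {x} r g h x<W refl = record
    -- `assign` decides equality of cells exactly as the update of a memory does, so both sides are
    -- the same conditional.
    { regs  = λ r′ → cong (if ⌊ cell r′ ≟ cell r ⌋ then x else_) (regs h r′)
    ; arrs  = λ a i v v<n → trans (lookup-other m x (λ e → <⇒≱ (cell<11 r) (≤-trans (m≤m+n 11 _) (≤-reflexive e)))) (arrs h a i v v<n)
    ; order = trans (lookup-other m x (cell≢2 r)) (order h)
    ; words = words-update (cell r) (words h) x<W }
    where
    cell≢2 : ∀ r → 2 ≢ cell r
    cell≢2 rV ()
    cell≢2 rW ()
    cell≢2 rS ()
    cell≢2 rP ()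
    cell≢2 rI ()
    cell≢2 rQ ()
    cell≢2 rA ()
    cell≢2 rB ()

  -- An address is an expansion with mixed radices: `n` splits off the vertex, then 9 the column.
  address-injective : ∀ a a′ {i i′ v v′} → v < n → v′ < n →
    address n a i v ≡ address n a′ i′ v′ → a ≡ a′ × i ≡ i′ × v ≡ v′
  address-injective a a′ v<n v′<n e with digits-injective v<n v′<n (+-cancelˡ-≡ 11 _ _ e)
  ... | e₁ , v≡ with digits-injective {9} (column<9 a) (column<9 a′) e₁
  ... | i≡ , a≡ = column-injective a a′ a≡ , i≡ , v≡

  ≈-arr : ∀ {m σ x b} r a o c → m ≈ σ → reg σ c < n → x < W → x ≡ reg σ r →
          b ≡ address n a (row σ o) (reg σ c) → m [ b ↦ x ] ≈ write r a o c σ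
  ≈-arr {m} {σ} {x} r a o c h v<n x<W refl refl = record
    { regs  = λ r → trans (lookup-other m x (λ e → <⇒≱ (cell<11 r) (≤-trans (m≤m+n 11 _) (≤-reflexive (sym e))))) (regs h r)
    ; arrs  = arrays
    ; order = order h
    ; words = words-update _ (words h) x<W }
    where
    i = row σ o
    v = reg σ c
    arrays : ∀ a′ i′ v′ → v′ < n →
      (m [ address n a i v ↦ x ]) (address n a′ i′ v′) ≡ arr (write r a o c σ) a′ i′ v′
    arrays a′ i′ v′ v′<n with column a ≟ column a′
    ... | no ¬p rewrite ≢⇒≡ᵇ-false ¬p =
      trans (lookup-other m x (λ e → ¬p (sym (cong column (proj₁ (address-injective a′ a {i′} {i} v′<n v<n e)))))) (arrs h a′ i′ v′ v′<n)
    ... | yes p with column-injective a a′ p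
    ... | refl rewrite ≡ᵇ-refl (column a) with i ≟ i′
    ... | no ¬p rewrite ≢⇒≡ᵇ-false ¬p =
      trans (lookup-other m x (λ e → ¬p (sym (proj₁ (proj₂ (address-injective a a {i′} {i} v′<n v<n e)))))) (arrs h a′ i′ v′ v′<n)
    ... | yes refl rewrite ≡ᵇ-refl i with v ≟ v′
    ... | no ¬p rewrite ≢⇒≡ᵇ-false ¬p =
      trans (lookup-other m x (λ e → ¬p (sym (proj₂ (proj₂ (address-injective a a {i′} {i} v′<n v<n e)))))) (arrs h a′ i′ v′ v′<n)
    ... | yes refl rewrite ≡ᵇ-refl v = lookup-same m _ x

  -- Execution of compiled code

  module _ (P : Program) where

    -- A `Run` includes the final halt, so runs do not compose. A piece of an execution is given by
    -- what it puts in front of any run.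
    record Reach (c : Config) (t : ℕ) (c′ : Config) : Set where
      constructor reach
      field
        continue : ∀ {t′ m} → Run W P c′ t′ m → Run W P c (t + t′) m
    open Reach public

    Reach-end : ∀ {c t p q m} → p ≡ q → Reach c t (p , m) → Reach c t (q , m)
    Reach-end refl f = f

    infixr 4 _▹_
    _▹_ : ∀ {c c′ c″ t t′} → Reach c t c′ → Reach c′ t′ c″ → Reach c (t + t′) c″
    _▹_ {c} {t = t} {t′} f g = reach λ {t″} {m} r →
      subst (λ u → Run W P c u m) (sym (+-assoc t t′ t″)) (continue f (continue g r))

    one : ∀ {pc m i c} → head (drop pc P) ≡ just i → Exec W i (pc , m) c → Reach (pc , m) 1 c
    one e x = reach (step e x)

    reach-address : ∀ {o m σ js} a i v → At P o (addressCode a i v ++ js) → m ≈ σ →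
      row σ i ≤ H → reg σ v < n →
      ∃[ m′ ] m′ ≈ σ × m′ 3 ≡ address n a (row σ i) (reg σ v) ×
              Reach (o , m) 8 (8 + o , m′)
    reach-address {o} {m} {σ} a i v (e₁ , e₂ , e₃ , e₄ , e₅ , e₆ , e₇ , e₈ , _) h i≤H v<n =
      m₈ , h₈ , v₈ ,
      reach λ r → step e₁ (const (small (m≤m+n 9 2))) (continue (row-step i e₂ h₁ refl i≤H)
           (step e₃ (const (small (≤-trans (<⇒≤ (column<9 a)) (m≤m+n 9 2))))
           (step e₄ (add b₄) (step e₅ (mul b₅) (step e₆ (add b₆) (step e₇ (const 11<W) (step e₈ (add b₈) r)))))))
      where
      A = reg σ v
      X = row σ i * 9
      limit : address n a (row σ i) A < W
      limit = address<W a i≤H v<n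
      b-add : X + column a < W
      b-add = ≤-<-trans (≤-trans (m≤m*n _ n) (≤-trans (m≤m+n _ A) (m≤n+m _ 11))) limit
      m₁ = m [ 3 ↦ 9 ]
      h₁ = ≈-scratch₃ h (small (m≤m+n 9 2))
      m₂ = m₁ [ 3 ↦ X ]
      h₂ = ≈-scratch₃ h₁ (≤-<-trans (m≤m+n X _) b-add)
      m₃ = m₂ [ 4 ↦ column a ]
      h₃ = ≈-scratch₄ h₂ (small (≤-trans (<⇒≤ (column<9 a)) (m≤m+n 9 2)))
      b₄ : m₃ 3 + m₃ 4 < W
      -- Looking up a literal cell computes: cell 3 holds nine times the row index, cell 4 the
      -- column.
      b₄ = b-add
      m₄ = m₃ [ 3 ↦ m₃ 3 + m₃ 4 ]
      h₄ = ≈-scratch₃ h₃ b₄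
      v₅ : m₄ 3 * m₄ 2 ≡ (X + column a) * n
      v₅ = cong ((X + column a) *_) (order h)
      b₅ : m₄ 3 * m₄ 2 < W
      b₅ = ≤-<-trans (≤-reflexive v₅) (≤-<-trans (≤-trans (m≤m+n _ A) (m≤n+m _ 11)) limit)
      m₅ = m₄ [ 3 ↦ m₄ 3 * m₄ 2 ]
      h₅ = ≈-scratch₃ h₄ b₅
      v₆ : m₅ 3 + m₅ (cell v) ≡ (X + column a) * n + A
      v₆ = cong₂ _+_ v₅ (regs h₅ v)
      b₆ : m₅ 3 + m₅ (cell v) < W
      b₆ = ≤-<-trans (≤-reflexive v₆) (≤-<-trans (m≤n+m _ 11) limit)
      m₆ = m₅ [ 3 ↦ m₅ 3 + m₅ (cell v) ]
      h₆ = ≈-scratch₃ h₅ b₆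
      m₇ = m₆ [ 4 ↦ 11 ]
      h₇ = ≈-scratch₄ h₆ 11<W
      v₈ : m₇ 4 + m₇ 3 ≡ address n a (row σ i) A
      v₈ = cong (11 +_) v₆
      b₈ : m₇ 4 + m₇ 3 < W
      b₈ = ≤-<-trans (≤-reflexive v₈) limit
      m₈ = m₇ [ 3 ↦ m₇ 4 + m₇ 3 ]
      h₈ = ≈-scratch₃ h₇ b₈
      row-step : ∀ i {m} → head (drop (suc o) P) ≡ just (rowCode i) → m ≈ σ → m 3 ≡ 9 → row σ i ≤ H →
                 Reach (suc o , m) 1 (suc (suc o) , m [ 3 ↦ row σ i * 9 ])
      row-step nothing {m} e h q p = reach λ {t} {m″} r →
        step e (sub (≤-<-trans (≤-reflexive (n∸n≡0 (m 3))) (small z≤n)))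
          (subst (λ z → Run W P (suc (suc o) , m [ 3 ↦ z ]) t m″) (sym (n∸n≡0 (m 3))) r)
      row-step (just s) {m} e h q p = reach λ {t} {m″} r →
        step e (mul (≤-<-trans (≤-reflexive eq) (≤-<-trans (≤-trans (*-monoˡ-≤ 9 p) (≤-trans (m≤m+n _ 8) (≤-trans (m≤m*n _ n) (≤-trans (m≤m+n _ n) (m≤n+m _ 11))))) word)))
          (subst (λ z → Run W P (suc (suc o) , m [ 3 ↦ z ]) t m″) (sym eq) r)
        where
        eq : m (cell s) * m 3 ≡ reg σ s * 9
        eq = cong₂ _*_ (regs h s) q

    jump-to : ∀ {o m l σ} → At P o (const 3 1 ∷ jumpIfPos 3 l ∷ []) → m ≈ σ →
              ∃[ m′ ] m′ ≈ σ × Reach (o , m) 2 (l , m′)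
    jump-to (e₁ , e₂ , _) h =
      _ , ≈-scratch₃ h 1<W , reach λ r → step e₁ (const 1<W) (step e₂ (jump (s≤s z≤n)) r)
      where
      1<W : 1 < W
      1<W = small (s≤s z≤n)

    At-take : ∀ {o} is {js} → At P o (is ++ js) → At P o is
    At-take is h = proj₁ (At-++ is h)

    At-rest : ∀ {o} c p {js} → At P p (compile o c ++ js) → At P (length-compile c + p) js
    At-rest {o} c p {js} h =
      subst (λ l → At P (l + p) js) (length-compile-correct o c) (proj₂ (At-++ (compile o c) h))

    simulation : ∀ {c σ t σ′ o m} → Eval c σ t σ′ → At P o (compile o c) → m ≈ σ →
                 ∃[ m′ ] m′ ≈ σ′ × Reach (o , m) t (length-compile c + o , m′)
    simulation skip at h = _ , h , reach λ r → r
    simulation (set {r} {k}) (e , _) h = _ , ≈-reg r _ h k<W refl , one e (const k<W)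
      where
      k<W : toℕ k < W
      k<W = small (≤-trans (<⇒≤ (toℕ<n k)) (m≤m+n 3 8))
    simulation (add {r} {s} {t} p) (e , _) h = _ , ≈-reg r (λ σ → reg σ s + reg σ t) h b eq , one e (add b)
      where
      eq = cong₂ _+_ (regs h s) (regs h t)
      b  = ≤-<-trans (≤-reflexive eq) (H<W p)
    simulation {m = m} (sub {r} {s} {t}) (e , _) h = _ , ≈-reg r (λ σ → reg σ s ∸ reg σ t) h b eq , one e (sub b)
      where
      eq = cong₂ _∸_ (regs h s) (regs h t)
      b  = ≤-<-trans (m∸n≤m (m (cell s)) (m (cell t))) (words h (cell s))
    simulation (mul {r} {s} {t} p) (e , _) h = _ , ≈-reg r (λ σ → reg σ s * reg σ t) h b eq , one e (mul b)
      where
      eq = cong₂ _*_ (regs h s) (regs h t)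
      b  = ≤-<-trans (≤-reflexive eq) (H<W p)
    simulation (size {r}) (e₁ , e₂ , _) h =
      _ , ≈-reg r _ (≈-scratch₃ h 0<W) b eq , reach λ x → step e₁ (const 0<W) (step e₂ (add b) x)
      where
      0<W = small z≤n
      eq = trans (+-identityʳ _) (order h)
      b  = ≤-<-trans (≤-reflexive eq) n<W
    simulation {σ = σ} {o = o} (ld {r} {a} {i} {v} p q) at h with reach-address {js = _ ∷ []} a i v at h p q
    ... | m′ , h′ , q′ , f =
      _ , ≈-reg r (λ σ → arr σ a (row σ i) (reg σ v)) h′ (words h′ _) (trans (cong m′ q′) (arrs h′ a (row σ i) (reg σ v) q)) ,
      f ▹ one (proj₁ (proj₂ (At-++ {P} {o} (addressCode a i v) at))) (load (words h′ _))
    simulation {σ = σ} {o = o} (st {r} {a} {i} {v} p q) at h with reach-address {js = _ ∷ []} a i v at h p q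
    ... | m′ , h′ , q′ , f =
      _ , ≈-arr r a i v h′ q (words h′ _) (regs h′ r) q′ ,
      f ▹ one (proj₁ (proj₂ (At-++ {P} {o} (addressCode a i v) at))) (store (words h′ _))
    simulation {c ⨾ d} {o = o} (x ⨾ y) at h
      with simulation x (At-take (compile o c) at) h
    ... | m₁ , h₁ , f₁ with simulation y (At-rest c o at) h₁
    ... | m₂ , h₂ , f₂ = m₂ , h₂ ,
      Reach-end (sym (+-assoc (length-compile d) (length-compile c) o))
        (f₁ ▹ f₂)
    simulation {if r c d} {o = o} (true p x) (e , at) h
      with simulation x (subst (λ l → At P (2 + l) (compile (3 + length-compile d + o) c))
              (+-suc (length-compile d) o) (proj₂ (proj₂ (At-rest d (suc o) at)))) h
    ... | m₁ , h₁ , f = m₁ , h₁ ,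
      one e (jump (subst (0 <_) (sym (regs h r)) p)) ▹
      Reach-end
        (sym (+-assoc (length-compile c) (3 + length-compile d) o)) f
    simulation {if r c d} {o = o} (false p x) (e , at) h
      with simulation x (At-take (compile (suc o) d) at) h
    ... | m₁ , h₁ , f
      with jump-to (At-take (const 3 1 ∷ jumpIfPos 3 _ ∷ []) (At-rest d (suc o) at)) h₁
    ... | m₂ , h₂ , g = m₂ , h₂ ,
      one e (skip (trans (regs h r) p)) ▹ f ▹ g
    simulation {while r c} {o = o} (done p) (e , e₁ , e₂ , at) h
      with jump-to (e₁ , e₂ , tt) h
    ... | m₁ , h₁ , f = m₁ , h₁ , one e (skip (trans (regs h r) p)) ▹ f
    -- The jump goes back to `o`, so the same placed code serves for the remaining rounds.
    simulation {while r c} {o = o} (iterate p x y) (e , e₁ , e₂ , at) h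
      with simulation x (At-take (compile (3 + o) c) at) h
    ... | m₁ , h₁ , f with jump-to (At-rest c (3 + o) at) h₁
    ... | m₂ , h₂ , g with simulation y (e , e₁ , e₂ , at) h₂
    ... | m₃ , h₃ , k = m₃ , h₃ ,
      one e (jump (subst (0 <_) (sym (regs h r)) p)) ▹ f ▹ g ▹ k

  -- For loop-free commands only: loops are never safe.
  wp : Cmd → State → (State → Set) → Set
  wp skip σ Q         = Q σ
  wp (set r k) σ Q    = Q (assign r (λ _ → toℕ k) σ)
  wp (add r s t) σ Q  = reg σ s + reg σ t ≤ H × Q (assign r (λ σ → reg σ s + reg σ t) σ)
  wp (sub r s t) σ Q  = Q (assign r (λ σ → reg σ s ∸ reg σ t) σ)
  wp (mul r s t) σ Q  = reg σ s * reg σ t ≤ H × Q (assign r (λ σ → reg σ s * reg σ t) σ)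
  wp (size r) σ Q     = Q (assign r (λ _ → n) σ)
  wp (ld r a i v) σ Q = row σ i ≤ H × reg σ v < n × Q (assign r (λ σ → arr σ a (row σ i) (reg σ v)) σ)
  wp (st r a i v) σ Q = row σ i ≤ H × reg σ v < n × Q (write r a i v σ)
  wp (c ⨾ d) σ Q      = wp c σ (λ σ′ → wp d σ′ Q)
  wp (if r c d) σ Q   = (0 < reg σ r → wp c σ Q) × (reg σ r ≡ 0 → wp d σ Q)
  wp (while r c) σ Q  = ⊥

  wp-mono : ∀ c {σ} {Q R : State → Set} → (∀ {σ} → Q σ → R σ) → wp c σ Q → wp c σ R
  wp-mono skip f h                 = f h
  wp-mono (set r k) f h            = f h
  wp-mono (add r s t) f (p , h)    = p , f h
  wp-mono (sub r s t) f h          = f h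
  wp-mono (mul r s t) f (p , h)    = p , f h
  wp-mono (size r) f h             = f h
  wp-mono (ld r a i v) f (p , q , h) = p , q , f h
  wp-mono (st r a i v) f (p , q , h) = p , q , f h
  wp-mono (c ⨾ d) f h              = wp-mono c (wp-mono d f) h
  wp-mono (if r c d) f (h , h′)    = (λ p → wp-mono c f (h p)) , (λ p → wp-mono d f (h′ p))

  -- wp c σ Q unfolds, so c, σ and Q could not be inferred without this wrapper.
  record Safe (c : Cmd) (σ : State) (Q : State → Set) : Set where
    constructor safe
    field
      unfold : wp c σ Q
  open Safe public

  consequence : ∀ {c σ Q} (R : State → Set) → Safe c σ Q → (∀ {σ′} → Q σ′ → R σ′) → wp c σ R
  consequence {c} R (safe h) f = wp-mono c f h

  Ends : Cmd → State → (ℕ → State → Set) → Set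
  Ends c σ Q = ∃[ t ] ∃[ σ′ ] Eval c σ t σ′ × Q t σ′

  eval′ : ∀ c {σ} {Q : State → Set} → wp c σ Q → Ends c σ (λ t σ′ → t ≤ cost c × Q σ′)
  eval′ skip h                   = _ , _ , skip , z≤n , h
  eval′ (set r k) h              = _ , _ , set , ≤-refl , h
  eval′ (add r s t) (p , h)      = _ , _ , add p , ≤-refl , h
  eval′ (sub r s t) h            = _ , _ , sub , ≤-refl , h
  eval′ (mul r s t) (p , h)      = _ , _ , mul p , ≤-refl , h
  eval′ (size r) h               = _ , _ , size , ≤-refl , h
  eval′ (ld r a i v) (p , q , h) = _ , _ , ld p q , ≤-refl , h
  eval′ (st r a i v) (p , q , h) = _ , _ , st p q , ≤-refl , h
  eval′ (c ⨾ d) h with eval′ c h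
  ... | _ , _ , x , p , h′ with eval′ d h′
  ... | _ , _ , y , q , h″ = _ , _ , (x ⨾ y) , +-mono-≤ p q , h″
  eval′ (if r c d) {σ} (h , h′) with reg σ r in eq
  ... | suc _ with eval′ c (h (s≤s z≤n))
  ... | t , σ′ , x , p , k = 1 + t , σ′ , true (subst (0 <_) (sym eq) (s≤s z≤n)) x ,
    +-mono-≤ {1} {3} (s≤s z≤n) (≤-trans p (m≤m+n (cost c) (cost d))) , k
  eval′ (if r c d) {σ} (h , h′) | zero with eval′ d (h′ refl)
  ... | t , σ′ , x , p , k = 1 + (t + 2) , σ′ , false eq x ,
    ≤-trans (≤-reflexive (cong suc (+-comm t 2))) (+-monoʳ-≤ 3 (≤-trans p (m≤n+m (cost d) (cost c)))) , k

  eval : ∀ {c σ Q} → Safe c σ Q → Ends c σ (λ t σ′ → t ≤ cost c × Q σ′)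
  eval {c} (safe h) = eval′ c h

  -- Φ pays for the running time: each round costs at most its decrease of Φ.
  eval-while : ∀ {r c} (Inv : State → Set) (Φ : State → ℕ) →
    (∀ {σ} → Inv σ → 0 < reg σ r → Ends c σ (λ t σ′ → Inv σ′ × 3 + t + Φ σ′ ≤ Φ σ)) →
    ∀ {σ} → Inv σ → Ends (while r c) σ (λ t σ′ → Inv σ′ × reg σ′ r ≡ 0 × t + Φ σ′ ≤ 3 + Φ σ)
  eval-while {r} {c} Inv Φ body {σ} inv = go (Φ σ) inv ≤-refl
    where
    -- A round costs at least 3, so the potential itself bounds the number of rounds.
    go : ∀ fuel {σ} → Inv σ → Φ σ ≤ fuel →
         Ends (while r c) σ (λ t σ′ → Inv σ′ × reg σ′ r ≡ 0 × t + Φ σ′ ≤ 3 + Φ σ)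
    go fuel {σ} inv le with reg σ r in eq
    go fuel {σ} inv le | zero = _ , _ , done eq , inv , eq , ≤-refl
    go fuel {σ} inv le | suc _ with body inv (subst (0 <_) (sym eq) (s≤s z≤n))
    go zero inv le | suc _ | t , σ′ , x , inv′ , drop with ≤-trans drop le
    ... | ()
    go (suc fuel) {σ} inv le | suc _ | t , σ′ , x , inv′ , drop
      with go fuel inv′ (≤-pred (≤-trans (s≤s (m≤n+m (Φ σ′) (2 + t))) (≤-trans drop le)))
    ... | t′ , σ″ , y , inv″ , eq″ , le″ = _ , σ″ , iterate (subst (0 <_) (sym eq) (s≤s z≤n)) x y ,
      inv″ , eq″ , (begin
        1 + (t + (2 + t′)) + Φ σ″  ≡⟨ solve 3 (λ a b c → con 1 :+ (a :+ (con 2 :+ b)) :+ c := con 3 :+ a :+ (b :+ c)) refl t t′ (Φ σ″) ⟩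
        3 + t + (t′ + Φ σ″)        ≤⟨ +-monoʳ-≤ (3 + t) le″ ⟩
        3 + t + (3 + Φ σ′)         ≡⟨ solve 2 (λ a b → con 3 :+ a :+ (con 3 :+ b) := con 3 :+ (con 3 :+ a :+ b)) refl t (Φ σ′) ⟩
        3 + (3 + t + Φ σ′)         ≤⟨ +-monoʳ-≤ 3 drop ⟩
        3 + Φ σ                    ∎)
      where
      open ≤-Reasoning
      open +-*-Solver

  run-program : ∀ pre c {σ t σ′ m} → Eval c σ t σ′ → m ≈ σ →
    ∃[ m′ ] m′ ≈ σ′ × Run W (pre ++ compile (length pre) c) (length pre , m) (t + 1) m′
  run-program pre c x h = finish (simulation P x (At-drop P (length pre) code (drop-length-++ pre code)) h)
    where
    code = compile (length pre) c
    P = pre ++ code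
    past-end : ∀ (xs : Program) → head (drop (length xs) xs) ≡ nothing
    past-end []       = refl
    past-end (_ ∷ xs) = past-end xs
    end : length-compile c + length pre ≡ length P
    end = trans (+-comm (length-compile c) (length pre))
         (trans (cong (length pre +_) (sym (length-compile-correct (length pre) c))) (sym (length-++ pre)))
    finish : ∀ {σ′ t m} → ∃[ m′ ] m′ ≈ σ′ × Reach P (length pre , m) t (length-compile c + length pre , m′) →
             ∃[ m′ ] m′ ≈ σ′ × Run W P (length pre , m) (t + 1) m′
    finish (m′ , h′ , f) = m′ , h′ ,
      continue f (halt (subst (λ l → head (drop l P) ≡ nothing) (sym end) (past-end P)))

-- The levels and their invariants

lookup-injective : ∀ {A : Set} {xs : List A} → Unique xs → ∀ i j → lookup xs i ≡ lookup xs j → i ≡ j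
lookup-injective (p ∷ ps) zero    zero    e = refl
lookup-injective (p ∷ ps) zero    (suc j) e = ⊥-elim (All.lookup p (∈-lookup j) e)
lookup-injective (p ∷ ps) (suc i) zero    e = ⊥-elim (All.lookup p (∈-lookup i) (sym e))
lookup-injective (p ∷ ps) (suc i) (suc j) e = cong suc (lookup-injective ps i j e)

-- Pigeonhole: the shifted values `f x ∸ a` embed the positions of the list into `Fin (b ∸ a)`.
-- Injectivity is asked on the entries only, because the topological numbering is injective only
-- below `n`.
length≤interval : ∀ {A : Set} {xs : List A} {a b} (f : A → ℕ) → Unique xs →
  All (λ x → a ≤ f x × f x < b) xs →
  (∀ {i j} → f (lookup xs i) ≡ f (lookup xs j) → lookup xs i ≡ lookup xs j) →
  length xs ≤ b ∸ a
length≤interval {xs = xs} {a} {b} f unique within injective =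
  injective⇒≤ {f = λ i → fromℕ< (position i)} λ {i} {j} e →
    lookup-injective unique i j (injective (∸-cancelʳ-≡ (proj₁ (inside i)) (proj₁ (inside j))
      (fromℕ<-injective _ _ (position i) (position j) e)))
  where
  inside : ∀ i → a ≤ f (lookup xs i) × f (lookup xs i) < b
  inside i = All.lookup within (∈-lookup i)
  position : ∀ i → f (lookup xs i) ∸ a < b ∸ a
  position i = ∸-monoˡ-< (proj₂ (inside i)) (proj₁ (inside i))

-- Finite sums and pointwise updates

Σ< : ℕ → (ℕ → ℕ) → ℕ
Σ< zero    f = 0
Σ< (suc n) f = f n + Σ< n f

Σ<-cong : ∀ n {f g} → (∀ u → u < n → g u ≡ f u) → Σ< n g ≡ Σ< n f
Σ<-cong zero    h = refl
Σ<-cong (suc n) h = cong₂ _+_ (h n ≤-refl) (Σ<-cong n (λ u p → h u (m<n⇒m<1+n p)))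

-- The slacks `a` and `b` express potential that is released or drawn at `w`, without differences of
-- natural numbers.
Σ<-change : ∀ n {f g a b w} → w < n → (∀ u → u ≢ w → g u ≡ f u) →
            g w + a ≤ f w + b → Σ< n g + a ≤ Σ< n f + b
Σ<-change (suc n) {f} {g} {a} {b} {w} w<n same le with w ≟ n
... | yes refl = begin
  g n + Σ< n g + a   ≡⟨ +-assoc (g n) _ _ ⟩
  g n + (Σ< n g + a) ≡⟨ cong (g n +_) (+-comm _ a) ⟩
  g n + (a + Σ< n g) ≡⟨ +-assoc (g n) a _ ⟨
  g n + a + Σ< n g   ≤⟨ +-mono-≤ le (≤-reflexive (Σ<-cong n (λ u p → same u (<⇒≢ p)))) ⟩
  f n + b + Σ< n f   ≡⟨ +-assoc (f n) b _ ⟩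
  f n + (b + Σ< n f) ≡⟨ cong (f n +_) (+-comm b _) ⟩
  f n + (Σ< n f + b) ≡⟨ +-assoc (f n) _ b ⟨
  f n + Σ< n f + b   ∎
  where open ≤-Reasoning
... | no ¬p = begin
  g n + Σ< n g + a   ≡⟨ +-assoc (g n) _ a ⟩
  g n + (Σ< n g + a) ≤⟨ +-mono-≤ (≤-reflexive (same n (λ e → ¬p (sym e))))
                          (Σ<-change n (≤∧≢⇒< (≤-pred w<n) ¬p) same le) ⟩
  f n + (Σ< n f + b) ≡⟨ +-assoc (f n) _ b ⟨
  f n + Σ< n f + b   ∎
  where open ≤-Reasoning

Σ<-const : ∀ n {f} x → (∀ u → u < n → f u ≡ x) → Σ< n f ≡ n * x
Σ<-const zero    x h = refl
Σ<-const (suc n) x h = cong₂ _+_ (h n ≤-refl) (Σ<-const n x (λ u p → h u (m<n⇒m<1+n p)))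

Σ<-member : ∀ n {f u} → u < n → f u ≤ Σ< n f
Σ<-member (suc n) {f} {u} u<n with u ≟ n
... | yes refl = m≤m+n _ _
... | no ¬p    = ≤-trans (Σ<-member n (≤∧≢⇒< (≤-pred u<n) ¬p)) (m≤n+m _ (f n))

infix 9 _⟦_↦_⟧ _⟦_#_↦_⟧

-- These are the conditionals that `write` leaves, so the `contents` of a state after a store are by
-- computation the updated `Levels`.
_⟦_↦_⟧ : (ℕ → ℕ) → ℕ → ℕ → ℕ → ℕ
(f ⟦ v ↦ x ⟧) u = if v ≡ᵇ u then x else f u

_⟦_#_↦_⟧ : (ℕ → ℕ → ℕ) → ℕ → ℕ → ℕ → ℕ → ℕ → ℕ
(f ⟦ i # v ↦ x ⟧) j u = if (i ≡ᵇ j) ∧ (v ≡ᵇ u) then x else f j u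

at-same : ∀ f v x → (f ⟦ v ↦ x ⟧) v ≡ x
at-same f v x rewrite ≡ᵇ-refl v = refl

at-other : ∀ f {v u} x → v ≢ u → (f ⟦ v ↦ x ⟧) u ≡ f u
at-other f x p rewrite ≢⇒≡ᵇ-false p = refl

at-same₂ : ∀ f i v x → (f ⟦ i # v ↦ x ⟧) i v ≡ x
at-same₂ f i v x rewrite ≡ᵇ-refl i | ≡ᵇ-refl v = refl

at-row : ∀ f {i j} v u x → i ≢ j → (f ⟦ i # v ↦ x ⟧) j u ≡ f j u
at-row f v u x p rewrite ≢⇒≡ᵇ-false p = refl

at-column : ∀ f i j {v u} x → v ≢ u → (f ⟦ i # v ↦ x ⟧) j u ≡ f j u
at-column f i j x p rewrite ≢⇒≡ᵇ-false p with i ≡ᵇ j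
... | true  = refl
... | false = refl

-- k v is the level of v and t v the end of its block: t v is the multiple of s
-- with k v < t v ≤ k v + s.  Row i of L holds the i-th entries of the lists of
-- the vertices, where the list of v has length len v.  M w v is 0 if there is
-- no arc from v to w; otherwise it is 1 or the last block in which w was put on
-- the list of v.  c w counts the v with M w v ≡ t w.
record Levels : Set where
  constructor levels
  field
    k t c len pend full : ℕ → ℕ
    L M                 : ℕ → ℕ → ℕ
open Levels

raise : Levels → ℕ → ℕ → Levels
raise D w q = record D { k = k D ⟦ w ↦ q ⟧ ; pend = pend D ⟦ w ↦ 1 ⟧ }

-- `M` keeps its marks: those of the discarded list are at most the old block end of `w`, hence
-- differ from `t′`. Setting `full` requests the scan of all arcs.
advance : Levels → ℕ → ℕ → ℕ → Levels
advance D w q t′ = record D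
  { k = k D ⟦ w ↦ q ⟧ ; pend = pend D ⟦ w ↦ 1 ⟧ ; t = t D ⟦ w ↦ t′ ⟧
  ; c = c D ⟦ w ↦ 0 ⟧ ; len = len D ⟦ w ↦ 0 ⟧ ; full = full D ⟦ w ↦ 1 ⟧ }

append : Levels → ℕ → ℕ → Levels
append D v w = record D
  { M = M D ⟦ w # v ↦ t D v ⟧ ; L = L D ⟦ len D v # v ↦ w ⟧ ; len = len D ⟦ v ↦ len D v + 1 ⟧ }

count : Levels → ℕ → Levels
count D w = record D { c = c D ⟦ w ↦ c D w + 1 ⟧ }

connect : Levels → ℕ → ℕ → Levels
connect D v w = record D { M = M D ⟦ w # v ↦ 1 ⟧ }

settle : Levels → ℕ → Levels
settle D v = record D { pend = pend D ⟦ v ↦ 0 ⟧ }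

unfill : Levels → ℕ → Levels
unfill D v = record D { full = full D ⟦ v ↦ 0 ⟧ }

module Levelled (n s : ℕ) (2≤s : 2 ≤ s) (n≤s² : n ≤ s * s) (τ : ℕ → ℕ)
  (τ<n : ∀ {u} → u < n → τ u < n)
  (τ-injective : ∀ {u v} → u < n → v < n → τ u ≡ τ v → u ≡ v) where

  -- A list of witnesses gives a lower bound, which is what the skip to the next block relies on. It
  -- allows the counter to lag behind the marks in the middle of a program.
  Counted : Levels → ℕ → ℕ → Set
  Counted D w l = ∃[ us ] Unique us × All (λ u → u < n × M D w u ≡ t D w) us × length us ≡ l

  record Core (D : Levels) : Set where
    field
      k<t    : ∀ {u} → u < n → k D u < t D u
      t≤k+s  : ∀ {u} → u < n → t D u ≤ k D u + s
      t-mult : ∀ {u} → u < n → ∃[ q ] t D u ≡ q * s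
      k≤τ    : ∀ {u} → u < n → k D u ≤ τ u
      arc-τ  : ∀ {u w} → u < n → w < n → 0 < M D w u → τ u < τ w
      M≤t    : ∀ {u w} → u < n → w < n → M D w u ≤ t D u
      counts : ∀ {w} → w < n → Counted D w (c D w)
      c<s    : ∀ {w} → w < n → c D w < s
      listed : ∀ {u w} → u < n → w < n → M D w u ≡ t D u → ∃[ i ] i < len D u × L D i u ≡ w
      entry  : ∀ {u i} → u < n → i < len D u → L D i u < n × 0 < M D (L D i u) u
      pend≤1 : ∀ {u} → u < n → pend D u ≤ 1
  open Core public

  -- The first case lasts as long as `u` stays in its block, since block ends only grow; the second
  -- puts the arc on the list of `u`.
  Near : Levels → ℕ → ℕ → Set
  Near D u w = t D u < t D w ⊎ M D w u ≡ t D u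

  -- `pend` excuses a violated arc, `full` a missing list entry. A vertex that has just entered a
  -- block has both flags set.
  OK : Levels → ℕ → ℕ → Set
  OK D u w = 0 < M D w u → (pend D u ≡ 0 → k D u < k D w) × (full D u ≡ 0 → Near D u w)

  -- What a scan of `u` achieves. The flags are absent because they are cleared only when the scan
  -- is over.
  Good : Levels → ℕ → ℕ → Set
  Good D u w = 0 < M D w u → k D u < k D w × Near D u w

  multiple-gap : ∀ {a b} → ∃[ q ] a ≡ q * s → ∃[ q ] b ≡ q * s → a < b → a + s ≤ b
  multiple-gap (p , refl) (q , refl) lt = begin
    p * s + s   ≡⟨ +-comm (p * s) s ⟩
    suc p * s   ≤⟨ *-monoˡ-≤ s (*-cancelʳ-< s p q lt) ⟩
    q * s       ∎
    where open ≤-Reasoning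

  s≤multiple : ∀ {a} → ∃[ q ] a ≡ q * s → 0 < a → s ≤ a
  s≤multiple (suc q , refl) lt = m≤m+n s (q * s)

  s≤t : ∀ {D} → Core D → ∀ {u} → u < n → s ≤ t D u
  s≤t C u<n = s≤multiple (t-mult C u<n) (≤-<-trans z≤n (k<t C u<n))

  -- Distinct multiples of `s` give t u + s ≤ t w ≤ k w + s, hence k u < t u ≤ k w.
  t<t⇒k<k : ∀ {D} → Core D → ∀ {u w} → u < n → w < n → t D u < t D w → k D u < k D w
  t<t⇒k<k {D} C {u} {w} u<n w<n lt = ≤-trans (k<t C u<n)
    (+-cancelʳ-≤ s (t D u) (k D w) (≤-trans (multiple-gap (t-mult C u<n) (t-mult C w<n) lt) (t≤k+s C w<n)))

  k<k⇒t≤t : ∀ {D} → Core D → ∀ {u w} → u < n → w < n → k D u < k D w → t D u ≤ t D w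
  k<k⇒t≤t C u<n w<n lt = ≮⇒≥ λ t<t → <-asym lt (t<t⇒k<k C w<n u<n t<t)

  -- The in-neighbours in us have levels at least t w ∸ s, so their positions in
  -- the topological numbering τ lie between t w ∸ s and τ w.
  jump≤τ : ∀ {D} → Core D → ∀ {w} → w < n → Counted D w s → t D w ≤ τ w
  jump≤τ {D} C {w} w<n (us , unique , marked , refl) = begin
    t D w                 ≡⟨ m∸n+n≡m (s≤t C w<n) ⟨
    t D w ∸ s + s         ≤⟨ +-monoʳ-≤ (t D w ∸ s) (length≤interval τ unique (All.map inside marked)
                               λ {i} {j} → τ-injective (bound i) (bound j)) ⟩
    t D w ∸ s + (τ w ∸ (t D w ∸ s)) ≡⟨ m+[n∸m]≡n (base) ⟩
    τ w                   ∎
    where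
    open ≤-Reasoning
    bound : ∀ i → lookup us i < n
    bound i = proj₁ (All.lookup marked (∈-lookup i))
    inside : ∀ {u} → u < n × M D w u ≡ t D w → t D w ∸ s ≤ τ u × τ u < τ w
    inside {u} (u<n , e) =
      -- `u` may have left the block since it was marked, but only upwards: t w = M w u ≤ t u ≤ k u
      -- + s.
      ≤-trans (m≤n+o⇒m∸n≤o (t D w) s (≤-trans (≤-reflexive (sym e))
        (≤-trans (M≤t C u<n w<n) (≤-trans (t≤k+s C u<n) (≤-reflexive (+-comm (k D u) s)))))) (k≤τ C u<n) ,
      arc-τ C u<n w<n (subst (0 <_) (sym e) (≤-<-trans z≤n (k<t C w<n)))
    base : t D w ∸ s ≤ τ w
    base = ≤-trans (m≤n+o⇒m∸n≤o (t D w) s (≤-trans (t≤k+s C w<n) (≤-reflexive (+-comm (k D w) s)))) (k≤τ C w<n)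

  module _ {D w q} (C : Core D) (w<n : w < n) (k<q : k D w < q) (q≤τ : q ≤ τ w) where

    raise-core : q < t D w → Core (raise D w q)
    raise-core q<t = record
      { k<t    = λ {u} → k<t′ u
      ; t≤k+s  = λ {u} → t≤k+s′ u
      ; t-mult = t-mult C
      ; k≤τ    = λ {u} → k≤τ′ u
      ; arc-τ  = arc-τ C
      ; M≤t    = M≤t C
      ; counts = counts C
      ; c<s    = c<s C
      ; listed = listed C
      ; entry  = entry C
      ; pend≤1 = λ {u} → pend≤1′ u }
      where
      D′ = raise D w q
      k<t′ : ∀ u → u < n → k D′ u < t D′ u
      k<t′ u u<n with w ≟ u
      ... | yes refl rewrite ≡ᵇ-refl w = q<t
      ... | no ¬p rewrite ≢⇒≡ᵇ-false ¬p = k<t C u<n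
      t≤k+s′ : ∀ u → u < n → t D′ u ≤ k D′ u + s
      t≤k+s′ u u<n with w ≟ u
      ... | yes refl rewrite ≡ᵇ-refl w = ≤-trans (t≤k+s C u<n) (+-monoˡ-≤ s (<⇒≤ k<q))
      ... | no ¬p rewrite ≢⇒≡ᵇ-false ¬p = t≤k+s C u<n
      k≤τ′ : ∀ u → u < n → k D′ u ≤ τ u
      k≤τ′ u u<n with w ≟ u
      ... | yes refl rewrite ≡ᵇ-refl w = q≤τ
      ... | no ¬p rewrite ≢⇒≡ᵇ-false ¬p = k≤τ C u<n
      pend≤1′ : ∀ u → u < n → pend D′ u ≤ 1
      pend≤1′ u u<n with w ≟ u
      ... | yes refl rewrite ≡ᵇ-refl w = ≤-refl
      ... | no ¬p rewrite ≢⇒≡ᵇ-false ¬p = pend≤1 C u<n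

    raise-good : ∀ {a b} → a ≢ w → Good D a b → Good (raise D w q) a b
    raise-good {a} {b} a≢w h arc rewrite ≢⇒≡ᵇ-false (λ e → a≢w (sym e)) with w ≟ b
    ... | yes refl rewrite ≡ᵇ-refl w = <-trans (proj₁ (h arc)) k<q , proj₂ (h arc)
    ... | no ¬p rewrite ≢⇒≡ᵇ-false ¬p = h arc

    -- As a tail, `w` is excused by its new `pend`; as a head, it only moves up.
    raise-ok : ∀ {a b} → OK D a b → OK (raise D w q) a b
    raise-ok {a} {b} h arc with w ≟ a
    ... | yes refl rewrite ≡ᵇ-refl w = (λ ()) , proj₂ (h arc)
    ... | no ¬p rewrite ≢⇒≡ᵇ-false ¬p with w ≟ b
    ... | yes refl rewrite ≡ᵇ-refl w = (λ z → <-trans (proj₁ (h arc) z) k<q) , proj₂ (h arc)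
    ... | no ¬p′ rewrite ≢⇒≡ᵇ-false ¬p′ = h arc

    module _ {t′} (t+s≤t′ : t D w + s ≤ t′) (q<t′ : q < t′) (t′≤q+s : t′ ≤ q + s)
                  (mult : ∃[ i ] t′ ≡ i * s) where

      t<t′ : t D w < t′
      t<t′ = <-≤-trans (m<m+n (t D w) (≤-trans (s≤s z≤n) 2≤s)) t+s≤t′

      advance-core : Core (advance D w q t′)
      advance-core = record
        { k<t    = λ {u} → k<t′ u
        ; t≤k+s  = λ {u} → t≤k+s′ u
        ; t-mult = λ {u} → t-mult′ u
        ; k≤τ    = λ {u} → k≤τ′ u
        ; arc-τ  = arc-τ C
        ; M≤t    = λ {u} {b} → M≤t′ u b
        ; counts = λ {u} → counts′ u
        ; c<s    = λ {u} → c<s′ u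
        ; listed = λ {u} {b} → listed′ u b
        ; entry  = λ {u} {i} → entry′ u i
        ; pend≤1 = λ {u} → pend≤1′ u }
        where
        D′ = advance D w q t′
        k<t′ : ∀ u → u < n → k D′ u < t D′ u
        k<t′ u u<n with w ≟ u
        ... | yes refl rewrite ≡ᵇ-refl w = q<t′
        ... | no ¬p rewrite ≢⇒≡ᵇ-false ¬p = k<t C u<n
        t≤k+s′ : ∀ u → u < n → t D′ u ≤ k D′ u + s
        t≤k+s′ u u<n with w ≟ u
        ... | yes refl rewrite ≡ᵇ-refl w = t′≤q+s
        ... | no ¬p rewrite ≢⇒≡ᵇ-false ¬p = t≤k+s C u<n
        t-mult′ : ∀ u → u < n → ∃[ i ] t D′ u ≡ i * s
        t-mult′ u u<n with w ≟ u
        ... | yes refl rewrite ≡ᵇ-refl w = mult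
        ... | no ¬p rewrite ≢⇒≡ᵇ-false ¬p = t-mult C u<n
        k≤τ′ : ∀ u → u < n → k D′ u ≤ τ u
        k≤τ′ u u<n with w ≟ u
        ... | yes refl rewrite ≡ᵇ-refl w = q≤τ
        ... | no ¬p rewrite ≢⇒≡ᵇ-false ¬p = k≤τ C u<n
        M≤t′ : ∀ u b → u < n → b < n → M D b u ≤ t D′ u
        M≤t′ u b u<n b<n with w ≟ u
        ... | yes refl rewrite ≡ᵇ-refl w = ≤-trans (M≤t C u<n b<n) (<⇒≤ t<t′)
        ... | no ¬p rewrite ≢⇒≡ᵇ-false ¬p = M≤t C u<n b<n
        counts′ : ∀ u → u < n → Counted D′ u (c D′ u)
        counts′ u u<n with w ≟ u
        ... | yes refl rewrite ≡ᵇ-refl w = [] , [] , [] , refl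
        ... | no ¬p rewrite ≢⇒≡ᵇ-false ¬p = counts C u<n
        c<s′ : ∀ u → u < n → c D′ u < s
        c<s′ u u<n with w ≟ u
        ... | yes refl rewrite ≡ᵇ-refl w = ≤-trans (s≤s z≤n) 2≤s
        ... | no ¬p rewrite ≢⇒≡ᵇ-false ¬p = c<s C u<n
        listed′ : ∀ u b → u < n → b < n → M D b u ≡ t D′ u → ∃[ i ] i < len D′ u × L D i u ≡ b
        listed′ u b u<n b<n with w ≟ u
        ... | yes refl rewrite ≡ᵇ-refl w = λ e → ⊥-elim (<⇒≱ t<t′ (≤-trans (≤-reflexive (sym e)) (M≤t C u<n b<n)))
        ... | no ¬p rewrite ≢⇒≡ᵇ-false ¬p = listed C u<n b<n
        entry′ : ∀ u i → u < n → i < len D′ u → L D i u < n × 0 < M D (L D i u) u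
        entry′ u i u<n with w ≟ u
        ... | yes refl rewrite ≡ᵇ-refl w = λ ()
        ... | no ¬p rewrite ≢⇒≡ᵇ-false ¬p = entry C u<n
        pend≤1′ : ∀ u → u < n → pend D′ u ≤ 1
        pend≤1′ u u<n with w ≟ u
        ... | yes refl rewrite ≡ᵇ-refl w = ≤-refl
        ... | no ¬p rewrite ≢⇒≡ᵇ-false ¬p = pend≤1 C u<n

      advance-good : ∀ {a b} → a ≢ w → Good D a b → Good (advance D w q t′) a b
      advance-good {a} {b} a≢w h arc rewrite ≢⇒≡ᵇ-false (λ e → a≢w (sym e)) with w ≟ b
      ... | yes refl rewrite ≡ᵇ-refl w = <-trans (proj₁ (h arc)) k<q , later (proj₂ (h arc))
        where
        later : Near D a w → t D a < t′ ⊎ M D w a ≡ t D a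
        later (inj₁ lt) = inj₁ (<-trans lt t<t′)
        later (inj₂ e)  = inj₂ e
      ... | no ¬p rewrite ≢⇒≡ᵇ-false ¬p = h arc

      advance-ok : ∀ {a b} → OK D a b → OK (advance D w q t′) a b
      advance-ok {a} {b} h arc with w ≟ a
      ... | yes refl rewrite ≡ᵇ-refl w = (λ ()) , (λ ())
      ... | no ¬p rewrite ≢⇒≡ᵇ-false ¬p with w ≟ b
      ... | yes refl rewrite ≡ᵇ-refl w = (λ z → <-trans (proj₁ (h arc) z) k<q) , (λ z → later (proj₂ (h arc) z))
        where
        later : Near D a w → t D a < t′ ⊎ M D w a ≡ t D a
        later (inj₁ lt) = inj₁ (<-trans lt t<t′)
        later (inj₂ e)  = inj₂ e
      ... | no ¬p′ rewrite ≢⇒≡ᵇ-false ¬p′ = h arc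

  module _ {D} (C : Core D) where

    module _ {v w} (v<n : v < n) (w<n : w < n) (arc : 0 < M D w v)
             (t≡t : t D v ≡ t D w) (unmarked : M D w v ≢ t D v) where

      append-arc← : ∀ {a b} → 0 < M (append D v w) b a → 0 < M D b a
      append-arc← {a} {b} h with w ≟ b
      ... | no ¬p rewrite ≢⇒≡ᵇ-false ¬p = h
      ... | yes refl rewrite ≡ᵇ-refl w with v ≟ a
      ... | no ¬p rewrite ≢⇒≡ᵇ-false ¬p = h
      ... | yes refl = arc

      append-arc→ : ∀ {a b} → 0 < M D b a → 0 < M (append D v w) b a
      append-arc→ {a} {b} h with w ≟ b
      ... | no ¬p rewrite ≢⇒≡ᵇ-false ¬p = h
      ... | yes refl rewrite ≡ᵇ-refl w with v ≟ a
      ... | no ¬p rewrite ≢⇒≡ᵇ-false ¬p = h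
      ... | yes refl rewrite ≡ᵇ-refl v = ≤-<-trans z≤n (k<t C v<n)

      -- The cell overwritten in row `w` receives `t v`, which is also `t w`, so the marks counted
      -- by `w` survive.
      append-marks : ∀ {a b} → M D b a ≡ t D b → M (append D v w) b a ≡ t D b
      append-marks {a} {b} h with w ≟ b
      ... | no ¬p rewrite ≢⇒≡ᵇ-false ¬p = h
      ... | yes refl rewrite ≡ᵇ-refl w with v ≟ a
      ... | no ¬p rewrite ≢⇒≡ᵇ-false ¬p = h
      ... | yes refl rewrite ≡ᵇ-refl v = t≡t

      append-near : ∀ {a b} → Near D a b → Near (append D v w) a b
      append-near (inj₁ lt) = inj₁ lt
      append-near {a} {b} (inj₂ e) with w ≟ b
      ... | no ¬p rewrite ≢⇒≡ᵇ-false ¬p = inj₂ e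
      ... | yes refl rewrite ≡ᵇ-refl w with v ≟ a
      ... | no ¬p rewrite ≢⇒≡ᵇ-false ¬p = inj₂ e
      ... | yes refl rewrite ≡ᵇ-refl v = inj₂ refl

      append-good : ∀ {a b} → Good D a b → Good (append D v w) a b
      append-good h arc′ = proj₁ (h (append-arc← arc′)) , append-near (proj₂ (h (append-arc← arc′)))

      append-ok : ∀ {a b} → OK D a b → OK (append D v w) a b
      append-ok h arc′ = proj₁ (h (append-arc← arc′)) , λ z → append-near (proj₂ (h (append-arc← arc′)) z)

      append-counted : ∀ {b} → Counted D b (c D b) → Counted (append D v w) b (c D b)
      append-counted (us , unique , marked , e) =
        us , unique , All.map (λ (u<n , e) → u<n , append-marks e) marked , e

      append-counted-suc : Counted (append D v w) w (c D w + 1)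
      append-counted-suc with counts C w<n
      ... | us , unique , marked , e = v ∷ us ,
        -- `v` is not yet among the witnesses, since its mark differed from the common block end.
        All.map (λ { (_ , e) refl → unmarked (trans e (sym t≡t)) }) marked ∷ unique ,
        (v<n , trans (at-same₂ (M D) w v (t D v)) t≡t) ∷ All.map (λ (u<n , e) → u<n , append-marks e) marked ,
        trans (cong suc e) (+-comm 1 (c D w))

      append-core : Core (append D v w)
      append-core = record
        { k<t    = k<t C
        ; t≤k+s  = t≤k+s C
        ; t-mult = t-mult C
        ; k≤τ    = k≤τ C
        ; arc-τ  = λ a<n b<n h → arc-τ C a<n b<n (append-arc← h)
        ; M≤t    = λ {a} {b} → M≤t′ a b
        ; counts = λ w<n → append-counted (counts C w<n)
        ; c<s    = c<s C
        ; listed = λ {a} {b} → listed′ a b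
        ; entry  = λ {a} {i} → entry′ a i
        ; pend≤1 = pend≤1 C }
        where
        D′ = append D v w
        M≤t′ : ∀ a b → a < n → b < n → M D′ b a ≤ t D a
        M≤t′ a b a<n b<n with w ≟ b
        ... | no ¬p rewrite ≢⇒≡ᵇ-false ¬p = M≤t C a<n b<n
        ... | yes refl rewrite ≡ᵇ-refl w with v ≟ a
        ... | no ¬p rewrite ≢⇒≡ᵇ-false ¬p = M≤t C a<n b<n
        ... | yes refl rewrite ≡ᵇ-refl v = ≤-refl
        keep : ∀ a b → ∃[ i ] i < len D a × L D i a ≡ b → ∃[ i ] i < len D′ a × L D′ i a ≡ b
        keep a b (i , lt , e) with v ≟ a
        ... | no ¬p = i , subst (i <_) (sym (at-other (len D) _ ¬p)) lt , trans (at-column (L D) (len D v) i w ¬p) e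
        ... | yes refl = i , subst (i <_) (sym (at-same (len D) v _)) (≤-trans lt (m≤m+n _ 1)) ,
                         trans (at-row (L D) v v w (λ e → <⇒≢ lt (sym e))) e
        listed′ : ∀ a b → a < n → b < n → M D′ b a ≡ t D a → ∃[ i ] i < len D′ a × L D′ i a ≡ b
        listed′ a b a<n b<n h with w ≟ b
        ... | no ¬p = keep a b (listed C a<n b<n (trans (sym (at-row (M D) v a (t D v) ¬p)) h))
        ... | yes refl with v ≟ a
        ... | no ¬p = keep a w (listed C a<n b<n (trans (sym (at-column (M D) w w (t D v) ¬p)) h))
        ... | yes refl = len D v , subst (len D v <_) (sym (at-same (len D) v _)) (m<m+n (len D v) (s≤s z≤n)) ,
                         at-same₂ (L D) (len D v) v w
        entry′ : ∀ a i → a < n → i < len D′ a → L D′ i a < n × 0 < M D′ (L D′ i a) a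
        entry′ a i a<n lt with v ≟ a
        ... | no ¬p = old (at-column (L D) (len D v) i w ¬p) (entry C a<n (subst (i <_) (at-other (len D) _ ¬p) lt))
          where
          old : ∀ {x y} → x ≡ y → y < n × 0 < M D y a → x < n × 0 < M D′ x a
          old refl (p , q) = p , append-arc→ q
        ... | yes refl with len D v ≟ i
        ... | yes refl = last (at-same₂ (L D) (len D v) v w)
          where
          last : ∀ {x} → x ≡ w → x < n × 0 < M D′ x v
          last refl = w<n , subst (0 <_) (sym (at-same₂ (M D) w v (t D v))) (≤-<-trans z≤n (k<t C v<n))
        ... | no ¬p = old (at-row (L D) v v w ¬p) (entry C a<n
              (≤∧≢⇒< (≤-pred (subst (i <_) (trans (at-same (len D) v _) (+-comm (len D v) 1)) lt)) (λ e → ¬p (sym e))))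
          where
          old : ∀ {x y} → x ≡ y → y < n × 0 < M D y v → x < n × 0 < M D′ x v
          old refl (p , q) = p , append-arc→ q

    count-core : ∀ {w} → Counted D w (c D w + 1) → c D w + 1 < s → Core (count D w)
    count-core {w} counted lt = record
      { k<t    = k<t C
      ; t≤k+s  = t≤k+s C
      ; t-mult = t-mult C
      ; k≤τ    = k≤τ C
      ; arc-τ  = arc-τ C
      ; M≤t    = M≤t C
      ; counts = λ {u} → counts′ u
      ; c<s    = λ {u} → c<s′ u
      ; listed = listed C
      ; entry  = entry C
      ; pend≤1 = pend≤1 C }
      where
      D′ = count D w
      counts′ : ∀ u → u < n → Counted D′ u (c D′ u)
      counts′ u u<n with w ≟ u
      ... | yes refl rewrite ≡ᵇ-refl w = counted
      ... | no ¬p rewrite ≢⇒≡ᵇ-false ¬p = counts C u<n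
      c<s′ : ∀ u → u < n → c D′ u < s
      c<s′ u u<n with w ≟ u
      ... | yes refl rewrite ≡ᵇ-refl w = lt
      ... | no ¬p rewrite ≢⇒≡ᵇ-false ¬p = c<s C u<n

    module _ {v w} (v<n : v < n) (w<n : w < n) (new : M D w v ≡ 0) where

      connect-arc→ : ∀ {a b} → 0 < M D b a → 0 < M (connect D v w) b a
      connect-arc→ {a} {b} h with w ≟ b
      ... | no ¬p rewrite ≢⇒≡ᵇ-false ¬p = h
      ... | yes refl rewrite ≡ᵇ-refl w with v ≟ a
      ... | no ¬p rewrite ≢⇒≡ᵇ-false ¬p = h
      ... | yes refl rewrite ≡ᵇ-refl v = s≤s z≤n

      connect-ok : ∀ {a b} → ¬ (a ≡ v × b ≡ w) → OK D a b → OK (connect D v w) a b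
      connect-ok {a} {b} other h arc′ with w ≟ b
      ... | no ¬p rewrite ≢⇒≡ᵇ-false ¬p = h arc′
      ... | yes refl rewrite ≡ᵇ-refl w with v ≟ a
      ... | no ¬p rewrite ≢⇒≡ᵇ-false ¬p = h arc′
      ... | yes refl = ⊥-elim (other (refl , refl))

      connect-core : τ v < τ w → Core (connect D v w)
      connect-core τ<τ = record
        { k<t    = k<t C
        ; t≤k+s  = t≤k+s C
        ; t-mult = t-mult C
        ; k≤τ    = k≤τ C
        ; arc-τ  = λ {a} {b} → arc-τ′ a b
        ; M≤t    = λ {a} {b} → M≤t′ a b
        ; counts = λ {b} b<n → counts′ b (counts C b<n) b<n
        ; c<s    = c<s C
        -- A cell that equals a block end is at least 2, so it is not the fresh mark 1.
        ; listed = λ {a} {b} a<n b<n e → listed C a<n b<n (mark b a (t D a) (≤-trans 2≤s (s≤t C a<n)) e)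
        ; entry  = λ a<n lt → proj₁ (entry C a<n lt) , connect-arc→ (proj₂ (entry C a<n lt))
        ; pend≤1 = pend≤1 C }
        where
        D′ = connect D v w
        arc-τ′ : ∀ a b → a < n → b < n → 0 < M D′ b a → τ a < τ b
        arc-τ′ a b a<n b<n h with w ≟ b
        ... | no ¬p rewrite ≢⇒≡ᵇ-false ¬p = arc-τ C a<n b<n h
        ... | yes refl rewrite ≡ᵇ-refl w with v ≟ a
        ... | no ¬p rewrite ≢⇒≡ᵇ-false ¬p = arc-τ C a<n b<n h
        ... | yes refl = τ<τ
        M≤t′ : ∀ a b → a < n → b < n → M D′ b a ≤ t D a
        M≤t′ a b a<n b<n with w ≟ b
        ... | no ¬p rewrite ≢⇒≡ᵇ-false ¬p = M≤t C a<n b<n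
        ... | yes refl rewrite ≡ᵇ-refl w with v ≟ a
        ... | no ¬p rewrite ≢⇒≡ᵇ-false ¬p = M≤t C a<n b<n
        ... | yes refl rewrite ≡ᵇ-refl v = ≤-trans (<⇒≤ 2≤s) (s≤t C a<n)
        mark : ∀ b a x → 2 ≤ x → M D′ b a ≡ x → M D b a ≡ x
        mark b a x 2≤x e with w ≟ b
        ... | no ¬p rewrite ≢⇒≡ᵇ-false ¬p = e
        ... | yes refl rewrite ≡ᵇ-refl w with v ≟ a
        ... | no ¬p rewrite ≢⇒≡ᵇ-false ¬p = e
        ... | yes refl rewrite ≡ᵇ-refl v = ⊥-elim (<⇒≢ 2≤x e)
        unmark : ∀ b a → 0 < M D b a → M D′ b a ≡ M D b a
        unmark b a h with w ≟ b
        ... | no ¬p rewrite ≢⇒≡ᵇ-false ¬p = refl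
        ... | yes refl rewrite ≡ᵇ-refl w with v ≟ a
        ... | no ¬p rewrite ≢⇒≡ᵇ-false ¬p = refl
        ... | yes refl rewrite ≡ᵇ-refl v = ⊥-elim (<⇒≢ h (sym new))
        counts′ : ∀ b → Counted D b (c D b) → b < n → Counted D′ b (c D b)
        counts′ b (us , unique , marked , e) b<n = us , unique ,
          All.map (λ {a} (a<n , e) → a<n ,
            trans (unmark b a (subst (0 <_) (sym e) (≤-<-trans z≤n (k<t C b<n)))) e) marked , e

    settle-core : ∀ v → Core (settle D v)
    settle-core v = record
      { k<t    = k<t C
      ; t≤k+s  = t≤k+s C
      ; t-mult = t-mult C
      ; k≤τ    = k≤τ C
      ; arc-τ  = arc-τ C
      ; M≤t    = M≤t C
      ; counts = counts C
      ; c<s    = c<s C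
      ; listed = listed C
      ; entry  = entry C
      ; pend≤1 = λ {u} → pend≤1′ u }
      where
      pend≤1′ : ∀ u → u < n → pend (settle D v) u ≤ 1
      pend≤1′ u u<n with v ≟ u
      ... | yes refl rewrite ≡ᵇ-refl v = z≤n
      ... | no ¬p rewrite ≢⇒≡ᵇ-false ¬p = pend≤1 C u<n

    unfill-core : ∀ v → Core (unfill D v)
    unfill-core v = record
      { k<t    = k<t C
      ; t≤k+s  = t≤k+s C
      ; t-mult = t-mult C
      ; k≤τ    = k≤τ C
      ; arc-τ  = arc-τ C
      ; M≤t    = M≤t C
      ; counts = counts C
      ; c<s    = c<s C
      ; listed = listed C
      ; entry  = entry C
      ; pend≤1 = pend≤1 C }

    settle-ok : ∀ {v a b} → (a ≡ v → Good D v b) → OK D a b → OK (settle D v) a b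
    settle-ok {v} {a} good h arc with v ≟ a
    ... | yes refl rewrite ≡ᵇ-refl v = (λ _ → proj₁ (good refl arc)) , proj₂ (h arc)
    ... | no ¬p rewrite ≢⇒≡ᵇ-false ¬p = h arc

    unfill-ok : ∀ {v a b} → (a ≡ v → Good D v b) → OK D a b → OK (unfill D v) a b
    unfill-ok {v} {a} good h arc with v ≟ a
    ... | yes refl rewrite ≡ᵇ-refl v = proj₁ (h arc) , (λ _ → proj₂ (good refl arc))
    ... | no ¬p rewrite ≢⇒≡ᵇ-false ¬p = h arc

    -- A list that is up to date contains every out-neighbour in the block of v.
    scanned-good : ∀ {v} → v < n → full D v ≡ 0 → (∀ {i} → i < len D v → k D v < k D (L D i v)) →
                   ∀ {b} → b < n → OK D v b → Good D v b
    scanned-good v<n full≡0 scanned b<n h arc with proj₂ (h arc) full≡0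
    ... | inj₁ lt = t<t⇒k<k C v<n b<n lt , inj₁ lt
    ... | inj₂ e with listed C v<n b<n e
    ... | i , lt , refl = scanned lt , inj₂ e

  -- All that can happen while the arcs of `v` are visited. Acyclicity keeps `v` itself in place, so
  -- the heads already treated stay good. Being reflexive and transitive, the relation serves as a
  -- loop invariant relative to the start of the scan.
  record Step (v : ℕ) (D D′ : Levels) : Set where
    field
      core  : Core D′
      ok    : ∀ {a b} → a < n → b < n → OK D a b → OK D′ a b
      good  : ∀ {b} → b < n → Good D v b → Good D′ v b
      k-v   : k D′ v ≡ k D v
      t-v   : t D′ v ≡ t D v
      pend-v : pend D′ v ≡ pend D v
      full-v : full D′ v ≡ full D v
      k-mono : ∀ b → k D b ≤ k D′ b
      arc→  : ∀ {a b} → 0 < M D b a → 0 < M D′ b a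
      arc←  : ∀ {a b} → 0 < M D′ b a → 0 < M D b a
  open Step public

  step-refl : ∀ {v D} → Core D → Step v D D
  step-refl C = record
    { core = C ; ok = λ _ _ h → h ; good = λ _ h → h ; k-v = refl ; t-v = refl ; pend-v = refl
    ; full-v = refl ; k-mono = λ _ → ≤-refl ; arc→ = λ h → h ; arc← = λ h → h }

  step-trans : ∀ {v D D′ D″} → Step v D D′ → Step v D′ D″ → Step v D D″
  step-trans S S′ = record
    { core   = core S′
    ; ok     = λ p q h → ok S′ p q (ok S p q h)
    ; good   = λ p h → good S′ p (good S p h)
    ; k-v    = trans (k-v S′) (k-v S)
    ; t-v    = trans (t-v S′) (t-v S)
    ; pend-v = trans (pend-v S′) (pend-v S)
    ; full-v = trans (full-v S′) (full-v S)
    ; k-mono = λ b → ≤-trans (k-mono S b) (k-mono S′ b)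
    ; arc→   = λ h → arc→ S′ (arc→ S h)
    ; arc←   = λ h → arc← S (arc← S′ h) }

  update-mono : ∀ f {w q} → f w < q → ∀ b → f b ≤ (f ⟦ w ↦ q ⟧) b
  update-mono f {w} lt b with w ≟ b
  ... | yes refl rewrite ≡ᵇ-refl w = <⇒≤ lt
  ... | no ¬p rewrite ≢⇒≡ᵇ-false ¬p = ≤-refl

  raise-step : ∀ {D v w q} → Core D → v ≢ w → w < n → k D w < q → q ≤ τ w → q < t D w →
               Step v D (raise D w q)
  raise-step {D} C v≢w w<n k<q q≤τ q<t = record
    { core   = raise-core C w<n k<q q≤τ q<t
    ; ok     = λ _ _ → raise-ok C w<n k<q q≤τ
    ; good   = λ _ → raise-good C w<n k<q q≤τ v≢w
    ; k-v    = at-other (k D) _ (≢-sym v≢w)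
    ; t-v    = refl
    ; pend-v = at-other (pend D) _ (≢-sym v≢w)
    ; full-v = refl
    ; k-mono = update-mono (k D) k<q
    ; arc→   = λ h → h
    ; arc←   = λ h → h }

  advance-step : ∀ {D v w q t′} → Core D → v ≢ w → w < n → k D w < q → q ≤ τ w →
    t D w + s ≤ t′ → q < t′ → t′ ≤ q + s → ∃[ i ] t′ ≡ i * s → Step v D (advance D w q t′)
  advance-step {D} C v≢w w<n k<q q≤τ t+s≤ q<t′ t′≤ mult = record
    { core   = advance-core C w<n k<q q≤τ t+s≤ q<t′ t′≤ mult
    ; ok     = λ _ _ → advance-ok C w<n k<q q≤τ t+s≤ q<t′ t′≤ mult
    ; good   = λ _ → advance-good C w<n k<q q≤τ t+s≤ q<t′ t′≤ mult v≢w
    ; k-v    = at-other (k D) _ (≢-sym v≢w)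
    ; t-v    = at-other (t D) _ (≢-sym v≢w)
    ; pend-v = at-other (pend D) _ (≢-sym v≢w)
    ; full-v = at-other (full D) _ (≢-sym v≢w)
    ; k-mono = update-mono (k D) k<q
    ; arc→   = λ h → h
    ; arc←   = λ h → h }

  append-step : ∀ {D v w} → Core D → v < n → w < n → 0 < M D w v → t D v ≡ t D w → M D w v ≢ t D v →
                Step v D (append D v w)
  append-step C v<n w<n arc e un = record
    { core   = append-core C v<n w<n arc e un
    ; ok     = λ _ _ → append-ok C v<n w<n arc e un
    ; good   = λ _ → append-good C v<n w<n arc e un
    ; k-v    = refl
    ; t-v    = refl
    ; pend-v = refl
    ; full-v = refl
    ; k-mono = λ _ → ≤-refl
    ; arc→   = append-arc→ C v<n w<n arc e un
    ; arc←   = append-arc← C v<n w<n arc e un }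

  count-step : ∀ {D v w} → Core D → Counted D w (c D w + 1) → c D w + 1 < s → Step v D (count D w)
  count-step C counted lt = record
    { core = count-core C counted lt ; ok = λ _ _ h → h ; good = λ _ h → h ; k-v = refl ; t-v = refl
    ; pend-v = refl ; full-v = refl ; k-mono = λ _ → ≤-refl ; arc→ = λ h → h ; arc← = λ h → h }

  -- ν pays for one visit of a list entry, μ for one stack entry, γ for putting a
  -- vertex on a list and F for scanning a row of M.  Entering a new block gives β
  -- per level, hence at least β * s, which covers F and the s + 1 payments of γ
  -- that are due until the next block is entered.
  module Potential (ν μ f : ℕ) where

    -- A list entry of `v` has at most t v ∸ k v + pend v ≤ s + 1 visits ahead: one for each further
    -- raise within the block and one for a scan already due.
    γ : ℕ
    γ = ν * (s + 1)

    F : ℕ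
    F = f * n

    -- Over `s` levels the summand `f * s` gives f * s * s ≥ f * n, and the two `γ` give 2 * s ≥ s +
    -- 1 payments.
    β : ℕ
    β = f * s + (γ + γ)

    -- None of these differences is truncated, since k < t ≤ k + s, k < n and c < s. The list term
    -- charges every entry for its remaining visits.
    φ : Levels → ℕ → ℕ
    φ D u = β * (n + s ∸ t D u) + μ * (n ∸ k D u) + γ * (s ∸ c D u) +
            ν * (t D u ∸ k D u + pend D u) * len D u + full D u * F

    Φ : Levels → ℕ
    Φ D = Σ< n (φ D)

    Σφ : ∀ {D D′ a b w} → w < n → (∀ u → u ≢ w → φ D′ u ≡ φ D u) →
         φ D′ w + a ≤ φ D w + b → Φ D′ + a ≤ Φ D + b
    Σφ = Σ<-change n

    private
      gap : ∀ {m a b} → a < b → b ≤ m → m ∸ b + 1 ≤ m ∸ a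
      gap {m} {a} {b} a<b b≤m = ≤-trans (≤-reflexive (+-comm (m ∸ b) 1)) (∸-monoʳ-< a<b b≤m)

      spend : ∀ x {m a b} → a < b → b ≤ m → x * (m ∸ b) + x ≤ x * (m ∸ a)
      spend x {m} {a} {b} a<b b≤m = ≤-trans (≤-reflexive
        (trans (cong (x * (m ∸ b) +_) (sym (*-identityʳ x))) (sym (*-distribˡ-+ x (m ∸ b) 1))))
        (*-monoʳ-≤ x (gap a<b b≤m))

    raise-Φ : ∀ {D w q} → Core D → w < n → k D w < q → q ≤ τ w → q < t D w → Φ (raise D w q) + μ ≤ Φ D
    raise-Φ {D} {w} {q} C w<n k<q q≤τ q<t = ≤-trans
      (Σφ {D} {D′} w<n same at-w) (≤-reflexive (+-identityʳ _))
      where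
      D′ = raise D w q
      same : ∀ u → u ≢ w → φ D′ u ≡ φ D u
      same u u≢w rewrite ≢⇒≡ᵇ-false (≢-sym u≢w) = refl
      X = β * (n + s ∸ t D w)
      Z = γ * (s ∸ c D w)
      V = full D w * F
      -- The raise uses up at least one level of the block, which makes room for the scan that
      -- becomes due.
      pending : ν * (t D w ∸ q + 1) * len D w ≤ ν * (t D w ∸ k D w + pend D w) * len D w
      pending = *-monoˡ-≤ (len D w) (*-monoʳ-≤ ν (≤-trans (gap k<q (<⇒≤ q<t)) (m≤m+n _ (pend D w))))
      at-w : φ D′ w + μ ≤ φ D w + 0
      at-w rewrite ≡ᵇ-refl w = begin
        X + μ * (n ∸ q) + Z + ν * (t D w ∸ q + 1) * len D w + V + μ
          ≡⟨ solve 6 (λ x y z u v m → x :+ y :+ z :+ u :+ v :+ m := x :+ (y :+ m) :+ z :+ u :+ v) refl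
               X (μ * (n ∸ q)) Z (ν * (t D w ∸ q + 1) * len D w) V μ ⟩
        X + (μ * (n ∸ q) + μ) + Z + ν * (t D w ∸ q + 1) * len D w + V
          ≤⟨ +-monoˡ-≤ V (+-mono-≤ (+-monoˡ-≤ Z (+-monoʳ-≤ X (spend μ k<q (≤-trans q≤τ (<⇒≤ (τ<n w<n)))))) pending) ⟩
        φ D w
          ≡⟨ +-identityʳ _ ⟨
        φ D w + 0 ∎
        where
        open ≤-Reasoning
        open +-*-Solver

    -- The list term disappears with the list. The first term drops by at least β * s, which refills
    -- the counter term, deposits `F` for the row scan and leaves one `γ` over.
    advance-Φ : ∀ {D w q t′} → Core D → w < n → k D w < q → q ≤ τ w →
                t D w + s ≤ t′ → t′ ≤ q + s → Φ (advance D w q t′) + (μ + γ) ≤ Φ D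
    advance-Φ {D} {w} {q} {t′} C w<n k<q q≤τ t+s≤t′ t′≤q+s = ≤-trans
      (Σφ {D} {D′} w<n same at-w) (≤-reflexive (+-identityʳ _))
      where
      D′ = advance D w q t′
      T = n + s
      q≤n : q ≤ n
      q≤n = ≤-trans q≤τ (<⇒≤ (τ<n w<n))
      same : ∀ u → u ≢ w → φ D′ u ≡ φ D u
      same u u≢w rewrite ≢⇒≡ᵇ-false (≢-sym u≢w) = refl
      blocks : T ∸ t′ + s ≤ T ∸ t D w
      blocks = begin
        T ∸ t′ + s             ≤⟨ +-monoˡ-≤ s (∸-monoʳ-≤ T t+s≤t′) ⟩
        T ∸ (t D w + s) + s    ≡⟨ cong (_+ s) (∸-+-assoc T (t D w) s) ⟨
        T ∸ t D w ∸ s + s      ≡⟨ m∸n+n≡m (m+n≤o⇒m≤o∸n s (≤-trans (≤-reflexive (+-comm s _)) (≤-trans t+s≤t′ (≤-trans t′≤q+s (+-monoˡ-≤ s q≤n))))) ⟩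
        T ∸ t D w              ∎
        where open ≤-Reasoning
      budget : F + γ * s + γ ≤ β * s
      budget = begin
        f * n + γ * s + γ             ≤⟨ +-mono-≤ (+-monoˡ-≤ (γ * s) (*-monoʳ-≤ f n≤s²)) (≤-trans (≤-reflexive (sym (*-identityʳ γ))) (*-monoʳ-≤ γ (<⇒≤ 2≤s))) ⟩
        f * (s * s) + γ * s + γ * s   ≡⟨ solve 3 (λ f g s → f :* (s :* s) :+ g :* s :+ g :* s := (f :* s :+ (g :+ g)) :* s) refl f γ s ⟩
        β * s                         ∎
        where
        open ≤-Reasoning
        open +-*-Solver
      at-w : φ D′ w + (μ + γ) ≤ φ D w + 0
      at-w rewrite ≡ᵇ-refl w | *-zeroʳ (ν * (t′ ∸ q + 1)) = begin
        β * (T ∸ t′) + μ * (n ∸ q) + γ * s + 0 + (F + 0) + (μ + γ)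
          ≡⟨ solve 6 (λ x y z u g m → x :+ y :+ z :+ con 0 :+ (u :+ con 0) :+ (m :+ g) := x :+ (u :+ z :+ g) :+ (y :+ m)) refl
               (β * (T ∸ t′)) (μ * (n ∸ q)) (γ * s) F γ μ ⟩
        β * (T ∸ t′) + (F + γ * s + γ) + (μ * (n ∸ q) + μ)
          ≤⟨ +-mono-≤ (+-monoʳ-≤ (β * (T ∸ t′)) budget) (spend μ k<q q≤n) ⟩
        β * (T ∸ t′) + β * s + μ * (n ∸ k D w)
          ≡⟨ cong (_+ μ * (n ∸ k D w)) (*-distribˡ-+ β (T ∸ t′) s) ⟨
        β * (T ∸ t′ + s) + μ * (n ∸ k D w)
          ≤⟨ +-monoˡ-≤ _ (*-monoʳ-≤ β blocks) ⟩
        β * (T ∸ t D w) + μ * (n ∸ k D w)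
          ≤⟨ ≤-trans (m≤m+n _ _) (≤-trans (m≤m+n _ _) (m≤m+n _ _)) ⟩
        φ D w
          ≡⟨ +-identityʳ _ ⟨
        φ D w + 0 ∎
        where
        open ≤-Reasoning
        open +-*-Solver

    append-Φ : ∀ {D v w} → Core D → v < n → Φ (append D v w) ≤ Φ D + γ
    append-Φ {D} {v} {w} C v<n = ≤-trans (≤-reflexive (sym (+-identityʳ _)))
      (Σφ {D} {D′} v<n same at-v)
      where
      D′ = append D v w
      same : ∀ u → u ≢ v → φ D′ u ≡ φ D u
      same u u≢v rewrite ≢⇒≡ᵇ-false (≢-sym u≢v) = refl
      X = β * (n + s ∸ t D v) + μ * (n ∸ k D v) + γ * (s ∸ c D v)
      Y = t D v ∸ k D v + pend D v
      V = full D v * F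
      at-v : φ D′ v + 0 ≤ φ D v + γ
      at-v rewrite ≡ᵇ-refl v = begin
        X + ν * Y * (len D v + 1) + V + 0
          ≡⟨ solve 4 (λ x y l v → x :+ y :* (l :+ con 1) :+ v :+ con 0 := x :+ y :* l :+ v :+ y) refl X (ν * Y) (len D v) V ⟩
        X + ν * Y * len D v + V + ν * Y
          ≤⟨ +-monoʳ-≤ (φ D v) (*-monoʳ-≤ ν (+-mono-≤ (m≤n+o⇒m∸n≤o (t D v) (k D v) (t≤k+s C v<n)) (pend≤1 C v<n))) ⟩
        φ D v + γ ∎
        where
        open ≤-Reasoning
        open +-*-Solver

    count-Φ : ∀ {D w} → w < n → c D w + 1 < s → Φ (count D w) + γ ≤ Φ D
    count-Φ {D} {w} w<n lt = ≤-trans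
      (Σφ {D} {D′} w<n same at-w) (≤-reflexive (+-identityʳ _))
      where
      D′ = count D w
      same : ∀ u → u ≢ w → φ D′ u ≡ φ D u
      same u u≢w rewrite ≢⇒≡ᵇ-false (≢-sym u≢w) = refl
      X = β * (n + s ∸ t D w) + μ * (n ∸ k D w)
      Y = ν * (t D w ∸ k D w + pend D w) * len D w
      V = full D w * F
      at-w : φ D′ w + γ ≤ φ D w + 0
      at-w rewrite ≡ᵇ-refl w = begin
        X + γ * (s ∸ (c D w + 1)) + Y + V + γ
          ≡⟨ solve 5 (λ x y z u m → x :+ y :+ z :+ u :+ m := x :+ (y :+ m) :+ z :+ u) refl
               X (γ * (s ∸ (c D w + 1))) Y V γ ⟩
        X + (γ * (s ∸ (c D w + 1)) + γ) + Y + V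
          ≤⟨ +-monoˡ-≤ V (+-monoˡ-≤ Y (+-monoʳ-≤ X (spend γ (m<m+n (c D w) (s≤s z≤n)) (<⇒≤ lt)))) ⟩
        φ D w
          ≡⟨ +-identityʳ _ ⟨
        φ D w + 0 ∎
        where
        open ≤-Reasoning
        open +-*-Solver

    settle-Φ : ∀ {D v} → v < n → 0 < pend D v → Φ (settle D v) + ν * len D v ≤ Φ D
    settle-Φ {D} {v} v<n p = ≤-trans
      (Σφ {D} {D′} v<n same at-v) (≤-reflexive (+-identityʳ _))
      where
      D′ = settle D v
      same : ∀ u → u ≢ v → φ D′ u ≡ φ D u
      same u u≢v rewrite ≢⇒≡ᵇ-false (≢-sym u≢v) = refl
      X = β * (n + s ∸ t D v) + μ * (n ∸ k D v) + γ * (s ∸ c D v)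
      Y = t D v ∸ k D v
      V = full D v * F
      at-v : φ D′ v + ν * len D v ≤ φ D v + 0
      at-v rewrite ≡ᵇ-refl v = begin
        X + ν * (Y + 0) * len D v + V + ν * len D v
          ≡⟨ solve 5 (λ x n y l v → x :+ n :* (y :+ con 0) :* l :+ v :+ n :* l := x :+ n :* (y :+ con 1) :* l :+ v) refl X ν Y (len D v) V ⟩
        X + ν * (Y + 1) * len D v + V
          ≤⟨ +-monoˡ-≤ V (+-monoʳ-≤ X (*-monoˡ-≤ (len D v) (*-monoʳ-≤ ν (+-monoʳ-≤ Y p)))) ⟩
        φ D v
          ≡⟨ +-identityʳ _ ⟨
        φ D v + 0 ∎
        where
        open ≤-Reasoning
        open +-*-Solver

    unfill-Φ : ∀ {D v} → v < n → 0 < full D v → Φ (unfill D v) + F ≤ Φ D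
    unfill-Φ {D} {v} v<n p = ≤-trans
      (Σφ {D} {D′} v<n same at-v) (≤-reflexive (+-identityʳ _))
      where
      D′ = unfill D v
      same : ∀ u → u ≢ v → φ D′ u ≡ φ D u
      same u u≢v rewrite ≢⇒≡ᵇ-false (≢-sym u≢v) = refl
      X = β * (n + s ∸ t D v) + μ * (n ∸ k D v) + γ * (s ∸ c D v) + ν * (t D v ∸ k D v + pend D v) * len D v
      at-v : φ D′ v + F ≤ φ D v + 0
      at-v rewrite ≡ᵇ-refl v = begin
        X + 0 + F             ≡⟨ cong (_+ F) (+-identityʳ X) ⟩
        X + F                 ≤⟨ +-monoʳ-≤ X (≤-trans (≤-reflexive (sym (*-identityˡ F))) (*-monoˡ-≤ F p)) ⟩
        φ D v                 ≡⟨ +-identityʳ _ ⟨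
        φ D v + 0             ∎
        where open ≤-Reasoning

    -- Since k v < t v, each entry still carries at least ν. This keeps the row indices of `L`
    -- within the word limit.
    len≤Φ : ∀ {D v} → 1 ≤ ν → Core D → v < n → len D v ≤ Φ D
    len≤Φ {D} {v} 1≤ν C v<n = begin
      len D v
        ≡⟨ *-identityˡ _ ⟨
      1 * len D v
        ≤⟨ *-monoˡ-≤ (len D v) (*-mono-≤ 1≤ν (≤-trans (m<n⇒0<n∸m (k<t C v<n)) (m≤m+n _ (pend D v)))) ⟩
      ν * (t D v ∸ k D v + pend D v) * len D v
        ≤⟨ ≤-trans (m≤n+m _ (β * (n + s ∸ t D v) + μ * (n ∸ k D v) + γ * (s ∸ c D v))) (m≤m+n _ (full D v * F)) ⟩
      φ D v
        ≤⟨ Σ<-member n v<n ⟩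
      Φ D ∎
      where open ≤-Reasoning

-- Topological numberings

-- Relative to a list of remaining vertices, so that it can be built by removing sinks.
record Numbering {n} (es : List (Edge n)) (vs : List (Fin n)) : Set where
  field
    number    : Fin n → ℕ
    bounded   : ∀ {v} → v ∈ vs → number v < length vs
    injective : ∀ {u v} → u ∈ vs → v ∈ vs → number u ≡ number v → u ≡ v
    monotone  : ∀ {u v} → u ∈ vs → v ∈ vs → (u , v) ∈ es → number u < number v
open Numbering

module _ {n} (es : List (Edge n)) (acyclic : Acyclic es) where

  open import Data.List.Membership.DecPropositional (≡-dec (Fin._≟_ {n}) (Fin._≟_ {n})) using (_∈?_)

  reachable-noetherian : WellFounded (flip (TransClosure (Adjacent es)))
  reachable-noetherian = spo-noetherian record
    { isEquivalence = isEquivalence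
    ; irrefl        = λ { refl → acyclic _ }
    ; trans         = transitive _
    ; <-resp-≈      = (λ { refl → id }) , (λ { refl → id }) }

  sink : ∀ {vs v} → v ∈ vs → ∃[ z ] z ∈ vs × (∀ {y} → y ∈ vs → (z , y) ∉ es)
  sink {vs} {v} v∈vs = go v∈vs (reachable-noetherian v)
    where
    go : ∀ {v} → v ∈ vs → Acc (flip (TransClosure (Adjacent es))) v →
         ∃[ z ] z ∈ vs × (∀ {y} → y ∈ vs → (z , y) ∉ es)
    go {v} v∈vs (acc rec) with any? (λ y → (v , y) ∈? es) vs
    ... | no none = v , v∈vs , λ y∈vs e → none (lose y∈vs e)
    ... | yes some with find some
    ... | y , y∈vs , e = go y∈vs (rec [ e ]⁺)

  -- A sink receives the largest number, which cannot conflict with arcs among the others.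
  numbering : ∀ vs → Numbering es vs
  numbering vs = go (length vs) vs ≤-refl
    where
    go : ∀ l vs → length vs ≤ l → Numbering es vs
    go l [] le = record { number = λ _ → 0 ; bounded = λ () ; injective = λ () ; monotone = λ () }
    go (suc l) vs@(v ∷ _) le with sink {vs} (here refl)
    ... | z , z∈vs , isSink = record
      { number = number′ ; bounded = bounded′ ; injective = injective′ ; monotone = monotone′ }
      where
      rest : List (Fin n)
      rest = filter (λ v → ¬? (v Fin.≟ z)) vs
      shorter : length rest < length vs
      shorter = filter-notAll (λ v → ¬? (v Fin.≟ z)) vs (lose z∈vs (λ p → p refl))
      N : Numbering es rest
      N = go l rest (≤-pred (≤-trans shorter le))
      keep : ∀ {v} → v ∈ vs → v ≢ z → v ∈ rest
      keep v∈vs v≢z = ∈-filter⁺ (λ v → ¬? (v Fin.≟ z)) v∈vs v≢z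
      number′ : Fin n → ℕ
      number′ v with v Fin.≟ z
      ... | yes _ = length rest
      ... | no _  = number N v
      bounded′ : ∀ {v} → v ∈ vs → number′ v < length vs
      bounded′ {v} v∈vs with v Fin.≟ z
      ... | yes _   = shorter
      ... | no v≢z  = <-trans (bounded N (keep v∈vs v≢z)) shorter
      injective′ : ∀ {u v} → u ∈ vs → v ∈ vs → number′ u ≡ number′ v → u ≡ v
      injective′ {u} {v} u∈vs v∈vs e with u Fin.≟ z | v Fin.≟ z
      ... | yes p   | yes q   = trans p (sym q)
      ... | yes _   | no v≢z  = ⊥-elim (<⇒≢ (bounded N (keep v∈vs v≢z)) (sym e))
      ... | no u≢z  | yes _   = ⊥-elim (<⇒≢ (bounded N (keep u∈vs u≢z)) e)
      ... | no u≢z  | no v≢z  = injective N (keep u∈vs u≢z) (keep v∈vs v≢z) e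
      monotone′ : ∀ {u v} → u ∈ vs → v ∈ vs → (u , v) ∈ es → number′ u < number′ v
      monotone′ {u} {v} u∈vs v∈vs e with u Fin.≟ z | v Fin.≟ z
      ... | yes refl | _       = ⊥-elim (isSink v∈vs e)
      ... | no u≢z   | yes _   = bounded N (keep u∈vs u≢z)
      ... | no u≢z   | no v≢z  = monotone N (keep u∈vs u≢z) (keep v∈vs v≢z) e

  topological-numbering : ∃[ τ ] (∀ {u} → u < n → τ u < n) ×
    (∀ {u v} → u < n → v < n → τ u ≡ τ v → u ≡ v) ×
    (∀ {x y} → (x , y) ∈ es → τ (toℕ x) < τ (toℕ y))
  topological-numbering = τ , τ<n , τ-injective , τ-monotone
    where
    N : Numbering es (allFin n)
    N = numbering (allFin n)
    -- In memory, vertices are plain numbers, so `τ` is extended by 0; its properties are stated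
    -- below `n`.
    τ : ℕ → ℕ
    τ u with u <? n
    ... | yes p = number N (fromℕ< p)
    ... | no _  = 0
    τ<n : ∀ {u} → u < n → τ u < n
    τ<n {u} u<n with u <? n
    ... | yes p = subst (number N (fromℕ< p) <_) (length-tabulate {n = n} id) (bounded N (∈-allFin _))
    ... | no ¬p = ⊥-elim (¬p u<n)
    τ-injective : ∀ {u v} → u < n → v < n → τ u ≡ τ v → u ≡ v
    τ-injective {u} {v} u<n v<n e with u <? n | v <? n
    ... | yes p | yes q = fromℕ<-injective _ _ p q (injective N (∈-allFin _) (∈-allFin _) e)
    ... | no ¬p | _     = ⊥-elim (¬p u<n)
    ... | _     | no ¬q = ⊥-elim (¬q v<n)
    τ-number : ∀ x → τ (toℕ x) ≡ number N x
    τ-number x with toℕ x <? n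
    ... | yes p = cong (number N) (fromℕ<-toℕ x p)
    ... | no ¬p = ⊥-elim (¬p (toℕ<n x))
    τ-monotone : ∀ {x y} → (x , y) ∈ es → τ (toℕ x) < τ (toℕ y)
    τ-monotone {x} {y} e = subst₂ _<_ (sym (τ-number x)) (sym (τ-number y)) (monotone N (∈-allFin x) (∈-allFin y) e)

-- Bounds the number of calls, each of which has a constant cost beyond what the potential pays.
length-edges : ∀ {n} {es : List (Edge n)} → Unique es → length es ≤ n * n
length-edges {n} unique = length≤interval (λ (x , y) → toℕ (combine x y)) unique
  (All.tabulate λ {(x , y)} _ → z≤n , toℕ<n (combine x y))
  λ e → case (combine-injective _ _ _ _ (toℕ-injective e))
  where
  case : ∀ {x y x′ y′ : Fin n} → x ≡ x′ × y ≡ y′ → (x , y) ≡ (x′ , y′)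
  case (refl , refl) = refl

-- The programs and their verification

pattern 0ᶠ = zero
pattern 1ᶠ = suc zero
pattern 2ᶠ = suc (suc zero)

-- The target level q in `rQ` is at most t v. So if q lies beyond the block of `w`, the new block is
-- that of `v` when q < t v, and the following one when q = t v.
raiseᶜ : Cmd
raiseᶜ =
  st rQ aK nothing rW ⨾
  set rA 1ᶠ ⨾ st rA aPend nothing rW ⨾
  set rB 0ᶠ ⨾ st rW aStk (just rP) rB ⨾ add rP rP rA ⨾
  ld rB aT nothing rW ⨾ add rA rQ rA ⨾ sub rA rA rB ⨾
  if rA
    (ld rB aT nothing rV ⨾ set rA 1ᶠ ⨾ add rA rQ rA ⨾ sub rA rA rB ⨾
     if rA (add rB rB rS) skip ⨾
     st rB aT nothing rW ⨾
     set rA 0ᶠ ⨾ st rA aC nothing rW ⨾ st rA aLen nothing rW ⨾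
     set rA 1ᶠ ⨾ st rA aFull nothing rW)
    skip

-- The result is positive iff the arc is violated; the level to which `w` would be raised stays in
-- `rQ`.
compareᶜ : Cmd
compareᶜ =
  ld rQ aK nothing rV ⨾ set rA 1ᶠ ⨾ add rQ rQ rA ⨾
  ld rA aK nothing rW ⨾ sub rA rQ rA

checkᶜ : Cmd
checkᶜ = compareᶜ ⨾ if rA raiseᶜ skip

blocksᶜ : Cmd
blocksᶜ = ld rA aT nothing rV ⨾ ld rB aT nothing rW ⨾ sub rB rB rA

-- `rA` still holds t v. Marks never exceed it, so the difference vanishes only for a current mark.
unmarkedᶜ : Cmd
unmarkedᶜ = ld rQ aM (just rW) rV ⨾ sub rQ rA rQ

appendᶜ : Cmd
appendᶜ =
  st rA aM (just rW) rV ⨾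
  ld rQ aLen nothing rV ⨾ st rW aL (just rQ) rV ⨾
  set rB 1ᶠ ⨾ add rQ rQ rB ⨾ st rQ aLen nothing rV ⨾
  ld rQ aC nothing rW ⨾ add rQ rQ rB ⨾ sub rB rS rQ

countᶜ : Cmd
countᶜ = st rQ aC nothing rW

-- The full counter is not stored: as q = t w, `raiseᶜ` moves `w` to a new block and resets it.
jumpᶜ : Cmd
jumpᶜ = ld rQ aT nothing rW ⨾ raiseᶜ

markᶜ : Cmd
markᶜ =
  blocksᶜ ⨾
  if rB skip (unmarkedᶜ ⨾ if rQ (appendᶜ ⨾ if rB countᶜ jumpᶜ) skip)

touchᶜ : Cmd
touchᶜ = checkᶜ ⨾ markᶜ

nextEntryᶜ : Cmd
nextEntryᶜ = set rA 1ᶠ ⨾ sub rI rI rA ⨾ ld rW aL (just rI) rV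

listBodyᶜ : Cmd
listBodyᶜ = nextEntryᶜ ⨾ checkᶜ

-- Subtracting 0 copies a register.
nextArcᶜ : Cmd
nextArcᶜ =
  set rA 1ᶠ ⨾ sub rI rI rA ⨾ set rB 0ᶠ ⨾ sub rW rI rB ⨾ ld rA aM (just rW) rV

rowBodyᶜ : Cmd
rowBodyᶜ = nextArcᶜ ⨾ if rA touchᶜ skip

listᶜ : Cmd
listᶜ = ld rI aLen nothing rV ⨾ while rI listBodyᶜ

unfillᶜ : Cmd
unfillᶜ = set rA 0ᶠ ⨾ st rA aFull nothing rV

rowᶜ : Cmd
rowᶜ = size rI ⨾ (while rI rowBodyᶜ ⨾ unfillᶜ)

popᶜ : Cmd
popᶜ = set rA 1ᶠ ⨾ sub rP rP rA ⨾ set rB 0ᶠ ⨾ ld rV aStk (just rP) rB ⨾ ld rA aPend nothing rV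

filledᶜ : Cmd
filledᶜ = ld rA aFull nothing rV

scanᶜ : Cmd
scanᶜ = filledᶜ ⨾ if rA rowᶜ listᶜ

settleᶜ : Cmd
settleᶜ = set rA 0ᶠ ⨾ st rA aPend nothing rV

-- Each raise pushes a copy of the vertex. Copies popped while `pend` is 0 are dropped in constant
-- time.
processᶜ : Cmd
processᶜ = while rP (popᶜ ⨾ if rA (scanᶜ ⨾ settleᶜ) skip)

connectᶜ : Cmd
connectᶜ = ld rA aM (just rW) rV ⨾ if rA skip (set rA 1ᶠ ⨾ st rA aM (just rW) rV)

insertᶜ : Cmd
insertᶜ = (connectᶜ ⨾ touchᶜ) ⨾ processᶜ

-- Meaningful for straight-line commands only: size, branches and loops are skipped.
after : Cmd → State → State
after (set r k) σ     = assign r (λ _ → toℕ k) σ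
after (add r s t) σ   = assign r (λ σ → reg σ s + reg σ t) σ
after (sub r s t) σ   = assign r (λ σ → reg σ s ∸ reg σ t) σ
after (ld r a i v) σ  = assign r (λ σ → arr σ a (row σ i) (reg σ v)) σ
after (st r a i v) σ  = write r a i v σ
after (c ⨾ d) σ       = after d (after c σ)
after c σ             = σ

record Contents : Set where
  field
    lv           : Levels
    stack        : ℕ → ℕ
    height width : ℕ
open Contents

contents : State → Contents
contents σ = record
  { lv     = levels (arr σ aK 0) (arr σ aT 0) (arr σ aC 0) (arr σ aLen 0) (arr σ aPend 0) (arr σ aFull 0)
                    (arr σ aL) (arr σ aM)
  ; stack  = λ i → arr σ aStk i 0
  ; height = reg σ rP
  ; width  = reg σ rS }

pos⇒< : ∀ {a b} → 0 < a ∸ b → b < a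
pos⇒< {a} {b} p = m∸n≢0⇒n<m (λ e → <⇒≢ p (sym e))

module Verification (n s : ℕ) .{{_ : NonZero n}} (2≤s : 2 ≤ s) (n≤s² : n ≤ s * s) (τ : ℕ → ℕ)
  (τ<n : ∀ {u} → u < n → τ u < n)
  (τ-injective : ∀ {u v} → u < n → v < n → τ u ≡ τ v → u ≡ v)
  (ν μ f : ℕ) (list≤ν : 3 + cost listBodyᶜ ≤ ν) (row≤f : 3 + cost rowBodyᶜ ≤ f) (pop≤μ : 60 + cost popᶜ ≤ μ)
  (B H W : ℕ) (B<H : B < H) (n+2s≤H : n + s + s ≤ H)
  (word : 11 + ((H * 9 + 8) * n + n) < W) where

  open Levelled n s 2≤s n≤s² τ τ<n τ-injective
  open Potential ν μ f
  open Machine n H W word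

  Ψ : Contents → ℕ
  Ψ X = Φ (lv X) + μ * height X

  -- e is the vertex being scanned, which has left the stack but is still pending;
  -- e = n if there is none.
  record Pending (e : ℕ) (pending stack : ℕ → ℕ) (height : ℕ) : Set where
    field
      stacked : ∀ {u} → u < n → 0 < pending u → u ≡ e ⊎ ∃[ i ] i < height × stack i ≡ u
      stack<n : ∀ {i} → i < height → stack i < n
  open Pending

  record Work (e : ℕ) (X : Contents) : Set where
    field
      valid   : Core (lv X)
      pending : Pending e (pend (lv X)) (stack X) (height X)
      width≡s : width X ≡ s
  open Work

  n≤H : n ≤ H
  n≤H = ≤-trans (m≤m+n n s) (≤-trans (m≤m+n (n + s) s) n+2s≤H)

  <n⇒≤H : ∀ {x} → x < n → x ≤ H
  <n⇒≤H p = ≤-trans (<⇒≤ p) n≤H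

  0<n : 0 < n
  0<n = >-nonZero⁻¹ n

  <n⇒+1≤H : ∀ {x} → x < n → x + 1 ≤ H
  <n⇒+1≤H {x} p = ≤-trans (≤-reflexive (+-comm x 1)) (≤-trans p n≤H)

  <H⇒+1≤H : ∀ {x} → x < H → x + 1 ≤ H
  <H⇒+1≤H {x} p = ≤-trans (≤-reflexive (+-comm x 1)) p

  -- With repeated copies the height is not bounded by `n`, but each entry holds μ of the potential.
  height<H : ∀ X → Ψ X ≤ B → height X < H
  height<H X le = ≤-<-trans (≤-trans (m≤n*m (height X) μ {{>-nonZero (≤-trans (s≤s z≤n) pop≤μ)}}) (≤-trans (m≤n+m (μ * height X) (Φ (lv X))) le)) B<H

  t+s≤H : ∀ {D u} → Core D → u < n → t D u + s ≤ H
  t+s≤H C u<n = ≤-trans (+-monoˡ-≤ s (≤-trans (t≤k+s C u<n)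
    (+-monoˡ-≤ s (≤-trans (k≤τ C u<n) (<⇒≤ (τ<n u<n)))))) n+2s≤H

  +1≤⇒< : ∀ {a b} → a + 1 ≤ b → a < b
  +1≤⇒< {a} p = ≤-trans (≤-reflexive (+-comm 1 a)) p

  -- The stack lies in column 0 of its rows; `∧ true` is what remains of the comparison of 0 with 0
  -- in `write`.
  pushed : (ℕ → ℕ) → ℕ → ℕ → ℕ → ℕ
  pushed stack height w i = if (height ≡ᵇ i) ∧ true then w else stack i

  push : ∀ {e p p′ stack height w} → w < n → (∀ {u} → u ≢ w → 0 < p′ u → 0 < p u) →
         Pending e p stack height → Pending e p′ (pushed stack height w) (height + 1)
  push {e} {p} {p′} {stack} {height} {w} w<n old P = record
    { stacked = λ {u} → stacked′ u
    ; stack<n = λ {i} → stack<n′ i }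
    where
    top : pushed stack height w height ≡ w
    top rewrite ≡ᵇ-refl height = refl
    below : ∀ {i} → height ≢ i → pushed stack height w i ≡ stack i
    below p rewrite ≢⇒≡ᵇ-false p = refl
    stacked′ : ∀ u → u < n → 0 < p′ u → u ≡ e ⊎ ∃[ i ] i < height + 1 × pushed stack height w i ≡ u
    stacked′ u u<n p with u ≟ w
    ... | yes refl = inj₂ (height , m<m+n height (s≤s z≤n) , top)
    ... | no ¬p with stacked P u<n (old ¬p p)
    ... | inj₁ e = inj₁ e
    ... | inj₂ (i , lt , e) = inj₂ (i , ≤-trans lt (m≤m+n height 1) , trans (below (λ e → <⇒≢ lt (sym e))) e)
    stack<n′ : ∀ i → i < height + 1 → pushed stack height w i < n
    stack<n′ i lt with height ≟ i
    ... | yes refl = subst (_< n) (sym top) w<n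
    ... | no ¬p = subst (_< n) (sym (below ¬p))
      (stack<n P (≤∧≢⇒< (≤-pred (≤-trans lt (≤-reflexive (+-comm height 1)))) (λ e → ¬p (sym e))))

  record Effect (e v : ℕ) (X X′ : Contents) : Set where
    field
      work : Work e X′
      progress : Step v (lv X) (lv X′)
      Ψ≤   : Ψ X′ ≤ Ψ X
  open Effect

  -- `Ψ+γ≤` is meant for the skip to t w: entering a block releases the `γ` that the entry just
  -- appended has drawn.
  record Raised (e v w q : ℕ) (X X′ : Contents) : Set where
    field
      effect : Effect e v X X′
      k≡q    : k (lv X′) w ≡ q
      len≡   : len (lv X′) v ≡ len (lv X) v
      L≡     : L (lv X′) ≡ L (lv X)
      Ψ+γ≤   : t (lv X) w ≤ q → Ψ X′ + γ ≤ Ψ X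
  open Raised

  Keeps : State → State → Set
  Keeps σ σ′ = reg σ′ rV ≡ reg σ rV × reg σ′ rW ≡ reg σ rW × reg σ′ rI ≡ reg σ rI

  private
    pay : ∀ {x y} a h → x + (μ + a) ≤ y → x + μ * (h + 1) + a ≤ y + μ * h
    pay {x} {y} a h le = begin
      x + μ * (h + 1) + a     ≡⟨ cong (λ z → x + z + a) (*-distribˡ-+ μ h 1) ⟩
      x + (μ * h + μ * 1) + a ≡⟨ cong (λ z → x + (μ * h + z) + a) (*-identityʳ μ) ⟩
      x + (μ * h + μ) + a     ≡⟨ regroup x (μ * h) μ a ⟩
      x + (μ + a) + μ * h     ≤⟨ +-monoˡ-≤ (μ * h) le ⟩
      y + μ * h               ∎
      where
      open ≤-Reasoning
      open +-*-Solver
      regroup : ∀ x y m a → x + (y + m) + a ≡ x + (m + a) + y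
      regroup = solve 4 (λ x y m a → x :+ (y :+ m) :+ a := x :+ (m :+ a) :+ y) refl

    pend-raised : ∀ D {w u} → u ≢ w → 0 < (pend D ⟦ w ↦ 1 ⟧) u → 0 < pend D u
    pend-raised D u≢w p = subst (0 <_) (at-other (pend D) 1 (≢-sym u≢w)) p

  raise-safe : ∀ e σ → let X = contents σ ; D = lv X ; v = reg σ rV ; w = reg σ rW ; q = reg σ rQ in
    Work e X → reg σ rP < H → v < n → w < n → v ≢ w →
    k D w < q → q ≤ τ w → k D v < q → q ≤ t D v → Safe raiseᶜ σ (λ σ′ → Keeps σ σ′ × Raised e v w q X (contents σ′))
  raise-safe e σ wk sp<H v<n w<n v≢w kw<q q≤τ kv<q q≤t = safe (
    z≤n , w<n , z≤n , w<n , <⇒≤ sp<H , 0<n , <H⇒+1≤H sp<H , z≤n , w<n , q+1≤H ,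
    (λ p → z≤n , v<n , q+1≤H ,
      -- Here q = t v, and `w` enters the block after that of `v`.
      (λ p′ → t+s≤B , z≤n , w<n , z≤n , w<n , z≤n , w<n , z≤n , w<n ,
         (refl , refl , refl) , advanced (t D v + reg σ rS)
           (subst (λ z → t D w + s ≤ t D v + z) (sym (width≡s wk)) (+-monoˡ-≤ s (≤-trans (t≤q p) q≤t)))
           (≤-<-trans q≤t (subst (λ z → t D v < t D v + z) (sym (width≡s wk)) (m<m+n (t D v) (≤-trans (s≤s z≤n) 2≤s))))
           (+-mono-≤ (t≤q p′) (≤-reflexive (width≡s wk)))
           (next (t-mult C v<n) (width≡s wk)) (t≤q p)) ,
      -- Here t w ≤ q < t v, so the two block ends differ by at least `s`.
      (λ p′ → z≤n , w<n , z≤n , w<n , z≤n , w<n , z≤n , w<n ,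
         (refl , refl , refl) , advanced (t D v) (multiple-gap (t-mult C w<n) (t-mult C v<n) (≤-<-trans (t≤q p) (q<t p′))) (q<t p′)
           (≤-trans (t≤k+s C v<n) (+-monoˡ-≤ s (<⇒≤ kv<q))) (t-mult C v<n) (t≤q p))) ,
    (λ p → (refl , refl , refl) , record
      { effect = record
        { work = record
          { valid = raise-core C w<n kw<q q≤τ (q<t p)
          ; pending = push w<n (pend-raised D) (pending wk)
          ; width≡s = width≡s wk }
        ; progress = raise-step C v≢w w<n kw<q q≤τ (q<t p)
        ; Ψ≤ = ≤-trans (≤-reflexive (sym (+-identityʳ _)))
                (pay 0 (reg σ rP) (≤-trans (≤-reflexive (cong (Φ (raise D w q) +_) (+-identityʳ μ)))
                  (raise-Φ C w<n kw<q q≤τ (q<t p)))) }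
      ; k≡q = at-same (k D) w q
      ; len≡ = refl
      ; L≡ = refl
      ; Ψ+γ≤ = λ le → ⊥-elim (<⇒≱ (q<t p) le) }))
    where
    X = contents σ
    D = lv X
    v = reg σ rV
    w = reg σ rW
    q = reg σ rQ
    C : Core D
    C = valid wk
    q+1≤H : q + 1 ≤ H
    q+1≤H = <n⇒+1≤H (≤-<-trans q≤τ (τ<n w<n))
    t≤q : ∀ {x} → 0 < q + 1 ∸ x → x ≤ q
    t≤q p = ≤-pred (≤-trans (pos⇒< p) (≤-reflexive (+-comm q 1)))
    q<t : ∀ {x} → q + 1 ∸ x ≡ 0 → q < x
    q<t p = +1≤⇒< (m∸n≡0⇒m≤n p)
    t+s≤B : t D v + reg σ rS ≤ H
    t+s≤B = subst (λ z → t D v + z ≤ H) (sym (width≡s wk)) (t+s≤H C v<n)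
    next : ∀ {a b} → ∃[ i ] a ≡ i * s → b ≡ s → ∃[ i ] a + b ≡ i * s
    next (i , refl) refl = suc i , +-comm (i * s) s
    advanced : ∀ t′ → t D w + s ≤ t′ → q < t′ → t′ ≤ q + s → ∃[ i ] t′ ≡ i * s → t D w ≤ q →
      Raised e v w q X (record X { lv = advance D w q t′ ; stack = pushed (stack X) (height X) w ; height = height X + 1 })
    advanced t′ t+s≤ q<t′ t′≤ mult t≤q = record
      { effect = record
        { work = record
          { valid = advance-core C w<n kw<q q≤τ t+s≤ q<t′ t′≤ mult
          ; pending = push w<n (pend-raised D) (pending wk)
          ; width≡s = width≡s wk }
        ; progress = advance-step C v≢w w<n kw<q q≤τ t+s≤ q<t′ t′≤ mult
        ; Ψ≤ = ≤-trans (m≤m+n _ γ) paid }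
      ; k≡q = at-same (k D) w q
      ; len≡ = at-other (len D) 0 (≢-sym v≢w)
      ; L≡ = refl
      ; Ψ+γ≤ = λ _ → paid }
      where
      paid : Φ (advance D w q t′) + μ * (height X + 1) + γ ≤ Ψ X
      paid = pay γ (height X) (advance-Φ C w<n kw<q q≤τ t+s≤ t′≤)

  record Checked (e v w : ℕ) (X X′ : Contents) : Set where
    field
      effect : Effect e v X X′
      k<k    : k (lv X′) v < k (lv X′) w
      len≡   : len (lv X′) v ≡ len (lv X) v
      L≡     : L (lv X′) ≡ L (lv X)
  open Checked

  check-safe : ∀ e σ → let X = contents σ ; v = reg σ rV ; w = reg σ rW in
    Work e X → Ψ X ≤ B → v < n → w < n → τ v < τ w →
    Safe checkᶜ σ (λ σ′ → Keeps σ σ′ × Checked e v w X (contents σ′))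
  check-safe e σ wk Ψ≤B v<n w<n τ<τ = safe (
    z≤n , v<n , <n⇒+1≤H kv<n , z≤n , w<n ,
    (λ p → consequence (λ σ′ → Keeps σ σ′ × Checked e v w X (contents σ′))
      (raise-safe e (after compareᶜ σ) wk (height<H X Ψ≤B) v<n w<n
        (λ v≡w → <⇒≢ τ<τ (cong τ v≡w)) (pos⇒< p)
        -- k v ≤ τ v < τ w, so ordinary raises keep levels below the numbering.
        (≤-trans (≤-reflexive (+-comm (k D v) 1)) (≤-<-trans (k≤τ C v<n) τ<τ))
        (m<m+n (k D v) (s≤s z≤n))
        (≤-trans (≤-reflexive (+-comm (k D v) 1)) (k<t C v<n)))
      λ (kept , r) → kept , record
        { effect = effect r
        ; k<k = subst₂ _<_ (sym (k-v (progress (effect r)))) (sym (k≡q r)) (m<m+n (k D v) (s≤s z≤n))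
        ; len≡ = len≡ r
        ; L≡ = L≡ r }) ,
    (λ p → (refl , refl , refl) , record
      { effect = record { work = wk ; progress = step-refl C ; Ψ≤ = ≤-refl }
      ; k<k = +1≤⇒< (m∸n≡0⇒m≤n p)
      ; len≡ = refl
      ; L≡ = refl }))
    where
    X = contents σ
    D = lv X
    v = reg σ rV
    w = reg σ rW
    C : Core D
    C = valid wk
    kv<n : k D v < n
    kv<n = ≤-<-trans (k≤τ C v<n) (τ<n v<n)

  record Touched (e v w : ℕ) (X X′ : Contents) : Set where
    field
      effect : Effect e v X X′
      near   : Good (lv X′) v w
  open Touched

  effect-refl : ∀ {e v X} → Work e X → Effect e v X X
  effect-refl wk = record { work = wk ; progress = step-refl (valid wk) ; Ψ≤ = ≤-refl }

  effect-trans : ∀ {e v X X′ X″} → Effect e v X X′ → Effect e v X′ X″ → Effect e v X X″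
  effect-trans E E′ = record
    { work = work E′
    ; progress = step-trans (progress E) (progress E′)
    ; Ψ≤   = ≤-trans (Ψ≤ E′) (Ψ≤ E) }

  len<H : ∀ {e} X {v} → Work e X → Ψ X ≤ B → v < n → len (lv X) v < H
  len<H X wk le v<n = ≤-<-trans
    (≤-trans (len≤Φ (≤-trans (s≤s z≤n) list≤ν) (valid wk) v<n) (≤-trans (m≤m+n _ (μ * height X)) le)) B<H

  mark-safe : ∀ e σ → let X = contents σ ; D = lv X ; v = reg σ rV ; w = reg σ rW in
    Work e X → Ψ X ≤ B → v < n → w < n → 0 < M D w v → k D v < k D w →
    Safe markᶜ σ (λ σ′ → Keeps σ σ′ × Touched e v w X (contents σ′))
  mark-safe e σ wk Ψ≤B v<n w<n arc kv<kw = safe (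
    z≤n , v<n , z≤n , w<n ,
    (λ p → (refl , refl , refl) , unchanged (inj₁ (pos⇒< p))) ,
    (λ p → <n⇒≤H w<n , v<n ,
      (λ p′ → <n⇒≤H w<n , v<n , z≤n , v<n , <⇒≤ l<H , v<n , <H⇒+1≤H l<H , z≤n , v<n ,
        z≤n , w<n , c+1≤H ,
        (λ p″ → z≤n , w<n , (refl , refl , refl) , counted p p′ (pos⇒< p″)) ,
        (λ p″ → z≤n , w<n , jumped p p′ (m∸n≡0⇒m≤n p″))) ,
      (λ p′ → (refl , refl , refl) , unchanged (inj₂ (≤-antisym (M≤t C v<n w<n) (m∸n≡0⇒m≤n p′))))))
    where
    X = contents σ
    D = lv X
    v = reg σ rV
    w = reg σ rW
    C : Core D
    C = valid wk
    l<H : len D v < H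
    l<H = len<H X wk Ψ≤B v<n
    c+1≤s : c D w + 1 ≤ s
    c+1≤s = ≤-trans (≤-reflexive (+-comm (c D w) 1)) (c<s C w<n)
    c+1≤H : c D w + 1 ≤ H
    c+1≤H = ≤-trans c+1≤s (≤-trans (m≤n+m s (n + s)) n+2s≤H)
    unchanged : Near D v w → Touched e v w X X
    unchanged near = record { effect = effect-refl wk ; near = λ _ → kv<kw , near }
    D₁ = append D v w
    module _ (p : t D w ∸ t D v ≡ 0) (p′ : 0 < t D v ∸ M D w v) where
      t≡t : t D v ≡ t D w
      t≡t = ≤-antisym (k<k⇒t≤t C v<n w<n kv<kw) (m∸n≡0⇒m≤n p)
      unmarked : M D w v ≢ t D v
      unmarked e = <⇒≢ (pos⇒< p′) e
      C₁ : Core D₁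
      C₁ = append-core C v<n w<n arc t≡t unmarked
      S₁ : Step v D D₁
      S₁ = append-step C v<n w<n arc t≡t unmarked
      enough : Counted D₁ w (c D w + 1)
      enough = append-counted-suc C v<n w<n arc t≡t unmarked
      -- The counter of `w` is not updated yet; the invariant tolerates this, since witnesses only
      -- bound it from above.
      wk₁ : Work e (record X { lv = D₁ })
      wk₁ = record { valid = C₁ ; pending = pending wk ; width≡s = width≡s wk }
      Ψ₁≤ : Ψ (record X { lv = D₁ }) ≤ Ψ X + γ
      Ψ₁≤ = ≤-trans (+-monoˡ-≤ (μ * height X) (append-Φ {D} {v} {w} C v<n))
        (≤-reflexive (trans (+-assoc (Φ D) γ _) (trans (cong (Φ D +_) (+-comm γ _)) (sym (+-assoc (Φ D) _ γ)))))
      counted : c D w + 1 < reg σ rS → Touched e v w X (record X { lv = count D₁ w })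
      counted lt = record
        { effect = record
          { work = record { valid = count-core C₁ enough lt′ ; pending = pending wk ; width≡s = width≡s wk }
          ; progress = step-trans S₁ (count-step C₁ enough lt′)
          ; Ψ≤ = +-cancelʳ-≤ γ _ _ (begin
              Φ (count D₁ w) + μ * height X + γ   ≡⟨ +-assoc (Φ (count D₁ w)) _ γ ⟩
              Φ (count D₁ w) + (μ * height X + γ) ≡⟨ cong (Φ (count D₁ w) +_) (+-comm _ γ) ⟩
              Φ (count D₁ w) + (γ + μ * height X) ≡⟨ +-assoc (Φ (count D₁ w)) γ _ ⟨
              Φ (count D₁ w) + γ + μ * height X   ≤⟨ +-monoˡ-≤ _ (count-Φ {D₁} w<n lt′) ⟩
              Φ D₁ + μ * height X                 ≤⟨ Ψ₁≤ ⟩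
              Ψ X + γ                             ∎) }
        ; near = λ _ → kv<kw , inj₂ (at-same₂ (M D) w v (t D v)) }
        where
        open ≤-Reasoning
        lt′ : c D w + 1 < s
        lt′ = subst (c D w + 1 <_) (width≡s wk) lt
      jumped : reg σ rS ≤ c D w + 1 →
             wp raiseᶜ (after (ld rQ aT nothing rW) (after appendᶜ (after unmarkedᶜ (after blocksᶜ σ))))
               (λ σ′ → Keeps σ σ′ × Touched e v w X (contents σ′))
      jumped le = consequence (λ σ′ → Keeps σ σ′ × Touched e v w X (contents σ′))
        (raise-safe e (after (ld rQ aT nothing rW) (after appendᶜ (after unmarkedᶜ (after blocksᶜ σ))))
          wk₁ (height<H X Ψ≤B) v<n w<n
          (λ v≡w → <⇒≢ kv<kw (cong (k D) v≡w)) (k<t C w<n)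
          (jump≤τ C₁ w<n (subst (Counted D₁ w) (≤-antisym c+1≤s (subst (_≤ c D w + 1) (width≡s wk) le)) enough))
          (subst (k D v <_) t≡t (k<t C v<n)) (≤-reflexive (sym t≡t)))
        λ (kept , r) → kept , record
          { effect = record
            { work = work (effect r)
            ; progress = step-trans S₁ (progress (effect r))
            -- The target is t w itself, so the `γ` drawn by the append is returned.
            ; Ψ≤ = +-cancelʳ-≤ γ _ _ (≤-trans (Ψ+γ≤ r ≤-refl) Ψ₁≤) }
          ; near = λ _ →
              subst₂ _<_ (sym (k-v (progress (effect r)))) (sym (k≡q r)) (subst (k D v <_) t≡t (k<t C v<n)) ,
              -- The new level of `w` is the block end of `v`, and the new block of `w` ends beyond
              -- it.
              inj₁ (subst₂ _<_ (trans (k≡q r) (trans (sym t≡t) (sym (t-v (progress (effect r)))))) refl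
                (k<t (valid (work (effect r))) w<n)) }

  _then_ : ∀ {c d σ Q R} → Safe c σ Q → (∀ {σ′} → Q σ′ → Safe d σ′ R) → Safe (c ⨾ d) σ R
  _then_ {c} {d} {R = R} (safe h) f = safe (wp-mono c (λ q → unfold (f q)) h)

  touch-safe : ∀ e σ → let X = contents σ ; D = lv X ; v = reg σ rV ; w = reg σ rW in
    Work e X → Ψ X ≤ B → v < n → w < n → 0 < M D w v →
    Safe touchᶜ σ (λ σ′ → Keeps σ σ′ × Touched e v w X (contents σ′))
  touch-safe e σ wk Ψ≤B v<n w<n arc =
    check-safe e σ wk Ψ≤B v<n w<n (arc-τ (valid wk) v<n w<n arc) then marking
    where
    X = contents σ
    v = reg σ rV
    w = reg σ rW
    marking : ∀ {σ₁} → Keeps σ σ₁ × Checked e v w X (contents σ₁) →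
              Safe markᶜ σ₁ (λ σ′ → Keeps σ σ′ × Touched e v w X (contents σ′))
    marking {σ₁} ((v≡ , w≡ , i≡) , r) = safe (consequence (λ σ′ → Keeps σ σ′ × Touched e v w X (contents σ′))
      (mark-safe e σ₁ (work (effect r)) (≤-trans (Ψ≤ (effect r)) Ψ≤B)
        (subst (_< n) (sym v≡) v<n) (subst (_< n) (sym w≡) w<n)
        (subst₂ (λ v w → 0 < M (lv (contents σ₁)) w v) (sym v≡) (sym w≡) (arc→ (progress (effect r)) arc))
        (subst₂ (λ v w → k (lv (contents σ₁)) v < k (lv (contents σ₁)) w) (sym v≡) (sym w≡) (k<k r)))
      λ { {σ′} ((v≡′ , w≡′ , i≡′) , r′) → (trans v≡′ v≡ , trans w≡′ w≡ , trans i≡′ i≡) ,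
        composed (contents σ′) (subst₂ (λ v w → Touched e v w (contents σ₁) (contents σ′)) v≡ w≡ r′) })
      where
      composed : ∀ X′ → Touched e v w (contents σ₁) X′ → Touched e v w X X′
      composed X′ r′ = record { effect = effect-trans (effect r) (effect r′) ; near = near r′ }

  -- The index counts down. The length must stay fixed, or entries added on the way would escape the
  -- scan.
  record ListInv (X₀ : Contents) (v : ℕ) (σ : State) : Set where
    field
      v≡    : reg σ rV ≡ v
      works : Work v (contents σ)
      steps : Step v (lv X₀) (lv (contents σ))
      len≡₀ : len (lv (contents σ)) v ≡ len (lv X₀) v
      i≤    : reg σ rI ≤ len (lv X₀) v
      seen  : ∀ {j} → reg σ rI ≤ j → j < len (lv X₀) v →
              k (lv (contents σ)) v < k (lv (contents σ)) (L (lv (contents σ)) j v)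
      Ψ≤₀   : Ψ (contents σ) ≤ Ψ X₀

  -- `seen` asks for `Good`, because this scan also rebuilds the list of `v`.
  record RowInv (X₀ : Contents) (v : ℕ) (σ : State) : Set where
    field
      v≡    : reg σ rV ≡ v
      works : Work v (contents σ)
      steps : Step v (lv X₀) (lv (contents σ))
      i≤    : reg σ rI ≤ n
      seen  : ∀ {b} → reg σ rI ≤ b → b < n → Good (lv (contents σ)) v b
      Ψ≤₀   : Ψ (contents σ) ≤ Ψ X₀

  Decreased : (State → Set) → State → State → Set
  Decreased Inv σ σ′ = Inv σ′ × suc (reg σ′ rI) ≡ reg σ rI × Ψ (contents σ′) ≤ Ψ (contents σ)

  countdown : ∀ {i j} → i ∸ 1 ≤ j → ¬ i ≤ j → j ≡ i ∸ 1
  countdown {zero}  p q = ⊥-elim (q z≤n)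
  countdown {suc i} p q = ≤-antisym (≤-pred (≰⇒> q)) p

  suc-pred-positive : ∀ {i} → 0 < i → suc (i ∸ 1) ≡ i
  suc-pred-positive (s≤s z≤n) = refl

  pred<  : ∀ {i} → 0 < i → i ∸ 1 < i
  pred< (s≤s z≤n) = ≤-refl

  -- `a * rI` pays for the rounds themselves, and Ψ for all raises and appends made in them.
  for-loop : ∀ {body} a (Inv : State → Set) → 3 + cost body ≤ a →
    (∀ {σ} → Inv σ → 0 < reg σ rI → Safe body σ (Decreased Inv σ)) →
    ∀ {σ} → Inv σ → Ends (while rI body) σ (λ t σ′ →
      Inv σ′ × reg σ′ rI ≡ 0 × t + Ψ (contents σ′) ≤ 3 + (Ψ (contents σ) + a * reg σ rI))
  for-loop {body} a Inv le safely {σ} inv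
    with eval-while Inv (λ σ → Ψ (contents σ) + a * reg σ rI) round inv
    where
    round : ∀ {σ} → Inv σ → 0 < reg σ rI → Ends body σ (λ t σ′ →
      Inv σ′ × 3 + t + (Ψ (contents σ′) + a * reg σ′ rI) ≤ Ψ (contents σ) + a * reg σ rI)
    round {σ} inv pos with eval (safely inv pos)
    ... | t , σ′ , x , t≤ , inv′ , i≡ , Ψ≤′ = t , σ′ , x , inv′ , (begin
      3 + t + (Ψ (contents σ′) + a * reg σ′ rI)
        ≤⟨ +-mono-≤ (≤-trans (+-monoʳ-≤ 3 t≤) le) (+-monoˡ-≤ _ Ψ≤′) ⟩
      a + (Ψ (contents σ) + a * reg σ′ rI)
        ≡⟨ solve 3 (λ a p i → a :+ (p :+ a :* i) := p :+ a :* (con 1 :+ i)) refl a (Ψ (contents σ)) (reg σ′ rI) ⟩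
      Ψ (contents σ) + a * suc (reg σ′ rI)
        ≡⟨ cong (λ i → Ψ (contents σ) + a * i) i≡ ⟩
      Ψ (contents σ) + a * reg σ rI ∎)
      where
      open ≤-Reasoning
      open +-*-Solver
  ... | t , σ′ , x , inv′ , i≡0 , le′ = t , σ′ , x , inv′ , i≡0 , ≤-trans (+-monoʳ-≤ t (m≤m+n _ _)) le′

  list-body : ∀ X₀ σ → let v = reg σ rV in Ψ X₀ ≤ B → v < n → ListInv X₀ v σ → 0 < reg σ rI →
              Safe listBodyᶜ σ (Decreased (ListInv X₀ v) σ)
  list-body X₀ σ Ψ≤B v<n inv pos = safe (
    <⇒≤ (<-trans j<l l<H) , v<n ,
    consequence (Decreased (ListInv X₀ v) σ)
      (check-safe v (after nextEntryᶜ σ) (moved (works inv)) (≤-trans (Ψ≤₀ inv) Ψ≤B) v<n w<n (arc-τ C v<n w<n arc))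
      λ { {σ′} ((v≡′ , _ , i≡′) , r) → record
          { v≡    = v≡′
          ; works = work (effect r)
          ; steps = step-trans (steps inv) (progress (effect r))
          ; len≡₀ = trans (len≡ r) (len≡₀ inv)
          ; i≤    = subst (_≤ len (lv X₀) v) (sym i≡′) (≤-trans (m∸n≤m (reg σ rI) 1) (i≤ inv))
          ; seen  = λ {j′} le lt → seen′ σ′ r j′ (subst (_≤ j′) i≡′ le) lt
          ; Ψ≤₀   = ≤-trans (Ψ≤ (effect r)) (Ψ≤₀ inv) } ,
          trans (cong suc i≡′) (suc-pred-positive pos) , Ψ≤ (effect r) })
    where
    open ListInv
    X = contents σ
    D = lv X
    v = reg σ rV
    j = reg σ rI ∸ 1
    w = L D j v
    C : Core D
    C = valid (works inv)
    l<H : len D v < H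
    l<H = len<H X (works inv) (≤-trans (Ψ≤₀ inv) Ψ≤B) v<n
    j<l : j < len D v
    j<l = <-≤-trans (pred< pos) (subst (reg σ rI ≤_) (sym (len≡₀ inv)) (i≤ inv))
    w<n : w < n
    w<n = proj₁ (entry C v<n j<l)
    arc : 0 < M D w v
    arc = proj₂ (entry C v<n j<l)
    moved : Work v X → Work v (contents (after nextEntryᶜ σ))
    moved wk = record { valid = valid wk ; pending = pending wk ; width≡s = width≡s wk }
    seen′ : ∀ σ′ → Checked v v w X (contents σ′) → ∀ j′ → j ≤ j′ → j′ < len (lv X₀) v →
            k (lv (contents σ′)) v < k (lv (contents σ′)) (L (lv (contents σ′)) j′ v)
    seen′ σ′ r j′ le lt with reg σ rI ≤? j′
    -- Entries checked before stay respected: k v is fixed during the scan, and heads only rise.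
    ... | yes p = subst₂ _<_ (sym (k-v (progress (effect r)))) (cong (λ g → k (lv (contents σ′)) (g j′ v)) (sym (L≡ r)))
                    (<-≤-trans (seen inv p lt) (k-mono (progress (effect r)) _))
    ... | no ¬p rewrite countdown le ¬p =
      subst (k (lv (contents σ′)) v <_) (cong (λ g → k (lv (contents σ′)) (g j v)) (sym (L≡ r))) (k<k r)

  row-body : ∀ X₀ σ → let v = reg σ rV in Ψ X₀ ≤ B → v < n → RowInv X₀ v σ → 0 < reg σ rI →
             Safe rowBodyᶜ σ (Decreased (RowInv X₀ v) σ)
  row-body X₀ σ Ψ≤B v<n inv pos = safe (
    <n⇒≤H w<n , v<n ,
    (λ arc → consequence (Decreased (RowInv X₀ v) σ)
      (touch-safe v (after nextArcᶜ σ) (moved (works inv)) (≤-trans (Ψ≤₀ inv) Ψ≤B) v<n w<n arc)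
      λ { {σ′} ((v≡′ , _ , i≡′) , r) → record
          { v≡    = v≡′
          ; works = work (effect r)
          ; steps = step-trans (steps inv) (progress (effect r))
          ; i≤    = subst (_≤ n) (sym i≡′) (<⇒≤ w<n)
          ; seen  = λ {b} le b<n → seen′ (lv (contents σ′)) (good (progress (effect r))) (near r) b (subst (_≤ b) i≡′ le) b<n
          ; Ψ≤₀   = ≤-trans (Ψ≤ (effect r)) (Ψ≤₀ inv) } ,
          trans (cong suc i≡′) (suc-pred-positive pos) , Ψ≤ (effect r) }) ,
    (λ none → record
      { v≡    = refl
      ; works = moved (works inv)
      ; steps = steps inv
      ; i≤    = <⇒≤ w<n
      ; seen  = λ {b} le b<n → seen′ D (λ _ h → h) (λ arc → ⊥-elim (<⇒≢ arc (sym none))) b le b<n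
      ; Ψ≤₀   = Ψ≤₀ inv } , suc-pred-positive pos , ≤-refl))
    where
    open RowInv
    X = contents σ
    D = lv X
    v = reg σ rV
    w = reg σ rI ∸ 1
    w<n : w < n
    w<n = <-≤-trans (pred< pos) (i≤ inv)
    moved : Work v X → Work v (contents (after nextArcᶜ σ))
    moved wk = record { valid = valid wk ; pending = pending wk ; width≡s = width≡s wk }
    seen′ : ∀ D′ → (∀ {b} → b < n → Good D v b → Good D′ v b) → Good D′ v w →
            ∀ b → w ≤ b → b < n → Good D′ v b
    seen′ D′ keep new b le b<n with reg σ rI ≤? b
    ... | yes p = keep b<n (seen inv p b<n)
    ... | no ¬p rewrite countdown le ¬p = new

  -- `ν * len` is still owed here: it is released when `settleᶜ` clears `pend` afterwards. A row
  -- scan is paid by the `F` that `unfillᶜ` releases and fits the same bound.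
  record Scanned (X : Contents) (v t : ℕ) (X′ : Contents) : Set where
    field
      work′  : Work v X′
      ok′    : ∀ {a b} → a < n → b < n → OK (lv X) a b → OK (lv X′) a b
      good′  : ∀ {b} → b < n → Good (lv X′) v b
      pend′  : pend (lv X′) v ≡ pend (lv X) v
      arc′   : ∀ {a b} → 0 < M (lv X) b a → 0 < M (lv X′) b a
      Ψ≤′    : Ψ X′ ≤ Ψ X
      paid   : t + Ψ X′ ≤ 15 + Ψ X + ν * len (lv X′) v

  list-scan : ∀ σ → let X = contents σ ; D = lv X ; v = reg σ rV in
    Work v X → Ψ X ≤ B → v < n → full D v ≡ 0 → (∀ {b} → b < n → OK D v b) →
    Ends listᶜ σ (λ t σ′ → reg σ′ rV ≡ v × Scanned X v t (contents σ′))
  list-scan σ wk Ψ≤B v<n full≡0 oks = conclude (for-loop ν (ListInv X v) list≤ν round start)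
    where
    open ListInv
    X = contents σ
    v = reg σ rV
    round : ∀ {σ} → ListInv X v σ → 0 < reg σ rI → Safe listBodyᶜ σ (Decreased (ListInv X v) σ)
    round {σ} inv = subst (λ u → u < n → ListInv X u σ → 0 < reg σ rI → Safe listBodyᶜ σ (Decreased (ListInv X u) σ))
      (v≡ inv) (list-body X σ Ψ≤B) v<n inv
    start : ListInv X v (after (ld rI aLen nothing rV) σ)
    start = record
      { v≡    = refl
      ; works = record { valid = valid wk ; pending = pending wk ; width≡s = width≡s wk }
      ; steps = step-refl (valid wk)
      ; len≡₀ = refl
      ; i≤    = ≤-refl
      ; seen  = λ le lt → ⊥-elim (<⇒≱ lt le)
      ; Ψ≤₀   = ≤-refl }
    conclude : Ends (while rI listBodyᶜ) (after (ld rI aLen nothing rV) σ) (λ t σ′ →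
      ListInv X v σ′ × reg σ′ rI ≡ 0 × t + Ψ (contents σ′) ≤ 3 + (Ψ X + ν * len (lv X) v)) →
      Ends listᶜ σ (λ t σ′ → reg σ′ rV ≡ v × Scanned X v t (contents σ′))
    conclude (t , σ′ , x , inv , i≡0 , le) = _ , σ′ , (ld z≤n v<n ⨾ x) , v≡ inv , record
      { work′ = works inv
      ; ok′   = ok (steps inv)
      ; good′ = λ b<n → scanned-good (valid (works inv)) v<n (trans (full-v (steps inv)) full≡0)
                  (λ {j} lt → seen inv (subst (_≤ j) (sym i≡0) z≤n) (subst (j <_) (len≡₀ inv) lt))
                  b<n (ok (steps inv) v<n b<n (oks b<n))
      ; pend′ = pend-v (steps inv)
      ; arc′  = arc→ (steps inv)
      ; Ψ≤′   = Ψ≤₀ inv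
      ; paid  = ≤-trans (+-monoʳ-≤ 9 le) (≤-trans
                  (≤-reflexive (cong (λ l → 12 + (Ψ (contents σ) + ν * l)) (sym (len≡₀ inv))))
                  (≤-trans (≤-reflexive (sym (+-assoc 12 (Ψ (contents σ)) _)))
                    (+-monoˡ-≤ _ (+-monoˡ-≤ (Ψ (contents σ)) (m≤m+n 12 3))))) }

  row-scan : ∀ σ → let X = contents σ ; D = lv X ; v = reg σ rV in
    Work v X → Ψ X ≤ B → v < n → 0 < full D v →
    Ends rowᶜ σ (λ t σ′ → reg σ′ rV ≡ v × Scanned X v t (contents σ′))
  row-scan σ wk Ψ≤B v<n full>0 = conclude (for-loop f (RowInv X v) row≤f round start)
    where
    open RowInv
    X = contents σ
    v = reg σ rV
    round : ∀ {σ} → RowInv X v σ → 0 < reg σ rI → Safe rowBodyᶜ σ (Decreased (RowInv X v) σ)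
    round {σ} inv = subst (λ u → u < n → RowInv X u σ → 0 < reg σ rI → Safe rowBodyᶜ σ (Decreased (RowInv X u) σ))
      (v≡ inv) (row-body X σ Ψ≤B) v<n inv
    start : RowInv X v (assign rI (λ _ → n) σ)
    start = record
      { v≡    = refl
      ; works = record { valid = valid wk ; pending = pending wk ; width≡s = width≡s wk }
      ; steps = step-refl (valid wk)
      ; i≤    = ≤-refl
      ; seen  = λ le lt → ⊥-elim (<⇒≱ lt le)
      ; Ψ≤₀   = ≤-refl }
    conclude : Ends (while rI rowBodyᶜ) (assign rI (λ _ → n) σ) (λ t σ′ →
      RowInv X v σ′ × reg σ′ rI ≡ 0 × t + Ψ (contents σ′) ≤ 3 + (Ψ X + f * n)) →
      Ends rowᶜ σ (λ t σ′ → reg σ′ rV ≡ v × Scanned X v t (contents σ′))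
    conclude (t , σ′ , x , inv , i≡0 , le) =
      _ , after unfillᶜ σ′ , (size ⨾ (x ⨾ (set ⨾ st z≤n (subst (_< n) (sym (v≡ inv)) v<n)))) , v≡ inv ,
      subst (λ u → Scanned (contents σ) (reg σ rV) _ (record (contents σ′) { lv = unfill (lv (contents σ′)) u }))
        (sym (v≡ inv)) finished
      where
      D′ = lv (contents σ′)
      allGood : ∀ {b} → b < n → Good D′ v b
      allGood {b} b<n = seen inv (subst (_≤ b) (sym i≡0) z≤n) b<n
      released : Φ (unfill D′ v) + μ * reg σ′ rP + F ≤ Ψ (contents σ′)
      released = ≤-trans (≤-reflexive (trans (+-assoc (Φ (unfill D′ v)) _ F) (trans (cong (Φ (unfill D′ v) +_) (+-comm _ F)) (sym (+-assoc (Φ (unfill D′ v)) F _)))))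
        (+-monoˡ-≤ (μ * reg σ′ rP) (unfill-Φ {D′} v<n (subst (0 <_) (sym (full-v (steps inv))) full>0)))
      finished : Scanned X v (2 + (t + (1 + 9))) (record (contents σ′) { lv = unfill D′ v })
      finished = record
        { work′ = record { valid = unfill-core (valid (works inv)) v ; pending = pending (works inv) ; width≡s = width≡s (works inv) }
        ; ok′   = λ a<n b<n h → unfill-ok (valid (works inv)) (λ _ → allGood b<n) (ok (steps inv) a<n b<n h)
        ; good′ = allGood
        ; pend′ = pend-v (steps inv)
        ; arc′  = arc→ (steps inv)
        ; Ψ≤′   = ≤-trans (m≤m+n _ F) (≤-trans released (Ψ≤₀ inv))
        ; paid  = ≤-trans (+-cancelʳ-≤ F _ _ balance) (m≤m+n _ _) }
        where
        open ≤-Reasoning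
        open +-*-Solver
        Ψ′ = Φ (unfill D′ v) + μ * reg σ′ rP
        -- 2 for `size`, 10 for `unfillᶜ` and 3 for leaving the loop.
        balance : 2 + (t + 10) + Ψ′ + F ≤ 15 + Ψ X + F
        balance = begin
          2 + (t + 10) + Ψ′ + F       ≡⟨ solve 3 (λ t p f → con 2 :+ (t :+ con 10) :+ p :+ f := con 12 :+ (t :+ (p :+ f))) refl t Ψ′ F ⟩
          12 + (t + (Ψ′ + F))         ≤⟨ +-monoʳ-≤ 12 (≤-trans (+-monoʳ-≤ t released) le) ⟩
          15 + (Ψ X + F)              ≡⟨ +-assoc 15 (Ψ X) F ⟨
          15 + Ψ X + F                ∎

  record Idling (X₀ : Contents) (σ : State) : Set where
    field
      works : Work n (contents σ)
      oks   : ∀ {a b} → a < n → b < n → OK (lv (contents σ)) a b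
      arcs  : ∀ {a b} → 0 < M (lv X₀) b a → 0 < M (lv (contents σ)) b a
      Ψ≤₀   : Ψ (contents σ) ≤ Ψ X₀

  straight : ∀ c σ → wp c σ (_≡ after c σ) → ∃[ t ] Eval c σ t (after c σ) × t ≤ cost c
  straight c σ h with eval (safe {c} h)
  ... | t , _ , x , t≤ , refl = t , x , t≤

  scan : ∀ σ → let X = contents σ ; D = lv X ; v = reg σ rV in
    Work v X → Ψ X ≤ B → v < n → (∀ {b} → b < n → OK D v b) →
    ∃[ t₀ ] Ends scanᶜ σ (λ t σ′ → t ≤ 12 + t₀ × reg σ′ rV ≡ v × Scanned X v t₀ (contents σ′))
  scan σ wk Ψ≤B v<n oks = branch (full (lv (contents σ)) (reg σ rV)) refl
    where
    X = contents σ
    v = reg σ rV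
    σ₁ = after filledᶜ σ
    wk₁ : Work v (contents σ₁)
    wk₁ = record { valid = valid wk ; pending = pending wk ; width≡s = width≡s wk }
    branch : ∀ x → full (lv X) v ≡ x →
      ∃[ t₀ ] Ends scanᶜ σ (λ t σ′ → t ≤ 12 + t₀ × reg σ′ rV ≡ v × Scanned X v t₀ (contents σ′))
    branch zero e = conclude (list-scan σ₁ wk₁ Ψ≤B v<n e oks)
      where
      conclude : Ends listᶜ σ₁ (λ t σ′ → reg σ′ rV ≡ v × Scanned X v t (contents σ′)) → _
      conclude (t , σ′ , x , v≡ , r) = t , 9 + (1 + (t + 2)) , σ′ , (ld z≤n v<n ⨾ false e x) ,
        ≤-reflexive (cong (10 +_) (+-comm t 2)) , v≡ , r
    branch (suc _) e = conclude (row-scan σ₁ wk₁ Ψ≤B v<n full>0)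
      where
      full>0 : 0 < full (lv X) v
      full>0 = subst (0 <_) (sym e) (s≤s z≤n)
      conclude : Ends rowᶜ σ₁ (λ t σ′ → reg σ′ rV ≡ v × Scanned X v t (contents σ′)) → _
      conclude (t , σ′ , x , v≡ , r) = t , 9 + (1 + t) , σ′ , (ld z≤n v<n ⨾ true full>0 x) ,
        +-monoˡ-≤ t (m≤m+n 10 2) , v≡ , r

  process-body : ∀ {X₀ σ} → Ψ X₀ ≤ B → Idling X₀ σ → 0 < reg σ rP →
    Ends (popᶜ ⨾ if rA (scanᶜ ⨾ settleᶜ) skip) σ
      (λ t σ′ → Idling X₀ σ′ × 3 + t + Ψ (contents σ′) ≤ Ψ (contents σ))
  process-body {X₀} {σ} Ψ≤B inv pos = afterPop (straight popᶜ σ (<⇒≤ h<H , 0<n , z≤n , v<n , refl))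
    where
    open Idling
    X = contents σ
    D = lv X
    h = reg σ rP ∸ 1
    v = stack X h
    σ₁ = after popᶜ σ
    X₁ : Contents
    X₁ = record X { height = h }
    wk : Work n X
    wk = works inv
    h<H : h < H
    h<H = <-trans (pred< pos) (height<H X (≤-trans (Ψ≤₀ inv) Ψ≤B))
    v<n : v < n
    v<n = stack<n (pending wk) (pred< pos)
    popped : ∀ {u} → u < n → 0 < pend D u → u ≡ v ⊎ ∃[ i ] i < h × stack X i ≡ u
    popped u<n p with stacked (pending wk) u<n p
    ... | inj₁ refl = ⊥-elim (<-irrefl refl u<n)
    ... | inj₂ (i , lt , refl) with i ≟ h
    ... | yes refl = inj₁ refl
    ... | no ¬p = inj₂ (i , ≤∧≢⇒< (≤-pred (≤-trans lt (≤-reflexive (sym (suc-pred-positive pos))))) ¬p , refl)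
    wk₁ : Work v X₁
    wk₁ = record
      { valid = valid wk
      ; pending = record { stacked = popped ; stack<n = λ lt → stack<n (pending wk) (<-trans lt (pred< pos)) }
      ; width≡s = width≡s wk }
    Ψ₁+μ : Ψ X₁ + μ ≡ Ψ X
    Ψ₁+μ = begin
      Φ D + μ * h + μ       ≡⟨ solve 3 (λ p m h → p :+ m :* h :+ m := p :+ m :* (con 1 :+ h)) refl (Φ D) μ h ⟩
      Φ D + μ * suc h       ≡⟨ cong (λ z → Φ D + μ * z) (suc-pred-positive pos) ⟩
      Ψ X                   ∎
      where
      open ≡-Reasoning
      open +-*-Solver
    Ψ₁≤ : Ψ X₁ ≤ Ψ X
    Ψ₁≤ = ≤-trans (m≤m+n (Ψ X₁) μ) (≤-reflexive Ψ₁+μ)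
    Goal : Set
    Goal = Ends (popᶜ ⨾ if rA (scanᶜ ⨾ settleᶜ) skip) σ
      (λ t σ′ → Idling X₀ σ′ × 3 + t + Ψ (contents σ′) ≤ Ψ X)
    afterPop : ∃[ t ] Eval popᶜ σ t σ₁ × t ≤ cost popᶜ → Goal
    afterPop (t , x , t≤) = branch (pend D v) refl
      where
      branch : ∀ z → pend D v ≡ z → Goal
      -- An outdated copy: `v` is not pending, so dropping it loses no pending vertex.
      branch zero e = _ , σ₁ , (x ⨾ false e skip) , record
        { works = record
          { valid = valid wk
          ; pending = record { stacked = unpending ; stack<n = stack<n (pending wk₁) }
          ; width≡s = width≡s wk }
        ; oks = oks inv
        ; arcs = arcs inv
        ; Ψ≤₀ = ≤-trans Ψ₁≤ (Ψ≤₀ inv) } , (begin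
          3 + (t + 3) + Ψ X₁           ≤⟨ +-monoˡ-≤ (Ψ X₁) (+-monoʳ-≤ 3 (+-monoˡ-≤ 3 t≤)) ⟩
          3 + (cost popᶜ + 3) + Ψ X₁   ≤⟨ +-monoˡ-≤ (Ψ X₁) (≤-trans (m≤m+n (3 + (cost popᶜ + 3)) 54) pop≤μ) ⟩
          μ + Ψ X₁                     ≡⟨ trans (+-comm μ _) Ψ₁+μ ⟩
          Ψ X                          ∎)
        where
        open ≤-Reasoning
        unpending : ∀ {u} → u < n → 0 < pend D u → u ≡ n ⊎ ∃[ i ] i < h × stack X i ≡ u
        unpending u<n p with popped u<n p
        ... | inj₁ refl = ⊥-elim (<⇒≢ p (sym e))
        ... | inj₂ q    = inj₂ q
      branch (suc _) e = afterScan (scan σ₁ (record { valid = valid wk₁ ; pending = pending wk₁ ; width≡s = width≡s wk₁ })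
          (≤-trans Ψ₁≤ (≤-trans (Ψ≤₀ inv) Ψ≤B)) v<n (oks inv v<n))
        where
        pend>0 : 0 < pend D v
        pend>0 = subst (0 <_) (sym e) (s≤s z≤n)
        afterScan : ∃[ t₀ ] Ends scanᶜ σ₁ (λ t σ′ → t ≤ 12 + t₀ × reg σ′ rV ≡ v × Scanned X₁ v t₀ (contents σ′)) → Goal
        afterScan (t₀ , t₁ , σ₂ , y , t₁≤ , v≡ , r) = _ , after settleᶜ σ₂ ,
            (x ⨾ true pend>0 (y ⨾ (set ⨾ st z≤n (subst (_< n) (sym v≡) v<n)))) , idle , cheap
          where
          open Scanned r
          X₂ = contents σ₂
          D₂ = lv X₂
          u = reg σ₂ rV
          X₃ = contents (after settleᶜ σ₂)
          pend₂>0 : 0 < pend D₂ v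
          pend₂>0 = subst (0 <_) (sym pend′) pend>0
          settled : Φ (settle D₂ v) + μ * height X₂ + ν * len D₂ v ≤ Ψ X₂
          settled = ≤-trans (≤-reflexive (trans (+-assoc (Φ (settle D₂ v)) _ (ν * len D₂ v))
              (trans (cong (Φ (settle D₂ v) +_) (+-comm _ (ν * len D₂ v))) (sym (+-assoc (Φ (settle D₂ v)) (ν * len D₂ v) _)))))
            (+-monoˡ-≤ (μ * height X₂) (settle-Φ {D₂} v<n pend₂>0))
          settled′ : Ψ X₃ + ν * len D₂ v ≤ Ψ X₂
          settled′ = subst (λ z → Φ (settle D₂ z) + μ * height X₂ + ν * len D₂ v ≤ Ψ X₂) (sym v≡) settled
          stacked′ : ∀ {a} → a < n → 0 < pend (settle D₂ v) a → a ≡ n ⊎ ∃[ i ] i < height X₂ × stack X₂ i ≡ a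
          stacked′ {a} a<n p with v ≟ a
          ... | yes refl = ⊥-elim (<⇒≢ p (sym (at-same (pend D₂) v 0)))
          ... | no ¬p with stacked (pending work′) a<n (subst (0 <_) (at-other (pend D₂) 0 ¬p) p)
          ... | inj₁ refl = ⊥-elim (¬p refl)
          ... | inj₂ q    = inj₂ q
          idle : Idling X₀ (after settleᶜ σ₂)
          idle = record
            { works = record
              { valid = settle-core (valid work′) u
              ; pending = record
                { stacked = λ {a} a<n → subst (λ z → 0 < pend (settle D₂ z) a → a ≡ n ⊎ ∃[ i ] i < height X₂ × stack X₂ i ≡ a) (sym v≡) (stacked′ a<n)
                ; stack<n = stack<n (pending work′) }
              ; width≡s = width≡s work′ }
            ; oks = λ {a} {b} a<n b<n → settle-ok (valid work′) {u} {a} {b}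
                (λ _ → subst (λ z → Good D₂ z b) (sym v≡) (good′ b<n)) (ok′ a<n b<n (oks inv a<n b<n))
            ; arcs = λ p → arc′ (arcs inv p)
            ; Ψ≤₀ = ≤-trans (m≤m+n _ _) (≤-trans settled′ (≤-trans Ψ≤′ (≤-trans Ψ₁≤ (Ψ≤₀ inv)))) }
          cheap : 3 + (t + (1 + (t₁ + (1 + 9)))) + Ψ X₃ ≤ Ψ X
          cheap = +-cancelʳ-≤ (ν * len D₂ v) _ _ (begin
            3 + (t + (1 + (t₁ + 10))) + Ψ X₃ + ν * len D₂ v
              ≡⟨ solve 4 (λ t u x l → con 3 :+ (t :+ (con 1 :+ (u :+ con 10))) :+ x :+ l := con 14 :+ t :+ (u :+ (x :+ l)))
                   refl t t₁ (Ψ X₃) (ν * len D₂ v) ⟩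
            14 + t + (t₁ + (Ψ X₃ + ν * len D₂ v))
              ≤⟨ +-mono-≤ (+-monoʳ-≤ 14 t≤) (+-mono-≤ t₁≤ settled′) ⟩
            14 + cost popᶜ + (12 + t₀ + Ψ X₂)
              ≡⟨ cong (14 + cost popᶜ +_) (+-assoc 12 t₀ (Ψ X₂)) ⟩
            14 + cost popᶜ + (12 + (t₀ + Ψ X₂))
              ≤⟨ +-monoʳ-≤ (14 + cost popᶜ) (+-monoʳ-≤ 12 paid) ⟩
            14 + cost popᶜ + (12 + (15 + Ψ X₁ + ν * len D₂ v))
              ≡⟨ solve 3 (λ c p l → con 14 :+ c :+ (con 12 :+ (con 15 :+ p :+ l)) := con 41 :+ c :+ p :+ l) refl (cost popᶜ) (Ψ X₁) (ν * len D₂ v) ⟩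
            41 + cost popᶜ + Ψ X₁ + ν * len D₂ v
              -- 41 is 3 for the loop, 1 for the branch, 10 for `settleᶜ`, 12 for the choice in
              -- `scanᶜ` and 15 from `paid`.
              ≤⟨ +-monoˡ-≤ (ν * len D₂ v) (+-monoˡ-≤ (Ψ X₁) (≤-trans (+-monoˡ-≤ (cost popᶜ) (m≤m+n 41 19)) pop≤μ)) ⟩
            μ + Ψ X₁ + ν * len D₂ v
              ≡⟨ cong (_+ ν * len D₂ v) (trans (+-comm μ _) Ψ₁+μ) ⟩
            Ψ X + ν * len D₂ v ∎)
            where
            open ≤-Reasoning
            open +-*-Solver

  process-ends : ∀ {X₀ σ} → Ψ X₀ ≤ B → Idling X₀ σ → Ends processᶜ σ (λ t σ′ →
    Idling X₀ σ′ × reg σ′ rP ≡ 0 × t + Ψ (contents σ′) ≤ 3 + Ψ (contents σ))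
  process-ends {X₀} Ψ≤B = eval-while (Idling X₀) (λ σ → Ψ (contents σ)) (process-body Ψ≤B)

  -- One insertion

  record Ready (σ : State) : Set where
    field
      works  : Work n (contents σ)
      oks    : ∀ {a b} → a < n → b < n → OK (lv (contents σ)) a b
      empty  : reg σ rP ≡ 0

  -- A pending vertex would be on the stack, which is empty, or be the dummy `n`.
  ready-ordered : ∀ {σ a b} → Ready σ → a < n → b < n → 0 < M (lv (contents σ)) b a →
                  k (lv (contents σ)) a < k (lv (contents σ)) b
  ready-ordered {σ} {a} {b} ready a<n b<n arc = proj₁ (oks a<n b<n arc) (settled (pend (lv (contents σ)) a) refl)
    where
    open Ready ready
    settled : ∀ z → pend (lv (contents σ)) a ≡ z → pend (lv (contents σ)) a ≡ 0
    settled zero    e = e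
    settled (suc _) e with stacked (pending works) a<n (subst (0 <_) (sym e) (s≤s z≤n))
    ... | inj₁ refl = ⊥-elim (<-irrefl refl a<n)
    ... | inj₂ (i , lt , _) = ⊥-elim (<⇒≱ lt (subst (_≤ i) (sym empty) z≤n))

  record Connected (X : Contents) (v w : ℕ) (X′ : Contents) : Set where
    field
      works : Work n X′
      oks   : ∀ {a b} → a < n → b < n → ¬ (a ≡ v × b ≡ w) → OK (lv X′) a b
      arcs  : ∀ {a b} → 0 < M (lv X) b a → 0 < M (lv X′) b a
      new   : 0 < M (lv X′) w v
      Ψ≡    : Ψ X′ ≡ Ψ X

  connect-safe : ∀ σ → let X = contents σ ; v = reg σ rV ; w = reg σ rW in
    Ready σ → v < n → w < n → τ v < τ w →
    Safe connectᶜ σ (λ σ′ → Keeps σ σ′ × Connected X v w (contents σ′))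
  connect-safe σ ready v<n w<n τ<τ = safe (
    <n⇒≤H w<n , v<n ,
    (λ arc → (refl , refl , refl) , record
      { works = record { valid = valid works ; pending = pending works ; width≡s = width≡s works }
      ; oks = λ a<n b<n _ → oks a<n b<n
      ; arcs = λ h → h
      ; new = arc
      ; Ψ≡ = refl }) ,
    (λ none → <n⇒≤H w<n , v<n , (refl , refl , refl) , record
      { works = record { valid = connect-core (valid works) v<n w<n none τ<τ ; pending = pending works ; width≡s = width≡s works }
      ; oks = λ a<n b<n other → connect-ok (valid works) v<n w<n none other (oks a<n b<n)
      ; arcs = connect-arc→ (valid works) v<n w<n none
      ; new = subst (0 <_) (sym (at-same₂ (M (lv (contents σ))) (reg σ rW) (reg σ rV) 1)) (s≤s z≤n)
      ; Ψ≡ = refl }))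
    where open Ready ready

  record Inserted (X : Contents) (v w : ℕ) (σ′ : State) : Set where
    field
      ready : Ready σ′
      arcs  : ∀ {a b} → 0 < M (lv X) b a → 0 < M (lv (contents σ′)) b a
      new   : 0 < M (lv (contents σ′)) w v
      Ψ≤′   : Ψ (contents σ′) ≤ Ψ X

  insert-ends : ∀ σ → let X = contents σ ; v = reg σ rV ; w = reg σ rW in
    Ready σ → Ψ X ≤ B → v < n → w < n → τ v < τ w →
    Ends insertᶜ σ (λ t σ′ → Inserted X v w σ′ ×
      t + Ψ (contents σ′) ≤ 3 + cost (connectᶜ ⨾ touchᶜ) + Ψ X)
  insert-ends σ ready Ψ≤B v<n w<n τ<τ = processing (eval {connectᶜ ⨾ touchᶜ} (connect-safe σ ready v<n w<n τ<τ then touching))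
    where
    X = contents σ
    v = reg σ rV
    w = reg σ rW
    record Middle (σ₂ : State) : Set where
      field
        idle  : Idling (contents σ₂) σ₂
        arcs₂ : ∀ {a b} → 0 < M (lv X) b a → 0 < M (lv (contents σ₂)) b a
        new₂  : 0 < M (lv (contents σ₂)) w v
        Ψ≤₂   : Ψ (contents σ₂) ≤ Ψ X
    touching : ∀ {σ₁} → Keeps σ σ₁ × Connected X v w (contents σ₁) → Safe touchᶜ σ₁ Middle
    touching {σ₁} ((v≡ , w≡ , _) , r) = safe (consequence Middle
      (touch-safe n σ₁ works (≤-trans (≤-reflexive Ψ≡) Ψ≤B)
        (subst (_< n) (sym v≡) v<n) (subst (_< n) (sym w≡) w<n)
        (subst₂ (λ v w → 0 < M (lv (contents σ₁)) w v) (sym v≡) (sym w≡) new))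
      λ { {σ′} (_ , r′) → middle σ′ (subst₂ (λ v w → Touched n v w (contents σ₁) (contents σ′)) v≡ w≡ r′) })
      where
      open Connected r
      middle : ∀ σ′ → Touched n v w (contents σ₁) (contents σ′) → Middle σ′
      middle σ′ r′ = record
        { idle = record
          { works = work (effect r′)
          ; oks = λ {a} {b} a<n b<n → all a b a<n b<n
          ; arcs = λ h → h
          ; Ψ≤₀ = ≤-refl }
        ; arcs₂ = λ h → arc→ (progress (effect r′)) (arcs h)
        ; new₂ = arc→ (progress (effect r′)) new
        ; Ψ≤₂ = ≤-trans (Ψ≤ (effect r′)) (≤-reflexive Ψ≡) }
        where
        -- The new arc has just been touched, hence is good; all others were acceptable before and
        -- remain so.
        all : ∀ a b → a < n → b < n → OK (lv (contents σ′)) a b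
        all a b a<n b<n with a ≟ v | b ≟ w
        ... | yes refl | yes refl = λ arc → (λ _ → proj₁ (near r′ arc)) , (λ _ → proj₂ (near r′ arc))
        ... | no ¬p    | _        = ok (progress (effect r′)) a<n b<n (oks a<n b<n (λ (p , _) → ¬p p))
        ... | yes _    | no ¬q    = ok (progress (effect r′)) a<n b<n (oks a<n b<n (λ (_ , q) → ¬q q))
    total : ∀ C {t t′ p q r} → t ≤ C → t′ + p ≤ 3 + q → q ≤ r → t + t′ + p ≤ 3 + C + r
    total C {t} {t′} {p} {q} {r} t≤ le q≤r = begin
      t + t′ + p     ≡⟨ +-assoc t t′ p ⟩
      t + (t′ + p)   ≤⟨ +-mono-≤ t≤ (≤-trans le (+-monoʳ-≤ 3 q≤r)) ⟩
      C + (3 + r)    ≡⟨ +-assoc C 3 r ⟨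
      C + 3 + r      ≡⟨ cong (_+ r) (+-comm C 3) ⟩
      3 + C + r      ∎
      where open ≤-Reasoning
    processing : Ends (connectᶜ ⨾ touchᶜ) σ (λ t σ₂ → t ≤ cost (connectᶜ ⨾ touchᶜ) × Middle σ₂) →
      Ends insertᶜ σ (λ t σ′ → Inserted X v w σ′ × t + Ψ (contents σ′) ≤ 3 + cost (connectᶜ ⨾ touchᶜ) + Ψ X)
    processing (t , σ₂ , x , t≤ , mid) = finishing (process-ends (≤-trans Ψ≤₂ Ψ≤B) idle)
      where
      open Middle mid
      finishing : Ends processᶜ σ₂ (λ t σ′ → Idling (contents σ₂) σ′ × reg σ′ rP ≡ 0 ×
          t + Ψ (contents σ′) ≤ 3 + Ψ (contents σ₂)) → _
      finishing (t′ , σ′ , y , idle′ , empty′ , le) = t + t′ , σ′ , (x ⨾ y) , record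
        { ready = record { works = works ; oks = oks ; empty = empty′ }
        ; arcs = λ h → arcs (arcs₂ h)
        ; new = arcs new₂
        ; Ψ≤′ = ≤-trans Ψ≤₀ Ψ≤₂ } , total (cost (connectᶜ ⨾ touchᶜ)) t≤ le Ψ≤₂
        where
        open Idling idle′

-- Initialisation

testᶜ : Cmd
testᶜ = mul rB rS rS ⨾ size rA ⨾ sub rA rA rB

growᶜ : Cmd
growᶜ = set rB 1ᶠ ⨾ add rS rS rB ⨾ testᶜ

-- All vertices start at level 0, in the block that ends at `s`; the other tables start at 0, as the
-- memory does.
tableᶜ : Cmd
tableᶜ = set rA 1ᶠ ⨾ sub rI rI rA ⨾ st rS aT nothing rI

-- Trying 2, 3, ... takes O(√n) time and needs only multiplication.
rootᶜ : Cmd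
rootᶜ = (set rS 2ᶠ ⨾ testᶜ) ⨾ while rA growᶜ

initialiseᶜ : Cmd
initialiseᶜ = rootᶜ ⨾ (size rI ⨾ while rI tableᶜ)

-- The rounded-up square root, but at least 2: the mark 1 in M must differ from all
-- block ends, which are multiples of s.
record IsRoot (n s : ℕ) : Set where
  field
    2≤s     : 2 ≤ s
    n≤s²    : n ≤ s * s
    minimal : ∀ {x} → 2 ≤ x → x < s → x * x < n
open IsRoot

root : ∀ n → ∃[ s ] IsRoot n s
root n = go n 2 (s≤s (s≤s z≤n)) (λ p q → ⊥-elim (<⇒≱ q p)) (m≤m+n n 2)
  where
  go : ∀ fuel x → 2 ≤ x → (∀ {y} → 2 ≤ y → y < x → y * y < n) → n ≤ fuel + x → ∃[ s ] IsRoot n s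
  go fuel x 2≤x min le with n ≤? x * x
  ... | yes p = x , record { 2≤s = 2≤x ; n≤s² = p ; minimal = min }
  go zero x 2≤x min le | no ¬p =
    ⊥-elim (¬p (≤-trans le (m≤m*n x x {{>-nonZero (<-trans (s≤s z≤n) 2≤x)}})))
  go (suc fuel) x 2≤x min le | no ¬p = go fuel (suc x) (m≤n⇒m≤1+n 2≤x) min′ (≤-trans le (≤-reflexive (sym (+-suc fuel x))))
    where
    min′ : ∀ {y} → 2 ≤ y → y < suc x → y * y < n
    min′ {y} 2≤y y<x with y ≟ x
    ... | yes refl = ≰⇒> ¬p
    ... | no y≢x   = min 2≤y (≤∧≢⇒< (≤-pred y<x) y≢x)

-- If s = y + 1 with y ≥ 2, then y * y < n by minimality and s ≤ 2 * y. For s = 2 the bound comes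
-- from n ≥ 1.
root²≤4n : ∀ {n s} → 1 ≤ n → IsRoot n s → s * s ≤ 4 * n
root²≤4n {n} {suc zero} 1≤n R = ⊥-elim (<⇒≱ (2≤s R) ≤-refl)
root²≤4n {n} {suc (suc zero)} 1≤n R = *-monoʳ-≤ 4 1≤n
root²≤4n {n} {suc y@(suc (suc z))} 1≤n R = begin
  suc y * suc y       ≤⟨ *-mono-≤ double double ⟩
  (y + y) * (y + y)   ≡⟨ solve 1 (λ y → (y :+ y) :* (y :+ y) := con 4 :* (y :* y)) refl y ⟩
  4 * (y * y)         ≤⟨ *-monoʳ-≤ 4 (<⇒≤ (minimal R (s≤s (s≤s z≤n)) ≤-refl)) ⟩
  4 * n               ∎
  where
  open ≤-Reasoning
  open +-*-Solver
  double : suc y ≤ y + y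
  double = +-monoˡ-≤ y {1} {y} (s≤s z≤n)
root²≤4n {n} {zero} 1≤n R = z≤n

module Initialisation (n s : ℕ) .{{_ : NonZero n}} (R : IsRoot n s) (H W : ℕ) (s²≤H : s * s ≤ H)
  (word : 11 + ((H * 9 + 8) * n + n) < W) where

  open Machine n H W word

  Blank : State → Set
  Blank σ = reg σ rP ≡ 0 × (∀ a i v → arr σ a i v ≡ 0)

  record RootInv (σ : State) : Set where
    field
      2≤x   : 2 ≤ reg σ rS
      x≤s   : reg σ rS ≤ s
      a≡    : reg σ rA ≡ n ∸ reg σ rS * reg σ rS
      blank : Blank σ

  record TableInv (σ : State) : Set where
    field
      s≡     : reg σ rS ≡ s
      p≡     : reg σ rP ≡ 0
      i≤     : reg σ rI ≤ n
      others : ∀ a i v → column a ≢ 1 → arr σ a i v ≡ 0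
      table  : ∀ {u} → reg σ rI ≤ u → u < n → arr σ aT 0 u ≡ s

  private
    s≤H : s ≤ H
    s≤H = ≤-trans (m≤m*n s s {{>-nonZero (<-trans (s≤s z≤n) (2≤s R))}}) s²≤H

    grow : ∀ {σ} → RootInv σ → 0 < reg σ rA →
           Safe growᶜ σ (λ σ′ → RootInv σ′ × reg σ rS < reg σ′ rS)
    grow {σ} inv pos = safe (
      ≤-trans x+1≤s s≤H , ≤-trans (*-mono-≤ x+1≤s x+1≤s) s²≤H ,
      record { 2≤x = ≤-trans 2≤x (m≤m+n _ 1) ; x≤s = x+1≤s ; a≡ = refl ; blank = blank } ,
      m<m+n (reg σ rS) (s≤s z≤n))
      where
      open RootInv inv
      x² = reg σ rS * reg σ rS
      x²<n : x² < n
      x²<n = m∸n≢0⇒n<m (λ e → <⇒≢ pos (sym (trans a≡ e)))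
      x+1≤s : reg σ rS + 1 ≤ s
      x+1≤s = ≤-trans (≤-reflexive (+-comm (reg σ rS) 1))
        (≤∧≢⇒< x≤s (λ e → <⇒≱ x²<n (≤-trans (n≤s² R) (≤-reflexive (sym (cong₂ _*_ e e))))))

    fill : ∀ {σ} → TableInv σ → 0 < reg σ rI →
           Safe tableᶜ σ (λ σ′ → TableInv σ′ × reg σ′ rI < reg σ rI)
    fill {σ} inv pos = safe (z≤n , j<n , record
      { s≡ = s≡
      ; p≡ = p≡
      ; i≤ = <⇒≤ j<n
      ; others = others′
      ; table = λ {u} → table′ u } , pred<)
      where
      open TableInv inv
      j = reg σ rI ∸ 1
      pred< : j < reg σ rI
      pred< = ∸-monoʳ-< {reg σ rI} {1} {0} (s≤s z≤n) pos
      j<n : j < n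
      j<n = <-≤-trans pred< i≤
      others′ : ∀ a i v → column a ≢ 1 → arr (after tableᶜ σ) a i v ≡ 0
      others′ a i v p rewrite ≢⇒≡ᵇ-false (≢-sym p) = others a i v p
      table′ : ∀ u → j ≤ u → u < n → arr (after tableᶜ σ) aT 0 u ≡ s
      table′ u le u<n with j ≟ u
      ... | yes refl rewrite ≡ᵇ-refl j = s≡
      ... | no j≢u rewrite ≢⇒≡ᵇ-false j≢u = table (≤-trans (m≤n+m∸n (reg σ rI) 1) (≤∧≢⇒< le j≢u)) u<n

    drop-le : ∀ {t a b c} → 3 + t ≤ a → b < c → 3 + t + a * b ≤ a * c
    drop-le {t} {a} {b} {c} le lt = ≤-trans (+-monoˡ-≤ (a * b) le)
      (≤-trans (≤-reflexive (sym (*-suc a b))) (*-monoʳ-≤ a lt))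

  root-ends : ∀ {σ} → Blank σ → Ends rootᶜ σ (λ t σ′ → reg σ′ rS ≡ s × Blank σ′ × t ≤ 8 + 9 * s)
  -- 9 is the cost 6 of `growᶜ` plus 3 for the test and the jump back.
  root-ends {σ} blank = conclude (eval-while RootInv (λ σ → 9 * (s ∸ reg σ rS)) round start)
    where
    σ₁ = after (set rS 2ᶠ) σ
    σ₂ = assign rA (λ σ → reg σ rA ∸ reg σ rB) (assign rA (λ _ → n) (assign rB (λ σ → reg σ rS * reg σ rS) σ₁))
    4≤H : 4 ≤ H
    4≤H = ≤-trans (*-mono-≤ (2≤s R) (2≤s R)) s²≤H
    start : RootInv σ₂
    start = record { 2≤x = ≤-refl ; x≤s = 2≤s R ; a≡ = refl ; blank = blank }
    round : ∀ {σ} → RootInv σ → 0 < reg σ rA →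
            Ends growᶜ σ (λ t σ′ → RootInv σ′ × 3 + t + 9 * (s ∸ reg σ′ rS) ≤ 9 * (s ∸ reg σ rS))
    round {σ} inv pos = account (eval (grow inv pos))
      where
      account : Ends growᶜ σ (λ t σ′ → t ≤ cost growᶜ × RootInv σ′ × reg σ rS < reg σ′ rS) →
                Ends growᶜ σ (λ t σ′ → RootInv σ′ × 3 + t + 9 * (s ∸ reg σ′ rS) ≤ 9 * (s ∸ reg σ rS))
      account (t , σ′ , x , t≤ , inv′ , lt) = t , σ′ , x , inv′ ,
        drop-le (+-monoʳ-≤ 3 t≤) (∸-monoʳ-< lt (RootInv.x≤s inv′))
    conclude : Ends (while rA growᶜ) σ₂ (λ t σ′ → RootInv σ′ × reg σ′ rA ≡ 0 ×
        t + 9 * (s ∸ reg σ′ rS) ≤ 3 + 9 * (s ∸ 2)) →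
      Ends rootᶜ σ (λ t σ′ → reg σ′ rS ≡ s × Blank σ′ × t ≤ 8 + 9 * s)
    conclude (t , σ′ , x , inv , a≡0 , le) = _ , σ′ , ((set ⨾ (mul 4≤H ⨾ (size ⨾ sub))) ⨾ x) , exact , blank′ ,
      +-monoʳ-≤ 5 (≤-trans (m≤m+n t _) (≤-trans le (+-monoʳ-≤ 3 (*-monoʳ-≤ 9 (m∸n≤m s 2)))))
      where
      open RootInv inv renaming (blank to blank′)
      exact : reg σ′ rS ≡ s
      exact with reg σ′ rS <? s
      ... | yes lt = ⊥-elim (<⇒≱ (minimal R 2≤x lt) (m∸n≡0⇒m≤n (trans (sym a≡) a≡0)))
      ... | no ¬lt = ≤-antisym x≤s (≮⇒≥ ¬lt)

  Initialised : ℕ → State → Set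
  Initialised t σ = reg σ rS ≡ s × reg σ rP ≡ 0 × (∀ a i v → column a ≢ 1 → arr σ a i v ≡ 0) ×
                    (∀ {u} → u < n → arr σ aT 0 u ≡ s) × t ≤ 13 + 9 * s + 14 * n

  table-ends : ∀ {σ} → reg σ rS ≡ s → Blank σ →
    Ends (size rI ⨾ while rI tableᶜ) σ (λ t σ′ → ∀ {t₁} → t₁ ≤ 8 + 9 * s → Initialised (t₁ + t) σ′)
  -- 14 is the cost 11 of `tableᶜ` plus 3 for the loop.
  table-ends {σ₁} s≡₁ (p≡₁ , zeros) = conclude (eval-while TableInv (λ σ → 14 * reg σ rI) round start)
    where
    σ₂ = assign rI (λ _ → n) σ₁
    start : TableInv σ₂
    start = record { s≡ = s≡₁ ; p≡ = p≡₁ ; i≤ = ≤-refl ; others = λ a i v _ → zeros a i v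
                   ; table = λ le lt → ⊥-elim (<⇒≱ lt le) }
    round : ∀ {σ} → TableInv σ → 0 < reg σ rI →
            Ends tableᶜ σ (λ t σ′ → TableInv σ′ × 3 + t + 14 * reg σ′ rI ≤ 14 * reg σ rI)
    round {σ} inv pos = account (eval (fill inv pos))
      where
      account : Ends tableᶜ σ (λ t σ′ → t ≤ cost tableᶜ × TableInv σ′ × reg σ′ rI < reg σ rI) →
                Ends tableᶜ σ (λ t σ′ → TableInv σ′ × 3 + t + 14 * reg σ′ rI ≤ 14 * reg σ rI)
      account (t , σ′ , x , t≤ , inv′ , lt) = t , σ′ , x , inv′ , drop-le (+-monoʳ-≤ 3 t≤) lt
    conclude : Ends (while rI tableᶜ) σ₂ (λ t σ′ → TableInv σ′ × reg σ′ rI ≡ 0 × t + 14 * reg σ′ rI ≤ 3 + 14 * n) →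
      Ends (size rI ⨾ while rI tableᶜ) σ₁ (λ t σ′ → ∀ {t₁} → t₁ ≤ 8 + 9 * s → Initialised (t₁ + t) σ′)
    conclude (t , σ′ , x , inv , i≡0 , le) = _ , σ′ , (size ⨾ x) , λ {t₁} t₁≤ → s≡ , p≡ , others ,
      (λ {u} lt → table (subst (_≤ u) (sym i≡0) z≤n) lt) , (begin
        t₁ + (2 + t)                  ≤⟨ +-mono-≤ t₁≤ (+-monoʳ-≤ 2 (≤-trans (m≤m+n t _) le)) ⟩
        8 + 9 * s + (5 + 14 * n)      ≡⟨ solve 2 (λ a b → con 8 :+ a :+ (con 5 :+ b) := con 13 :+ a :+ b) refl (9 * s) (14 * n) ⟩
        13 + 9 * s + 14 * n           ∎)
      where
      open TableInv inv
      open ≤-Reasoning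
      open +-*-Solver

  initialise-ends : ∀ {σ} → Blank σ → Ends initialiseᶜ σ Initialised
  initialise-ends {σ} blank = tables (root-ends blank)
    where
    tables : Ends rootᶜ σ (λ t σ′ → reg σ′ rS ≡ s × Blank σ′ × t ≤ 8 + 9 * s) → Ends initialiseᶜ σ Initialised
    tables (t₁ , σ₁ , x₁ , s≡₁ , blank₁ , t₁≤) = conclude (table-ends s≡₁ blank₁)
      where
      conclude : Ends (size rI ⨾ while rI tableᶜ) σ₁ (λ t σ′ → ∀ {t₁} → t₁ ≤ 8 + 9 * s → Initialised (t₁ + t) σ′) →
                 Ends initialiseᶜ σ Initialised
      conclude (t₂ , σ₂ , x₂ , h) = t₁ + t₂ , σ₂ , (x₁ ⨾ x₂) , h t₁≤

-- The total running time

module Main (ν μ f C : ℕ) (list≤ν : 3 + cost listBodyᶜ ≤ ν) (row≤f : 3 + cost rowBodyᶜ ≤ f)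
  (pop≤μ : 60 + cost popᶜ ≤ μ) (touch≤C : 4 + cost (connectᶜ ⨾ touchᶜ) ≤ C) where

  c₁ κ c₂ : ℕ
  -- The summands bound the shares of `f`, of the two `γ` in `β`, of `μ` and of `γ * s` in the
  -- initial potential.
  c₁ = f + 4 * ν + μ + 8 * ν
  -- Addresses are below 12 + (9H + 8)n + n, where H ≤ (2c₁ + 6)n³; 21 is 12 + 8 + 1. The exponent
  -- has to be at least 4.
  κ  = 9 * (2 * c₁ + 6) + 21
  -- 38 = 15 + 9 + 14 covers the initialisation, `C` the n² calls, `c₁` the potential.
  c₂ = 38 + C + c₁

  A : Algorithm
  A = record
    -- Cell 3 is still 0, so this saves `n` in cell 2 before cell 0 is overwritten.
    { initialise = add 2 0 3 ∷ compile 1 initialiseᶜ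
    ; insert     = compile 0 insertᶜ
    ; ordBase    = 11
    ; κ          = κ }

  module _ (n s : ℕ) (1≤n : 1 ≤ n) (R : IsRoot n s) where

    private instance
      n-nonZero : NonZero n
      n-nonZero = >-nonZero 1≤n

    γ₀ β₀ B H W : ℕ
    γ₀ = ν * (s + 1)
    β₀ = f * s + (γ₀ + γ₀)
    B  = n * (β₀ * n + μ * n + γ₀ * s)
    -- `B` bounds stack and lists; `5 * n` covers s * s and n + 2 * s, by 2 * s ≤ s * s ≤ 4 * n.
    H  = suc (B + 5 * n)
    W  = κ * n ^ κ

    private
      s² : s * s ≤ 4 * n
      s² = root²≤4n 1≤n R
      1≤s : 1 ≤ s
      1≤s = <-trans (s≤s z≤n) (2≤s R)

    B<H : B < H
    B<H = s≤s (m≤m+n B (5 * n))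

    s²≤H : s * s ≤ H
    s²≤H = ≤-trans s² (≤-trans (*-monoˡ-≤ n (m≤m+n 4 1)) (≤-trans (m≤n+m (5 * n) B) (n≤1+n _)))

    n+2s≤H : n + s + s ≤ H
    n+2s≤H = begin
      n + s + s      ≡⟨ +-assoc n s s ⟩
      n + (s + s)    ≡⟨ cong (λ z → n + (s + z)) (+-identityʳ s) ⟨
      n + 2 * s      ≤⟨ +-monoʳ-≤ n (≤-trans (*-monoˡ-≤ s (2≤s R)) s²) ⟩
      5 * n          ≤⟨ ≤-trans (m≤n+m (5 * n) B) (n≤1+n _) ⟩
      H              ∎
      where open ≤-Reasoning

    s≤2n : s ≤ 2 * n
    s≤2n = ≮⇒≥ λ lt → <⇒≱ (*-mono-< lt lt) (begin
      s * s                ≤⟨ s² ⟩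
      4 * n                ≤⟨ m≤m*n (4 * n) n ⟩
      4 * n * n            ≡⟨ solve 1 (λ n → con 4 :* n :* n := con 2 :* n :* (con 2 :* n)) refl n ⟩
      2 * n * (2 * n)      ∎)
      where
      open ≤-Reasoning
      open +-*-Solver

    γ≤ : γ₀ ≤ 2 * ν * s
    γ≤ = begin
      ν * (s + 1)     ≤⟨ *-monoʳ-≤ ν (+-monoʳ-≤ s 1≤s) ⟩
      ν * (s + s)     ≡⟨ solve 2 (λ ν s → ν :* (s :+ s) := con 2 :* ν :* s) refl ν s ⟩
      2 * ν * s       ∎
      where
      open ≤-Reasoning
      open +-*-Solver

    B≤ : B ≤ c₁ * (n * n * s)
    B≤ = begin
      n * (β₀ * n + μ * n + γ₀ * s)
        ≤⟨ *-monoʳ-≤ n (+-mono-≤ (+-mono-≤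
             (*-monoˡ-≤ n (+-monoʳ-≤ (f * s) (+-mono-≤ γ≤ γ≤)))
             (*-monoʳ-≤ μ (m≤n*m n s {{>-nonZero 1≤s}})))
             (≤-trans (*-monoˡ-≤ s γ≤) γs)) ⟩
      n * ((f * s + (2 * ν * s + 2 * ν * s)) * n + μ * (s * n) + 8 * ν * (s * n))
        ≡⟨ solve 5 (λ n s f ν μ → n :* ((f :* s :+ (con 2 :* ν :* s :+ con 2 :* ν :* s)) :* n :+ μ :* (s :* n) :+ con 8 :* ν :* (s :* n))
             := (f :+ con 4 :* ν :+ μ :+ con 8 :* ν) :* (n :* n :* s)) refl n s f ν μ ⟩
      c₁ * (n * n * s) ∎
      where
      open ≤-Reasoning
      open +-*-Solver
      γs : 2 * ν * s * s ≤ 8 * ν * (s * n)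
      γs = begin
        2 * ν * s * s         ≡⟨ *-assoc (2 * ν) s s ⟩
        2 * ν * (s * s)       ≤⟨ *-monoʳ-≤ (2 * ν) (≤-trans s² (*-monoʳ-≤ 4 (m≤n*m n s {{>-nonZero 1≤s}}))) ⟩
        2 * ν * (4 * (s * n)) ≡⟨ solve 2 (λ ν x → con 2 :* ν :* (con 4 :* x) := con 8 :* ν :* x) refl ν (s * n) ⟩
        8 * ν * (s * n)       ∎

    word : 11 + ((H * 9 + 8) * n + n) < W
    word = begin
      12 + ((H * 9 + 8) * n + n)
        ≤⟨ +-mono-≤ (*-monoʳ-≤ 12 1≤q) (+-mono-≤ (*-monoˡ-≤ n (+-mono-≤ (*-monoˡ-≤ 9 H≤) (*-monoʳ-≤ 8 1≤m))) n≤q) ⟩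
      12 * q + (((2 * c₁ + 6) * m * 9 + 8 * m) * n + q)
        ≡⟨ solve 2 (λ c n → con 12 :* (n :* n :* n :* n) :+ (((con 2 :* c :+ con 6) :* (n :* n :* n) :* con 9 :+ con 8 :* (n :* n :* n)) :* n :+ (n :* n :* n :* n))
             := (con 9 :* (con 2 :* c :+ con 6) :+ con 21) :* (n :* n :* n :* n)) refl c₁ n ⟩
      κ * q
        ≡⟨ cong (κ *_) (solve 1 (λ n → n :* n :* n :* n := n :* (n :* (n :* (n :* con 1)))) refl n) ⟩
      κ * n ^ 4
        ≤⟨ *-monoʳ-≤ κ (^-monoʳ-≤ n (≤-trans (m≤m+n 4 17) (m≤n+m 21 (9 * (2 * c₁ + 6))))) ⟩
      W ∎
      where
      open ≤-Reasoning
      open +-*-Solver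
      m = n * n * n
      q = m * n
      1≤m : 1 ≤ m
      1≤m = *-mono-≤ (*-mono-≤ 1≤n 1≤n) 1≤n
      n≤q : n ≤ q
      n≤q = m≤n*m n m {{>-nonZero 1≤m}}
      1≤q : 1 ≤ q
      1≤q = *-mono-≤ 1≤m 1≤n
      n≤m : n ≤ m
      n≤m = m≤n*m n (n * n) {{>-nonZero (*-mono-≤ 1≤n 1≤n)}}
      H≤ : H ≤ (2 * c₁ + 6) * m
      H≤ = begin
        1 + (B + 5 * n)
          ≤⟨ +-mono-≤ 1≤m (+-mono-≤ (≤-trans B≤ (*-monoʳ-≤ c₁ (*-monoʳ-≤ (n * n) s≤2n))) (*-monoʳ-≤ 5 n≤m)) ⟩
        m + (c₁ * (n * n * (2 * n)) + 5 * m)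
          ≡⟨ solve 2 (λ c n → n :* n :* n :+ (c :* (n :* n :* (con 2 :* n)) :+ con 5 :* (n :* n :* n))
               := (con 2 :* c :+ con 6) :* (n :* n :* n)) refl c₁ n ⟩
        (2 * c₁ + 6) * m ∎

    open Machine n H W word
    open _≈_

    module _ (es₀ : List (Edge n)) (acyclic : Acyclic es₀) where

      private
        τ-data = topological-numbering es₀ acyclic
      τ : ℕ → ℕ
      τ = proj₁ τ-data
      τ<n : ∀ {u} → u < n → τ u < n
      τ<n = proj₁ (proj₂ τ-data)
      τ-injective : ∀ {u v} → u < n → v < n → τ u ≡ τ v → u ≡ v
      τ-injective = proj₁ (proj₂ (proj₂ τ-data))
      τ-monotone : ∀ {x y} → (x , y) ∈ es₀ → τ (toℕ x) < τ (toℕ y)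
      τ-monotone = proj₂ (proj₂ (proj₂ τ-data))

      open Levelled n s (2≤s R) (n≤s² R) τ τ<n τ-injective
      open Potential ν μ f
      open Verification n s (2≤s R) (n≤s² R) τ τ<n τ-injective ν μ f list≤ν row≤f pop≤μ B H W B<H n+2s≤H word

      insertions : ∀ es past {m σ} → m ≈ σ → Ready σ → Ψ (contents σ) ≤ B →
        (∀ {x y} → (x , y) ∈ es → τ (toℕ x) < τ (toℕ y)) →
        (∀ {x y} → (x , y) ∈ past → 0 < M (lv (contents σ)) (toℕ y) (toℕ x)) →
        ∃[ t ] Algorithm.Insertions A past m es t × t ≤ C * length es + Ψ (contents σ)
      insertions [] past h ready Ψ≤B es-τ past-arcs = 0 , Algorithm.[] , z≤n
      insertions ((x , y) ∷ es) past {m} {σ} h ready Ψ≤B es-τ past-arcs =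
        inserted (insert-ends σ₁ record { works = record { valid = valid works ; pending = pending works ; width≡s = width≡s works }
                                        ; oks = oks ; empty = empty }
                   Ψ≤B (toℕ<n x) (toℕ<n y) (es-τ (here refl)))
        where
        open Ready ready
        open Work
        σ₁ = assign rW (λ _ → toℕ y) (assign rV (λ _ → toℕ x) σ)
        m₁ = (m [ 0 ↦ toℕ x ]) [ 1 ↦ toℕ y ]
        h₁ : m₁ ≈ σ₁
        h₁ = ≈-reg rW (λ _ → toℕ y) (≈-reg rV (λ _ → toℕ x) h (<-trans (toℕ<n x) n<W) refl) (<-trans (toℕ<n y) n<W) refl
        Goal : Set
        Goal = ∃[ t ] Algorithm.Insertions A past m ((x , y) ∷ es) t × t ≤ C * suc (length es) + Ψ (contents σ)
        inserted : Ends insertᶜ σ₁ (λ t σ′ → Inserted (contents σ₁) (toℕ x) (toℕ y) σ′ ×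
          t + Ψ (contents σ′) ≤ 3 + cost (connectᶜ ⨾ touchᶜ) + Ψ (contents σ)) → Goal
        inserted (t , σ′ , ev , r , le) = continued (run-program [] insertᶜ ev h₁)
          where
          open Inserted r renaming (ready to ready′)
          past-arcs′ : ∀ {a b} → (a , b) ∈ (x , y) ∷ past → 0 < M (lv (contents σ′)) (toℕ b) (toℕ a)
          past-arcs′ (here refl) = new
          past-arcs′ (there p)   = arcs (past-arcs p)
          le′ : t + 1 + Ψ (contents σ′) ≤ C + Ψ (contents σ)
          le′ = begin
            t + 1 + Ψ (contents σ′)   ≡⟨ cong (_+ Ψ (contents σ′)) (+-comm t 1) ⟩
            1 + (t + Ψ (contents σ′)) ≤⟨ +-monoʳ-≤ 1 le ⟩
            4 + cost (connectᶜ ⨾ touchᶜ) + Ψ (contents σ) ≤⟨ +-monoˡ-≤ (Ψ (contents σ)) touch≤C ⟩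
            C + Ψ (contents σ)        ∎
            where open ≤-Reasoning
          Ψ′≤B : Ψ (contents σ′) ≤ B
          Ψ′≤B = ≤-trans Ψ≤′ Ψ≤B
          continued : ∃[ m′ ] m′ ≈ σ′ × Run W (compile 0 insertᶜ) (0 , m₁) (t + 1) m′ → Goal
          continued (m′ , h′ , run) = conclude (insertions es ((x , y) ∷ past) h′ ready′ Ψ′≤B (λ p → es-τ (there p)) past-arcs′)
            where
            ordered : Algorithm.IsTopologicalOrdering A ((x , y) ∷ past) m′
            ordered {a} {b} p = subst₂ _<_ (sym (arrs h′ aK 0 (toℕ a) (toℕ<n a))) (sym (arrs h′ aK 0 (toℕ b) (toℕ<n b)))
              (ready-ordered ready′ (toℕ<n a) (toℕ<n b) (past-arcs′ p))
            conclude : ∃[ t ] Algorithm.Insertions A ((x , y) ∷ past) m′ es t × t ≤ C * length es + Ψ (contents σ′) → Goal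
            conclude (t′ , rest , t′≤) = t + 1 + t′ , Algorithm.next run ordered rest , (begin
              t + 1 + t′                                     ≤⟨ +-monoʳ-≤ (t + 1) t′≤ ⟩
              t + 1 + (C * length es + Ψ (contents σ′))      ≡⟨ solve 3 (λ a b c → a :+ (b :+ c) := b :+ (a :+ c)) refl (t + 1) (C * length es) (Ψ (contents σ′)) ⟩
              C * length es + (t + 1 + Ψ (contents σ′))      ≤⟨ +-monoʳ-≤ (C * length es) le′ ⟩
              C * length es + (C + Ψ (contents σ))           ≡⟨ solve 3 (λ c l p → c :* l :+ (c :+ p) := c :* (con 1 :+ l) :+ p) refl C (length es) (Ψ (contents σ)) ⟩
              C * suc (length es) + Ψ (contents σ)           ∎)
              where
              open ≤-Reasoning
              open +-*-Solver

      -- The initial potential is the whole budget; no later operation increases it.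
      start-levels : ∀ {t₀ σ} → Initialisation.Initialised n s R H W s²≤H word t₀ σ → Ready σ × Ψ (contents σ) ≡ B
      start-levels {t₀} {σ} (s≡ , p≡ , others , table , _) = record
        { works = record
          { valid = start-core
          ; pending = record
            { stacked = λ u<n p → ⊥-elim (<⇒≢ p (sym (zero-at aPend 0 _ λ ())))
            ; stack<n = λ lt → ⊥-elim (<⇒≱ lt (subst (_≤ _) (sym p≡) z≤n)) }
          ; width≡s = s≡ }
        ; oks = λ _ _ arc → ⊥-elim (no-arc arc)
        ; empty = p≡ } , start-Ψ
        where
        D = lv (contents σ)
        zero-at : ∀ a i v → column a ≢ 1 → arr σ a i v ≡ 0
        zero-at = others
        no-arc : ∀ {w u} → ¬ 0 < M D w u
        no-arc {w} {u} p = <⇒≢ p (sym (zero-at aM w u λ ()))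
        0<s : 0 < s
        0<s = 1≤s
        start-core : Core D
        start-core = record
          { k<t    = λ {u} u<n → subst₂ _<_ (sym (zero-at aK 0 u λ ())) (sym (table u<n)) 0<s
          ; t≤k+s  = λ {u} u<n → subst (_≤ k D u + s) (sym (table u<n)) (m≤n+m s (k D u))
          ; t-mult = λ u<n → 1 , trans (table u<n) (sym (+-identityʳ s))
          ; k≤τ    = λ {u} _ → subst (_≤ τ u) (sym (zero-at aK 0 u λ ())) z≤n
          ; arc-τ  = λ _ _ p → ⊥-elim (no-arc p)
          ; M≤t    = λ {u} {w} _ _ → subst (_≤ t D u) (sym (zero-at aM w u λ ())) z≤n
          ; counts = λ {w} _ → [] , [] , [] , sym (zero-at aC 0 w λ ())
          ; c<s    = λ {w} _ → subst (_< s) (sym (zero-at aC 0 w λ ())) 0<s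
          ; listed = λ {u} {w} u<n _ e → ⊥-elim (<⇒≢ 0<s (trans (sym (zero-at aM w u λ ())) (trans e (table u<n))))
          ; entry  = λ {u} {i} _ lt → ⊥-elim (<⇒≱ lt (subst (_≤ i) (sym (zero-at aLen 0 u λ ())) z≤n))
          ; pend≤1 = λ {u} _ → subst (_≤ 1) (sym (zero-at aPend 0 u λ ())) z≤n }
        start-φ : ∀ u → u < n → φ D u ≡ β₀ * n + μ * n + γ₀ * s
        start-φ u u<n rewrite table u<n | zero-at aK 0 u (λ ()) | zero-at aC 0 u (λ ())
          | zero-at aLen 0 u (λ ()) | zero-at aFull 0 u (λ ()) | m+n∸n≡m n s
          | *-zeroʳ (ν * (s + arr σ aPend 0 u)) = trans (+-identityʳ _) (+-identityʳ _)
        start-Ψ : Ψ (contents σ) ≡ B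
        start-Ψ = trans (cong₂ _+_ (Σ<-const n _ start-φ) (trans (cong (μ *_) p≡) (*-zeroʳ μ))) (+-identityʳ B)

      m₀ : Memory
      m₀ = (λ _ → 0) [ 0 ↦ n ]

      σ₀ : State
      σ₀ = mkState (λ r → m₀ (cell r)) (λ _ _ _ → 0)

      start-≈ : m₀ [ 2 ↦ n + 0 ] ≈ σ₀
      start-≈ = record
        { regs  = λ { rV → refl ; rW → refl ; rS → refl ; rP → refl ; rI → refl ; rQ → refl ; rA → refl ; rB → refl }
        ; arrs  = λ _ _ _ _ → refl
        ; order = +-identityʳ n
        ; words = words-update 2 (words-update 0 (λ _ → small z≤n) n<W) (subst (_< W) (sym (+-identityʳ n)) n<W) }

      maintained : Unique es₀ → ∃[ t ] Algorithm.MaintainsIn A n es₀ t × t ≤ c₂ * (n * n * s)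
      maintained unique = initialised (Initialisation.initialise-ends n s R H W s²≤H word {σ₀} (refl , λ _ _ _ → refl))
        where
        Goal : Set
        Goal = ∃[ t ] Algorithm.MaintainsIn A n es₀ t × t ≤ c₂ * (n * n * s)
        initialised : Ends initialiseᶜ σ₀ (Initialisation.Initialised n s R H W s²≤H word) → Goal
        initialised (t , σ , ev , init) = started (start-levels init) (run-program (add 2 0 3 ∷ []) initialiseᶜ ev start-≈)
          where
          t≤ : t ≤ 13 + 9 * s + 14 * n
          t≤ = proj₂ (proj₂ (proj₂ (proj₂ init)))
          started : Ready σ × Ψ (contents σ) ≡ B →
            ∃[ m ] m ≈ σ × Run W (add 2 0 3 ∷ compile 1 initialiseᶜ) (1 , m₀ [ 2 ↦ n + 0 ]) (t + 1) m → Goal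
          started (ready , Ψ≡B) (m , h , run) = conclude (insertions es₀ [] h ready (≤-reflexive Ψ≡B) τ-monotone λ ())
            where
            conclude : ∃[ t′ ] Algorithm.Insertions A [] m es₀ t′ × t′ ≤ C * length es₀ + Ψ (contents σ) → Goal
            conclude (t′ , rest , t′≤) = suc (t + 1) + t′ ,
              (suc (t + 1) , m , t′ , step refl (add (subst (_< W) (sym (+-identityʳ n)) n<W)) run , rest , refl) , (begin
                suc (t + 1) + t′
                  ≡⟨ cong (λ z → suc z + t′) (+-comm t 1) ⟩
                2 + t + t′
                  ≤⟨ +-mono-≤ (+-monoʳ-≤ 2 t≤) (≤-trans t′≤ (+-mono-≤ (*-monoʳ-≤ C (length-edges unique)) (≤-trans (≤-reflexive Ψ≡B) B≤))) ⟩
                15 + 9 * s + 14 * n + (C * (n * n) + c₁ * x)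
                  ≤⟨ +-mono-≤ (+-mono-≤ (+-mono-≤ (*-monoʳ-≤ 15 1≤x) (*-monoʳ-≤ 9 s≤x)) (*-monoʳ-≤ 14 n≤x)) (+-monoˡ-≤ (c₁ * x) (*-monoʳ-≤ C nn≤x)) ⟩
                15 * x + 9 * x + 14 * x + (C * x + c₁ * x)
                  ≡⟨ solve 3 (λ C c x → con 15 :* x :+ con 9 :* x :+ con 14 :* x :+ (C :* x :+ c :* x) := (con 38 :+ C :+ c) :* x) refl C c₁ x ⟩
                c₂ * x ∎)
              where
              open ≤-Reasoning
              open +-*-Solver
              x = n * n * s
              1≤nn : 1 ≤ n * n
              1≤nn = *-mono-≤ 1≤n 1≤n
              nn≤x : n * n ≤ x
              nn≤x = m≤m*n (n * n) s {{>-nonZero 1≤s}}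
              n≤x : n ≤ x
              n≤x = ≤-trans (m≤m*n n n) nn≤x
              s≤x : s ≤ x
              s≤x = m≤n*m s (n * n) {{>-nonZero 1≤nn}}
              1≤x : 1 ≤ x
              1≤x = ≤-trans 1≤nn nn≤x

    -- s * s ≤ 4 * n replaces `s` by twice the square root of `n`, hence the factor 2.
    squared : ∀ {t} → t ≤ c₂ * (n * n * s) → t ≤ 2 * c₂ · n ^5/2
    squared {t} le = begin
      t ^ 2
        ≤⟨ ^-monoˡ-≤ 2 le ⟩
      (c₂ * (n * n * s)) ^ 2
        ≡⟨ solve 3 (λ c n s → (c :* (n :* n :* s)) :* ((c :* (n :* n :* s)) :* con 1) := c :* c :* (n :* n :* n :* n) :* (s :* s)) refl c₂ n s ⟩
      c₂ * c₂ * (n * n * n * n) * (s * s)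
        ≤⟨ *-monoʳ-≤ (c₂ * c₂ * (n * n * n * n)) s² ⟩
      c₂ * c₂ * (n * n * n * n) * (4 * n)
        ≡⟨ solve 2 (λ c n → c :* c :* (n :* n :* n :* n) :* (con 4 :* n) := (con 2 :* c) :* ((con 2 :* c) :* con 1) :* (n :* (n :* (n :* (n :* (n :* con 1)))))) refl c₂ n ⟩
      (2 * c₂) ^ 2 * n ^ 5 ∎
      where
      open ≤-Reasoning
      open +-*-Solver

  conclusion : Σ[ A ∈ Algorithm ] ∃[ c ]
    ((n : ℕ) → 1 ≤ n →
    (es : List (Edge n)) → Unique es → Acyclic es →
    ∃[ t ] (Algorithm.MaintainsIn A n es t × t ≤ c · n ^5/2))
  conclusion = A , 2 * c₂ , λ n 1≤n es unique acyclic →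
    let s , R = root n
        t , m , le = maintained n s 1≤n R es acyclic unique
    in t , m , squared n s 1≤n R le

theorem1 : Σ[ A ∈ Algorithm ] ∃[ c ]
    ((n : ℕ) → 1 ≤ n →
    (es : List (Edge n)) → Unique es → Acyclic es →
    ∃[ t ] (Algorithm.MaintainsIn A n es t × t ≤ c · n ^5/2))
-- Each loop constant is the cost of one round plus 3 for the test and the jump back.
theorem1 = Main.conclusion (3 + cost listBodyᶜ) (60 + cost popᶜ) (3 + cost rowBodyᶜ) (4 + cost (connectᶜ ⨾ touchᶜ))
  ≤-refl ≤-refl ≤-refl ≤-refl
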